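{- Let $C>0$ be a constant. Let $G$ be a connected $(n,d,\lambda)$ graph (with $n \to \infty$) such that $\lambda \le C\sqrt{d}$ and $d \ge 2C\sqrt{n \ln^{1/9} n}$. Then for any vertex $v$ of $G$, with probability $1-o(1)$, $$|T(G,v) - (\log_2 n + \ln n)| = o(\ln n).$$
   Context: An $(n,d,\lambda)$ graph is a $d$-regular graph on $n$ vertices whose adjacency matrix has eigenvalues $\lambda_1 = d \ge \lambda_2 \ge \dots \ge \lambda_n$ (real, as the matrix is symmetric), with $\lambda := \max_{2 \le i \le n}|\lambda_i|$. Push model: initially only the vertex $v$ is informed; in each round every informed vertex independently chooses a neighbor uniformly at random and transmits the information to it. $T(G,v)$ is the number of rounds until all vertices are informed. The hypotheses hold for all sufficiently large $n$; asymptotic notation refers to $n \to \infty$, and the probability is over the random choices of the protocol. -}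

module Defs where

open import Algebra.Bundles using (CommutativeRing; Semiring)
import Algebra.Definitions.RawSemiring as RawSemiringDefinitions
import Algebra.Properties.Semiring.Sum as SemiringSum
open import Data.Bool.Base using (Bool; false; T; if_then_else_)
open import Data.Fin.Base as Fin using (Fin; zero; suc)
import Data.Fin.Properties as Fin
open import Data.List.Base as List using (List; []; _∷_; length; filterᵇ; allFin; cartesianProductWith)
open import Data.Nat.Base as ℕ using (ℕ; zero; suc; NonZero; _!)
open import Data.Nat.Properties using (_!≢0)
open import Data.Product.Base using (Σ; Σ-syntax; ∃-syntax; _×_; _,_; proj₁; proj₂)
open import Data.Sum.Base using (_⊎_)
open import Data.Vec.Base as Vec using (Vec; []; _∷_)
import Data.Vec.Functional as Vector
open import Level using (Level; _⊔_) renaming (suc to lsuc)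
open import Relation.Binary.Construct.Closure.ReflexiveTransitive using (Star)
open import Relation.Binary.Core using (Rel)
open import Relation.Binary.PropositionalEquality.Core using (_≡_)
open import Relation.Binary.Structures using (IsStrictPartialOrder)
open import Relation.Nullary.Decidable.Core using (does)
open import Relation.Nullary.Negation.Core using (¬_)

-- Archimedean, Cauchy-complete ordered fields: the axiomatic description of
-- the real numbers, which determines them up to unique isomorphism.  The
-- axioms are phrased so that they hold both for the classical reals and for
-- the constructive (Cauchy/Bishop) reals; in particular the order is not
-- assumed decidable, which is why cotransitivity, tightness and binary joins
-- are listed.
record CompleteOrderedField (c ℓ₁ ℓ₂ : Level) : Set (lsuc (c ⊔ ℓ₁ ⊔ ℓ₂)) where
  field
    commutativeRing : CommutativeRing c ℓ₁

  open CommutativeRing commutativeRing public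

  open RawSemiringDefinitions (Semiring.rawSemiring semiring) public
    using (_^_) renaming (_×_ to _·_)
  open SemiringSum semiring public
    using (sum)

  infix  4 _<_ _≤_
  infixl 6 _∨_

  field
    _<_                  : Rel Carrier ℓ₂
    isStrictPartialOrder : IsStrictPartialOrder _≈_ _<_
    cotransitive         : ∀ {x y} → x < y → ∀ z → x < z ⊎ z < y
    tight                : ∀ {x y} → ¬ (x < y) → ¬ (y < x) → x ≈ y
    0<1                  : 0# < 1#
    +-monoˡ-<            : ∀ {x y} z → x < y → x + z < y + z
    *-pos                : ∀ {x y} → 0# < x → 0# < y → 0# < x * y
    inverse              : ∀ {x} → 0# < x → Σ[ y ∈ Carrier ] (0# < y × x * y ≈ 1#)

  _≤_ : Rel Carrier ℓ₂
  x ≤ y = ¬ (y < x)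

  field
    _∨_     : Carrier → Carrier → Carrier
    x≤x∨y   : ∀ x y → x ≤ x ∨ y
    y≤x∨y   : ∀ x y → y ≤ x ∨ y
    ∨-least : ∀ {x y z} → x ≤ z → y ≤ z → x ∨ y ≤ z

  ∣_∣ : Carrier → Carrier
  ∣ x ∣ = x ∨ (- x)

  fromℕ : ℕ → Carrier
  fromℕ n = n · 1#

  Converges : (ℕ → Carrier) → Carrier → Set (c ⊔ ℓ₂)
  Converges s x = ∀ ε → 0# < ε → Σ[ N ∈ ℕ ] (∀ k → N ℕ.≤ k → ∣ s k - x ∣ < ε)

  Cauchy : (ℕ → Carrier) → Set (c ⊔ ℓ₂)
  Cauchy s = ∀ ε → 0# < ε →
    Σ[ N ∈ ℕ ] (∀ j k → N ℕ.≤ j → N ℕ.≤ k → ∣ s j - s k ∣ < ε)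

  field
    archimedean : ∀ x → Σ[ n ∈ ℕ ] (x < fromℕ n)
    complete    : ∀ s → Cauchy s → Σ[ x ∈ Carrier ] Converges s x

  recip : ∀ x → 0# < x → Carrier
  recip x 0<x = proj₁ (inverse 0<x)

  0<fromℕ : ∀ n → 0# < fromℕ (suc n)
  0<fromℕ zero    = proj₁ <-resp-≈ (sym (+-identityʳ 1#)) 0<1
    where open IsStrictPartialOrder isStrictPartialOrder using (<-resp-≈)
  0<fromℕ (suc n) = <-trans (0<fromℕ n)
    (proj₂ <-resp-≈ (+-identityˡ _) (+-monoˡ-< (fromℕ (suc n)) 0<1))
    where open IsStrictPartialOrder isStrictPartialOrder
            using (<-resp-≈) renaming (trans to <-trans)

  0<fromℕ′ : ∀ n .{{_ : NonZero n}} → 0# < fromℕ n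
  0<fromℕ′ (suc n) = 0<fromℕ n

  expTerm : Carrier → ℕ → Carrier
  expTerm x k = x ^ k * recip (fromℕ (k !)) (0<fromℕ′ (k !) {{k !≢0}})

  -- y = exp x
  IsExp : Carrier → Carrier → Set (c ⊔ ℓ₂)
  IsExp x y = Converges (λ m → sum {m} (λ k → expTerm x (Fin.toℕ k))) y

-- The reals with named k-th roots and natural logarithm.  root-nonneg and
-- root-^ determine root k on [0,∞), and exp-ln determines ln on (0,∞); ln-pos
-- is a consequence, recorded so that division by ln 2 makes sense.
record Reals (c ℓ₁ ℓ₂ : Level) : Set (lsuc (c ⊔ ℓ₁ ⊔ ℓ₂)) where
  field
    completeOrderedField : CompleteOrderedField c ℓ₁ ℓ₂

  open CompleteOrderedField completeOrderedField public

  field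
    root        : (k : ℕ) .{{_ : NonZero k}} → Carrier → Carrier
    root-nonneg : ∀ k .{{_ : NonZero k}} {x} → 0# ≤ x → 0# ≤ root k x
    root-^      : ∀ k .{{_ : NonZero k}} {x} → 0# ≤ x → root k x ^ k ≈ x
    ln          : ∀ x → 0# < x → Carrier
    exp-ln      : ∀ x (0<x : 0# < x) → IsExp (ln x 0<x) x
    ln-pos      : ∀ x (0<x : 0# < x) → 1# < x → 0# < ln x 0<x

  √_ : Carrier → Carrier
  √ x = root 2 x

  infix 9 √_

  lnℕ : (n : ℕ) .{{_ : NonZero n}} → Carrier
  lnℕ n = ln (fromℕ n) (0<fromℕ′ n)

  0<ln2 : 0# < lnℕ 2
  0<ln2 = ln-pos (fromℕ 2) (0<fromℕ′ 2)
    (proj₁ <-resp-≈ (+-congˡ (sym (+-identityʳ 1#)))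
      (proj₂ <-resp-≈ (+-identityˡ 1#) (+-monoˡ-< 1# 0<1)))
    where open IsStrictPartialOrder isStrictPartialOrder using (<-resp-≈)

  log₂ℕ : (n : ℕ) .{{_ : NonZero n}} → Carrier
  log₂ℕ n = lnℕ n * recip (lnℕ 2) 0<ln2

record Graph (n : ℕ) : Set where
  field
    adj    : Fin n → Fin n → Bool
    symm   : ∀ u w → adj u w ≡ adj w u
    irrefl : ∀ u → adj u u ≡ false

  Adj : Fin n → Fin n → Set
  Adj u w = T (adj u w)

  neighbours : Fin n → List (Fin n)
  neighbours u = filterᵇ (adj u) (allFin n)

  Regular : ℕ → Set
  Regular d = ∀ u → length (neighbours u) ≡ d

  Connected : Set
  Connected = ∀ u w → Star Adj u w

module PushModel {n : ℕ} (G : Graph n) where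
  open Graph G

  -- A realisation of all random choices: in round t (counted from 0), vertex
  -- u chooses its neighbour choice t u.  Choices of uninformed vertices are drawn
  -- as well but have no effect.
  record Run : Set where
    field
      choice : ℕ → Fin n → Fin n
      valid  : ∀ t u → Adj u (choice t u)

  open Run public

  Informed : Fin n → Run → ℕ → Fin n → Set
  Informed v ω zero    u = u ≡ v
  Informed v ω (suc t) u =
    Informed v ω t u ⊎ (∃[ w ] (Informed v ω t w × choice ω t w ≡ u))

  -- T(G,v) = t on the run ω
  _BroadcastTime_is_ : Fin n → Run → ℕ → Set
  v BroadcastTime ω is t =
    (∀ u → Informed v ω t u) × (∀ s → s ℕ.< t → ¬ (∀ u → Informed v ω s u))

  Round : Set
  Round = Vec (Fin n) n

  product : ∀ {a} {A : Set a} {k} → Vec (List A) k → List (Vec A k)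
  product []         = [] ∷ []
  product (xs ∷ xss) = cartesianProductWith _∷_ xs (product xss)

  rounds : List Round
  rounds = product (Vec.tabulate neighbours)

  -- All possible outcomes of the first h rounds, each listed once.  The
  -- uniform distribution on this list is the product distribution: all
  -- choices independent, each uniform among the neighbours.
  histories : ∀ h → List (Vec Round h)
  histories h = product (Vec.replicate h rounds)

  prefix : ∀ h → Run → Vec Round h
  prefix h ω = Vec.tabulate (λ t → Vec.tabulate (choice ω (Fin.toℕ t)))

module _ {c ℓ₁ ℓ₂} (ℝ : Reals c ℓ₁ ℓ₂) where
  open Reals ℝ

  module _ {n : ℕ} (G : Graph n) where
    open PushModel G

    -- "The event E has probability at least p".  Runs are infinite, so the
    -- probability of E is bounded below through an event D ⊆ E that is
    -- decided by finitely many rounds h and so has probability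
    -- #D / #histories.  If E itself depends on the first h rounds only (as
    -- does every event forcing an upper bound on the broadcast time), D = E
    -- is the best choice.
    Prob≥ : ∀ {e} → Carrier → (Run → Set e) → Set (ℓ₂ ⊔ e)
    Prob≥ p E =
      Σ[ h ∈ ℕ ] Σ[ D ∈ (Vec Round h → Bool) ]
        ( (∀ ω → T (D (prefix h ω)) → E ω)
        × p * fromℕ (length (histories h)) ≤ fromℕ (length (filterᵇ D (histories h))) )

  Matrix : ℕ → Set c
  Matrix n = Fin n → Fin n → Carrier

  adjacency : ∀ {n} → Graph n → Matrix n
  adjacency G u w = if Graph.adj G u w then 1# else 0#

  ⟨_,_⟩ : ∀ {n} → (Fin n → Carrier) → (Fin n → Carrier) → Carrier
  ⟨ x , y ⟩ = sum (λ u → x u * y u)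

  -- The eigenvalues of a real symmetric matrix in non-increasing order,
  -- repeated according to multiplicity: value i belongs to the i-th member of
  -- an orthonormal basis of eigenvectors.
  record Spectrum {n} (A : Matrix n) : Set (c ⊔ ℓ₁ ⊔ ℓ₂) where
    field
      value       : Fin n → Carrier
      vector      : Fin n → Fin n → Carrier
      eigen       : ∀ i u → ⟨ A u , vector i ⟩ ≈ value i * vector i u
      orthonormal : ∀ i j → ⟨ vector i , vector j ⟩ ≈ (if does (i Fin.≟ j) then 1# else 0#)
      spanning    : ∀ (x : Fin n → Carrier) u → x u ≈ sum (λ i → ⟨ x , vector i ⟩ * vector i u)
      descending  : ∀ i j → i Fin.≤ j → value j ≤ value i

  -- The maximum starts from 0, which only matters for one-vertex graphs.
  record IsNdλGraph {m} (G : Graph (suc m)) (d : ℕ) (lam : Carrier) : Set (c ⊔ ℓ₁ ⊔ ℓ₂) where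
    field
      regular  : Graph.Regular G d
      spectrum : Spectrum (adjacency G)
    open Spectrum spectrum
    field
      λ₁≈d     : value Fin.zero ≈ fromℕ d
      lam≈max  : lam ≈ Vector.foldr _∨_ 0# (λ (i : Fin m) → ∣ value (suc i) ∣)

Eventually : ∀ {p} → (ℕ → Set p) → Set p
Eventually P = Σ[ N ∈ ℕ ] (∀ i → N ℕ.≤ i → P i)

TendsToInfinity : (ℕ → ℕ) → Set
TendsToInfinity f = ∀ K → Eventually (λ i → K ℕ.≤ f i)

{-# OPTIONS --safe #-}

-- Only two consequences of the hypotheses matter: d → ∞ and λ/d → 0.  Let S be
-- the informed set, U its complement and p = (1 - 1/d)^d.
--
-- Upper bound.  A vertex with k informed neighbours is missed in a round with
-- probability (1 - 1/d)^k.  The spectral bounds on e(S,S), e(U,U) and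
-- Σ deg_S(u)² give E|S'| ≥ (2 - o(1))|S| while |S| = o(n); since
-- |S| ≤ |S'| ≤ 2|S|, convexity of 1/x turns this into E[1/|S'|] ≤
-- (1/2 + o(1))/|S|, so Markov's inequality for 1/|S| shows that about log₂ n
-- rounds reach linear size.  The chord bound on k ↦ (1 - 1/d)^k gives E|U'| ≤
-- (p + (1 - p)(|U|/n + λ/d))|U|: a bounded number of rounds makes |U|/n small,
-- after which |U| shrinks by a factor close to p ≈ 1/e and about ln n rounds
-- suffice.
--
-- Lower bound.  |S| at most doubles, so half of the vertices are uninformed
-- after log₂ n - O(1) rounds.  Among them, those never chosen by any vertex
-- during the next (1 - ε) ln n rounds number n^(ε - o(1)) on average, and the
-- events of never being chosen are negatively correlated, so Chebyshev's
-- inequality applies.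
--
-- All comparisons with ln n are made through exp: for x ≥ 0 it is the supremum
-- of its partial sums, and 1 + x ≤ exp x ≤ 1/(1 - x) locates d ln(d/(d-1))
-- between 1 and d/(d-1).

module Submission where

open import Algebra.Bundles using (CommutativeRing)
import Algebra.Properties.CommutativeSemigroup as CommutativeSemigroupProperties
import Algebra.Properties.CommutativeSemiring.Exp as CommutativeSemiringExp
import Algebra.Properties.Ring as RingProperties
import Algebra.Properties.Semiring.Exp as SemiringExp
import Algebra.Properties.Semiring.Mult as SemiringMult
import Algebra.Properties.Semiring.Sum as SemiringSum
import Algebra.Solver.Ring as RingSolver
open import Algebra.Solver.Ring.AlmostCommutativeRing using (fromCommutativeRing; _-Raw-AlmostCommutative⟶_)
open import Data.Bool.Base using (Bool; true; false; not; _∧_; _∨_; if_then_else_; T)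
open import Data.Empty using (⊥-elim)
open import Data.Fin.Base as Fin using (Fin; zero; suc)
import Data.Fin.Properties as Fin
open import Data.Integer.Base as ℤ using (ℤ; +_; -[1+_]; +[1+_]; _⊖_; _◃_)
import Data.Integer.Properties as ℤ
open import Data.List.Base as List using (List; []; _∷_; length; filterᵇ; cartesianProductWith; _++_)
open import Data.Maybe.Base using (Maybe; just; nothing)
open import Data.Nat.Base as ℕ using (ℕ; zero; suc; _!; NonZero)
import Data.Nat.Properties as ℕ
open import Data.Product.Base using (Σ-syntax; ∃-syntax; _×_; _,_; proj₁; proj₂)
import Data.Sign.Base as Sign
open import Data.Sum.Base using (inj₁; inj₂; [_,_]′)
open import Data.Unit.Base using (tt)
open import Data.Vec.Base as Vec using (Vec; []; _∷_)
import Data.Vec.Functional as Vector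
open import Data.Vec.Properties using (lookup∘tabulate; lookup-replicate)
open import Defs
open import Level using (_⊔_)
open import Relation.Binary.PropositionalEquality.Core as ≡ using (_≡_; _≢_)
import Relation.Binary.Reasoning.Base.Triple as TripleReasoning
import Relation.Binary.Reasoning.Setoid as SetoidReasoning
open import Relation.Binary.Structures using (IsPreorder; IsStrictPartialOrder)
open import Relation.Nullary.Decidable.Core using (yes; no; does; Dec)
open import Relation.Nullary.Negation.Core using (¬_)

-- A lower bound on the mean of |S'| does not by itself bound the time to reach linear size, since
-- the mean could be carried by a few large outcomes; a contracting potential such as 1/|S| excludes
-- this, because iterating a contraction needs nothing but conditional expectations. The growth
-- estimate fails once |S| is a constant fraction of n, so the potential has to be cut off there.
-- Every spectral estimate loses an error θ ≥ λ/d, which is why the cut-offs lie at the fraction 2θ: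
-- when the middle phase starts, uninformed fraction plus error is at most (1 - 2θ) + θ, still
-- bounded away from 1. The cut-offs and the length of the middle phase depend on ε and δ only, so
-- they cost O(1) rounds against ln n.
--
-- The order of the field is not decidable. Events are therefore Boolean comparisons of natural
-- numbers, integer parts are found up to an error of 2, and estimates are mostly stated with
-- denominators cleared.

-- Ring identities with integer coefficients

module IntegerCoefficientSolver {c ℓ} (R : CommutativeRing c ℓ) where
  open CommutativeRing R
  open RingProperties ring using (-0#≈0#; -‿+-comm; -‿distribˡ-*; -‿distribʳ-*; -‿involutive)
  open SemiringMult semiring using (×1-homo-*; ×-homo-+) renaming (_×_ to _·_)
  open SetoidReasoning setoid

  fromℤ : ℤ → Carrier
  fromℤ (+ n)    = n · 1#
  fromℤ -[1+ n ] = - (suc n · 1#)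

  private
    cancel : ∀ x y z → (x + y) - (x + z) ≈ y - z
    cancel x y z = begin
      (x + y) - (x + z)      ≈⟨ +-cong (+-comm x y) (sym (-‿+-comm x z)) ⟩
      (y + x) + (- x + - z)  ≈⟨ +-assoc y x _ ⟩
      y + (x + (- x + - z))  ≈⟨ +-congˡ (sym (+-assoc x (- x) (- z))) ⟩
      y + ((x - x) + - z)    ≈⟨ +-congˡ (+-congʳ (-‿inverseʳ x)) ⟩
      y + (0# + - z)         ≈⟨ +-congˡ (+-identityˡ (- z)) ⟩
      y - z ∎

    fromℤ-⊖ : ∀ m n → fromℤ (m ⊖ n) ≈ m · 1# - n · 1#
    fromℤ-⊖ zero    zero    = sym (-‿inverseʳ 0#)
    fromℤ-⊖ zero    (suc n) = sym (+-identityˡ _)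
    fromℤ-⊖ (suc m) zero    = sym (trans (+-congˡ -0#≈0#) (+-identityʳ _))
    fromℤ-⊖ (suc m) (suc n) = begin
      fromℤ (suc m ⊖ suc n)       ≡⟨ ≡.cong fromℤ (ℤ.[1+m]⊖[1+n]≡m⊖n m n) ⟩
      fromℤ (m ⊖ n)               ≈⟨ fromℤ-⊖ m n ⟩
      m · 1# - n · 1#             ≈⟨ sym (cancel 1# _ _) ⟩
      (1# + m · 1#) - (1# + n · 1#) ∎

    fromℤ-neg : ∀ i → fromℤ (ℤ.- i) ≈ - fromℤ i
    fromℤ-neg (+ zero)  = sym -0#≈0#
    fromℤ-neg +[1+ n ]  = refl
    fromℤ-neg -[1+ n ]  = sym (-‿involutive _)

    fromℤ-+ : ∀ i j → fromℤ (i ℤ.+ j) ≈ fromℤ i + fromℤ j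
    fromℤ-+ (+ m)    (+ n)    = ×-homo-+ 1# m n
    fromℤ-+ (+ m)    -[1+ n ] = fromℤ-⊖ m (suc n)
    fromℤ-+ -[1+ m ] (+ n)    = trans (fromℤ-⊖ n (suc m)) (+-comm _ _)
    fromℤ-+ -[1+ m ] -[1+ n ] = begin
      - (suc (suc (m ℕ.+ n)) · 1#)    ≡⟨ ≡.cong (λ k → - (suc k · 1#)) (≡.sym (ℕ.+-suc m n)) ⟩
      - ((suc m ℕ.+ suc n) · 1#)      ≈⟨ -‿cong (×-homo-+ 1# (suc m) (suc n)) ⟩
      - (suc m · 1# + suc n · 1#)     ≈⟨ sym (-‿+-comm _ _) ⟩
      - (suc m · 1#) + - (suc n · 1#) ∎

    fromℤ-* : ∀ i j → fromℤ (i ℤ.* j) ≈ fromℤ i * fromℤ j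
    fromℤ-* (+ m)    (+ n)    = begin
      fromℤ (Sign.+ ◃ (m ℕ.* n))  ≡⟨ ≡.cong fromℤ (ℤ.+◃n≡+n (m ℕ.* n)) ⟩
      (m ℕ.* n) · 1#              ≈⟨ ×1-homo-* m n ⟩
      m · 1# * n · 1# ∎
    fromℤ-* (+ m)    -[1+ n ] = begin
      fromℤ (Sign.- ◃ (m ℕ.* suc n)) ≡⟨ ≡.cong fromℤ (ℤ.-◃n≡-n (m ℕ.* suc n)) ⟩
      fromℤ (ℤ.- (+ (m ℕ.* suc n)))  ≈⟨ fromℤ-neg (+ (m ℕ.* suc n)) ⟩
      - ((m ℕ.* suc n) · 1#)         ≈⟨ -‿cong (×1-homo-* m (suc n)) ⟩
      - (m · 1# * (suc n · 1#))      ≈⟨ -‿distribʳ-* _ _ ⟩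
      m · 1# * - (suc n · 1#) ∎
    fromℤ-* -[1+ m ] (+ n)    = begin
      fromℤ (Sign.- ◃ (suc m ℕ.* n)) ≡⟨ ≡.cong fromℤ (ℤ.-◃n≡-n (suc m ℕ.* n)) ⟩
      fromℤ (ℤ.- (+ (suc m ℕ.* n)))  ≈⟨ fromℤ-neg (+ (suc m ℕ.* n)) ⟩
      - ((suc m ℕ.* n) · 1#)         ≈⟨ -‿cong (×1-homo-* (suc m) n) ⟩
      - (suc m · 1# * n · 1#)        ≈⟨ -‿distribˡ-* _ _ ⟩
      - (suc m · 1#) * n · 1# ∎
    fromℤ-* -[1+ m ] -[1+ n ] = begin
      (suc m ℕ.* suc n) · 1#           ≈⟨ ×1-homo-* (suc m) (suc n) ⟩
      suc m · 1# * (suc n · 1#)        ≈⟨ sym (-‿involutive _) ⟩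
      - - (suc m · 1# * (suc n · 1#))  ≈⟨ -‿cong (-‿distribˡ-* _ _) ⟩
      - (- (suc m · 1#) * (suc n · 1#)) ≈⟨ -‿distribʳ-* _ _ ⟩
      - (suc m · 1#) * - (suc n · 1#) ∎

    -- Makes the literal 1 denote 1# itself, so that goals mentioning 1# match.
    coefficient : ℤ → Carrier
    coefficient (+ 1) = 1#
    coefficient i     = fromℤ i

    coefficient≈ : ∀ i → coefficient i ≈ fromℤ i
    coefficient≈ (+ 0)           = refl
    coefficient≈ (+ 1)           = sym (+-identityʳ 1#)
    coefficient≈ (+ suc (suc n)) = refl
    coefficient≈ -[1+ n ]        = refl

    morphism : ℤ.+-*-rawRing -Raw-AlmostCommutative⟶ fromCommutativeRing R
    morphism = record
      { ⟦_⟧    = coefficient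
      ; +-homo = λ i j → trans (coefficient≈ (i ℤ.+ j)) (trans (fromℤ-+ i j) (sym (+-cong (coefficient≈ i) (coefficient≈ j))))
      ; *-homo = λ i j → trans (coefficient≈ (i ℤ.* j)) (trans (fromℤ-* i j) (sym (*-cong (coefficient≈ i) (coefficient≈ j))))
      ; -‿homo = λ i → trans (coefficient≈ (ℤ.- i)) (trans (fromℤ-neg i) (-‿cong (sym (coefficient≈ i))))
      ; 0-homo = refl
      ; 1-homo = refl
      }

    _≟_ : ∀ i j → Maybe (coefficient i ≈ coefficient j)
    i ≟ j with i ℤ.≟ j
    ... | yes i≡j = just (reflexive (≡.cong coefficient i≡j))
    ... | no  _   = nothing

  open RingSolver ℤ.+-*-rawRing (fromCommutativeRing R) morphism _≟_ public
    using (solve; _:=_; _:+_; _:*_; _:-_; :-_; con; Polynomial)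

-- Arithmetic of a constructively ordered field

module OrderedFieldProperties {c ℓ₁ ℓ₂} (F : CompleteOrderedField c ℓ₁ ℓ₂) where
  open CompleteOrderedField F hiding (zero)
  open IsStrictPartialOrder isStrictPartialOrder public
    using (<-resp-≈) renaming (irrefl to <-irrefl; trans to <-trans; asym to <-asym)
  open SemiringExp semiring public using (^-homo-*; ^-congˡ)
  open CommutativeSemiringExp commutativeSemiring public using (^-distrib-*)
  open SemiringMult semiring public using (×1-homo-*; ×-homo-+)
  open SemiringSum semiring public
    using (sum-cong-≋; sum-replicate-zero; ∑-distrib-+; ∑-comm; *-distribˡ-sum; *-distribʳ-sum)
  open CommutativeSemigroupProperties *-commutativeSemigroup public
    using (x∙yz≈y∙xz; x∙yz≈yx∙z; x∙yz≈z∙xy)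
  open IntegerCoefficientSolver commutativeRing public
    using (solve; _:=_; _:+_; _:*_; _:-_; :-_; con; Polynomial)

  :0 :1 :2 :3 : ∀ {k} → Polynomial k
  :0 = con (+ 0)
  :1 = con (+ 1)
  :2 = con (+ 2)
  :3 = con (+ 3)

  ≤-refl : ∀ {x} → x ≤ x
  ≤-refl = <-irrefl refl

  ≤-reflexive : ∀ {x y} → x ≈ y → x ≤ y
  ≤-reflexive x≈y = <-irrefl (sym x≈y)

  <⇒≤ : ∀ {x y} → x < y → x ≤ y
  <⇒≤ x<y y<x = <-asym x<y y<x

  <-≤-trans : ∀ {x y z} → x < y → y ≤ z → x < z
  <-≤-trans x<y y≤z with cotransitive x<y _
  ... | inj₁ x<z = x<z
  ... | inj₂ z<y = ⊥-elim (y≤z z<y)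

  ≤-<-trans : ∀ {x y z} → x ≤ y → y < z → x < z
  ≤-<-trans x≤y y<z with cotransitive y<z _
  ... | inj₁ y<x = ⊥-elim (x≤y y<x)
  ... | inj₂ x<z = x<z

  ≤-trans : ∀ {x y z} → x ≤ y → y ≤ z → x ≤ z
  ≤-trans x≤y y≤z z<x = x≤y (≤-<-trans y≤z z<x)

  ≤-antisym : ∀ {x y} → x ≤ y → y ≤ x → x ≈ y
  ≤-antisym x≤y y≤x = tight y≤x x≤y

  -- Case analysis on the order is available whenever the goal is an
  -- inequality _≤_, because that is a negation.
  ≤-cases : ∀ x y {a b} → (x ≤ y → a ≤ b) → (y < x → a ≤ b) → a ≤ b
  ≤-cases x y f g b<a = f (λ y<x → g y<x b<a) b<a

  ≤-isPreorder : IsPreorder _≈_ _≤_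
  ≤-isPreorder = record
    { isEquivalence = isEquivalence ; reflexive = ≤-reflexive ; trans = ≤-trans }

  module ≤-Reasoning = TripleReasoning
    ≤-isPreorder <-asym <-trans <-resp-≈ <⇒≤ <-≤-trans ≤-<-trans
  open ≤-Reasoning

  +-monoʳ-< : ∀ z {x y} → x < y → z + x < z + y
  +-monoʳ-< z {x} {y} x<y = begin-strict
    z + x ≈⟨ +-comm z x ⟩
    x + z <⟨ +-monoˡ-< z x<y ⟩
    y + z ≈⟨ +-comm y z ⟩
    z + y ∎

  x<y⇒0<y-x : ∀ {x y} → x < y → 0# < y - x
  x<y⇒0<y-x {x} {y} x<y = begin-strict
    0#    ≈⟨ sym (-‿inverseʳ x) ⟩
    x - x <⟨ +-monoˡ-< (- x) x<y ⟩
    y - x ∎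

  0<z⇒x<x+z : ∀ {x z} → 0# < z → x < x + z
  0<z⇒x<x+z {x} {z} 0<z = begin-strict
    x      ≈⟨ sym (+-identityʳ x) ⟩
    x + 0# <⟨ +-monoʳ-< x 0<z ⟩
    x + z ∎

  x≤y⇒0≤y-x : ∀ {x y} → x ≤ y → 0# ≤ y - x
  x≤y⇒0≤y-x {x} {y} x≤y y-x<0 = x≤y (begin-strict
    y           ≈⟨ solve 2 (λ x y → y := x :+ (y :- x)) refl x y ⟩
    x + (y - x) <⟨ +-monoʳ-< x y-x<0 ⟩
    x + 0#      ≈⟨ +-identityʳ x ⟩
    x ∎)

  ≤-by : ∀ {x y z} → 0# ≤ z → y ≈ x + z → x ≤ y
  ≤-by {x} {y} {z} 0≤z y≈x+z y<x = 0≤z (begin-strict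
    z           ≈⟨ solve 2 (λ x z → z := (x :+ z) :- x) refl x z ⟩
    (x + z) - x ≈⟨ +-congʳ (sym y≈x+z) ⟩
    y - x       <⟨ +-monoˡ-< (- x) y<x ⟩
    x - x       ≈⟨ -‿inverseʳ x ⟩
    0# ∎)

  <-by : ∀ {x y z} → 0# < z → y ≈ x + z → x < y
  <-by {x} {y} {z} 0<z y≈x+z = begin-strict
    x     <⟨ 0<z⇒x<x+z 0<z ⟩
    x + z ≈⟨ sym y≈x+z ⟩
    y ∎

  +-nonneg : ∀ {x y} → 0# ≤ x → 0# ≤ y → 0# ≤ x + y
  +-nonneg {x} {y} 0≤x 0≤y = ≤-trans 0≤x (≤-by 0≤y refl)

  +-pos : ∀ {x y} → 0# < x → 0# ≤ y → 0# < x + y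
  +-pos 0<x 0≤y = <-≤-trans 0<x (≤-by 0≤y refl)

  +-mono-≤ : ∀ {x y u v} → x ≤ y → u ≤ v → x + u ≤ y + v
  +-mono-≤ {x} {y} {u} {v} x≤y u≤v = ≤-by (+-nonneg (x≤y⇒0≤y-x x≤y) (x≤y⇒0≤y-x u≤v))
    (solve 4 (λ x y u v → y :+ v := (x :+ u) :+ ((y :- x) :+ (v :- u))) refl x y u v)

  +-monoʳ-≤ : ∀ {x u v} → u ≤ v → x + u ≤ x + v
  +-monoʳ-≤ u≤v = +-mono-≤ ≤-refl u≤v

  x≈1*x : ∀ {a x} → a ≈ 1# → x ≈ a * x
  x≈1*x a≈1 = trans (sym (*-identityˡ _)) (*-congʳ (sym a≈1))

  neg-anti-≤ : ∀ {x y} → x ≤ y → - y ≤ - x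
  neg-anti-≤ {x} {y} x≤y = ≤-by (x≤y⇒0≤y-x x≤y)
    (solve 2 (λ x y → :- x := :- y :+ (y :- x)) refl x y)

  -- The axiom `*-pos` covers strict positivity only. The sign of each factor may be split because
  -- the goal is a negation, and a factor that is both ≤ 0 and ≥ 0 vanishes by antisymmetry.
  *-nonneg : ∀ {x y} → 0# ≤ x → 0# ≤ y → 0# ≤ x * y
  *-nonneg {x} {y} 0≤x 0≤y = ≤-cases x 0#
    (λ x≤0 → ≤-reflexive (sym (trans (*-congʳ (≤-antisym x≤0 0≤x)) (zeroˡ y))))
    (λ 0<x → ≤-cases y 0#
      (λ y≤0 → ≤-reflexive (sym (trans (*-congˡ (≤-antisym y≤0 0≤y)) (zeroʳ x))))
      (λ 0<y → <⇒≤ (*-pos 0<x 0<y)))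

  *-monoˡ-≤ : ∀ {z x y} → 0# ≤ z → x ≤ y → z * x ≤ z * y
  *-monoˡ-≤ {z} {x} {y} 0≤z x≤y = ≤-by (*-nonneg 0≤z (x≤y⇒0≤y-x x≤y))
    (solve 3 (λ z x y → z :* y := z :* x :+ z :* (y :- x)) refl z x y)

  *-monoʳ-≤ : ∀ {z x y} → 0# ≤ z → x ≤ y → x * z ≤ y * z
  *-monoʳ-≤ {z} {x} {y} 0≤z x≤y = ≤-by (*-nonneg 0≤z (x≤y⇒0≤y-x x≤y))
    (solve 3 (λ z x y → y :* z := x :* z :+ z :* (y :- x)) refl z x y)

  *-mono-≤ : ∀ {a b x y} → 0# ≤ a → a ≤ b → 0# ≤ x → x ≤ y → a * x ≤ b * y
  *-mono-≤ 0≤a a≤b 0≤x x≤y =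
    ≤-trans (*-monoˡ-≤ 0≤a x≤y) (*-monoʳ-≤ (≤-trans 0≤x x≤y) a≤b)

  *-monoˡ-< : ∀ {z x y} → 0# < z → x < y → z * x < z * y
  *-monoˡ-< {z} {x} {y} 0<z x<y = <-by (*-pos 0<z (x<y⇒0<y-x x<y))
    (solve 3 (λ z x y → z :* y := z :* x :+ z :* (y :- x)) refl z x y)

  *-cancelˡ-≤ : ∀ {z x y} → 0# < z → z * x ≤ z * y → x ≤ y
  *-cancelˡ-≤ 0<z zx≤zy y<x = zx≤zy (*-monoˡ-< 0<z y<x)

  *-cancelˡ-≈ : ∀ {z x y} → 0# < z → z * x ≈ z * y → x ≈ y
  *-cancelˡ-≈ 0<z zx≈zy = ≤-antisym
    (*-cancelˡ-≤ 0<z (≤-reflexive zx≈zy)) (*-cancelˡ-≤ 0<z (≤-reflexive (sym zx≈zy)))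

  0≤x*x : ∀ x → 0# ≤ x * x
  0≤x*x x = ≤-cases 0# x (λ 0≤x → *-nonneg 0≤x 0≤x)
    (λ x<0 → ≤-trans (*-nonneg (x≤y⇒0≤y-x (<⇒≤ x<0)) (x≤y⇒0≤y-x (<⇒≤ x<0)))
        (≤-reflexive (solve 1 (λ x → (:0 :- x) :* (:0 :- x) := x :* x) refl x)))

  x*x≤y*y⇒x≤y : ∀ {x y} → 0# ≤ y → x * x ≤ y * y → x ≤ y
  x*x≤y*y⇒x≤y {x} {y} 0≤y x²≤y² y<x = x²≤y² (begin-strict
    y * y ≤⟨ *-monoˡ-≤ 0≤y (<⇒≤ y<x) ⟩
    y * x ≈⟨ *-comm y x ⟩
    x * y <⟨ *-monoˡ-< (≤-<-trans 0≤y y<x) y<x ⟩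
    x * x ∎)

  0≤1 : 0# ≤ 1#
  0≤1 = <⇒≤ 0<1

  ^-nonneg : ∀ {x} k → 0# ≤ x → 0# ≤ x ^ k
  ^-nonneg zero    0≤x = 0≤1
  ^-nonneg (suc k) 0≤x = *-nonneg 0≤x (^-nonneg k 0≤x)

  ^-pos : ∀ {x} k → 0# < x → 0# < x ^ k
  ^-pos zero    0<x = 0<1
  ^-pos (suc k) 0<x = *-pos 0<x (^-pos k 0<x)

  ^-monoˡ-≤ : ∀ {x y} k → 0# ≤ x → x ≤ y → x ^ k ≤ y ^ k
  ^-monoˡ-≤ zero    0≤x x≤y = ≤-refl
  ^-monoˡ-≤ (suc k) 0≤x x≤y = *-mono-≤ 0≤x x≤y (^-nonneg k 0≤x) (^-monoˡ-≤ k 0≤x x≤y)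

  1^k≈1 : ∀ k → 1# ^ k ≈ 1#
  1^k≈1 zero    = refl
  1^k≈1 (suc k) = trans (*-identityˡ _) (1^k≈1 k)

  x≤1⇒x^k≤1 : ∀ {x} k → 0# ≤ x → x ≤ 1# → x ^ k ≤ 1#
  x≤1⇒x^k≤1 k 0≤x x≤1 = ≤-trans (^-monoˡ-≤ k 0≤x x≤1) (≤-reflexive (1^k≈1 k))

  0≤fromℕ : ∀ k → 0# ≤ fromℕ k
  0≤fromℕ zero    = ≤-refl
  0≤fromℕ (suc k) = <⇒≤ (0<fromℕ k)

  fromℕ-+ : ∀ m k → fromℕ (m ℕ.+ k) ≈ fromℕ m + fromℕ k
  fromℕ-+ m k = ×-homo-+ 1# m k

  fromℕ-* : ∀ m k → fromℕ (m ℕ.* k) ≈ fromℕ m * fromℕ k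
  fromℕ-* = ×1-homo-*

  fromℕ-mono-≤ : ∀ {m k} → m ℕ.≤ k → fromℕ m ≤ fromℕ k
  fromℕ-mono-≤ {k = k} ℕ.z≤n = 0≤fromℕ k
  fromℕ-mono-≤ (ℕ.s≤s m≤k) = +-monoʳ-≤ (fromℕ-mono-≤ m≤k)

  fromℕ-mono-< : ∀ {m k} → m ℕ.< k → fromℕ m < fromℕ k
  fromℕ-mono-< {m} {k} m<k = <-≤-trans (<-by 0<1 (+-comm 1# (fromℕ m))) (fromℕ-mono-≤ {suc m} {k} m<k)

  fromℕ-cancel-≤ : ∀ {m k} → fromℕ m ≤ fromℕ k → m ℕ.≤ k
  fromℕ-cancel-≤ {m} {k} m≤k with m ℕ.≤? k
  ... | yes p = p
  ... | no  p = ⊥-elim (m≤k (fromℕ-mono-< {k} {m} (ℕ.≰⇒> p)))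

  fromℕ-1 : fromℕ 1 ≈ 1#
  fromℕ-1 = +-identityʳ 1#

  fromℕ>1 : ∀ {k} → 2 ℕ.≤ k → 1# < fromℕ k
  fromℕ>1 {k} 2≤k = ≤-<-trans (≤-reflexive (sym fromℕ-1)) (fromℕ-mono-< {1} {k} 2≤k)

  -- Each induction step discards only the term k x². Allowing negative x matters: the inequality is
  -- applied to 1 - 1/d as well as to 1 + τ.
  bernoulli : ∀ {x} k → 0# ≤ 1# + x → 1# + fromℕ k * x ≤ (1# + x) ^ k
  bernoulli {x} zero    0≤1+x = ≤-reflexive (trans (+-congˡ (zeroˡ x)) (+-identityʳ 1#))
  bernoulli {x} (suc k) 0≤1+x = begin
    1# + (1# + fromℕ k) * x
      ≤⟨ ≤-by (*-nonneg (0≤fromℕ k) (0≤x*x x))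
          (solve 2 (λ x k → (:1 :+ x) :* (:1 :+ k :* x) := (:1 :+ (:1 :+ k) :* x) :+ k :* (x :* x)) refl x (fromℕ k)) ⟩
    (1# + x) * (1# + fromℕ k * x) ≤⟨ *-monoˡ-≤ 0≤1+x (bernoulli k 0≤1+x) ⟩
    (1# + x) ^ suc k ∎

  0<recip : ∀ {x} (0<x : 0# < x) → 0# < recip x 0<x
  0<recip 0<x = proj₁ (proj₂ (inverse 0<x))

  *-recip : ∀ {x} (0<x : 0# < x) → x * recip x 0<x ≈ 1#
  *-recip 0<x = proj₂ (proj₂ (inverse 0<x))

  half : Carrier
  half = recip (fromℕ 2) (0<fromℕ 1)

  half*2≈1 : half * fromℕ 2 ≈ 1#
  half*2≈1 = trans (*-comm _ _) (*-recip (0<fromℕ 1))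

  0<half : 0# < half
  0<half = 0<recip (0<fromℕ 1)

  0≤half : 0# ≤ half
  0≤half = <⇒≤ 0<half

  x≤∣x∣ : ∀ x → x ≤ ∣ x ∣
  x≤∣x∣ x = x≤x∨y x (- x)

  -x≤∣x∣ : ∀ x → - x ≤ ∣ x ∣
  -x≤∣x∣ x = y≤x∨y x (- x)

  ∣x∣≤y⇒x*x≤y*y : ∀ {x y} → ∣ x ∣ ≤ y → x * x ≤ y * y
  ∣x∣≤y⇒x*x≤y*y {x} {y} ∣x∣≤y = ≤-by
    (*-nonneg (x≤y⇒0≤y-x (≤-trans (x≤∣x∣ x) ∣x∣≤y)) (x≤y⇒0≤y-x (≤-trans (-x≤∣x∣ x) ∣x∣≤y)))
    (solve 2 (λ x y → y :* y := x :* x :+ (y :- x) :* (y :- (:- x))) refl x y)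

  -- An exact floor would require deciding the order. Cotransitivity offers the overlapping
  -- alternatives k < x and x < k + 1 instead, and the overlap costs a slack of 2 rather than 1.
  approximateFloor : ∀ {x} → 0# ≤ x → ∃[ k ] (fromℕ k ≤ x × x ≤ fromℕ k + fromℕ 2)
  approximateFloor {x} 0≤x = descend (proj₁ (archimedean x)) (proj₂ (archimedean x))
    where
    descend : ∀ N → x < fromℕ N → ∃[ k ] (fromℕ k ≤ x × x ≤ fromℕ k + fromℕ 2)
    descend zero          x<0 = ⊥-elim (0≤x x<0)
    descend (suc zero)    x<1 = 0 , 0≤x , ≤-trans (<⇒≤ x<1) (≤-by 0≤1 (solve 0 (:0 :+ :2 := (:1 :+ :0) :+ :1) refl))
    descend (suc (suc k)) x<k+2 =
      [ (λ k<x → k , <⇒≤ k<x , ≤-trans (<⇒≤ x<k+2)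
          (≤-reflexive (solve 1 (λ k → :1 :+ (:1 :+ k) := k :+ :2) refl (fromℕ k))))
      , (λ x<k+1 → descend (suc k) x<k+1)
      ]′ (cotransitive (fromℕ-mono-< {k} {suc k} (ℕ.n<1+n k)) x)

  approximateCeiling : ∀ {x} → 0# ≤ x → ∃[ k ] (x ≤ fromℕ k × fromℕ k ≤ x + fromℕ 2)
  approximateCeiling {x} 0≤x with approximateFloor 0≤x
  ... | k , k≤x , x≤k+2 = suc (suc k) , ≤-trans x≤k+2 (≤-reflexive k+2≈) ,
        ≤-trans (≤-reflexive (sym k+2≈)) (+-mono-≤ k≤x ≤-refl)
    where
    k+2≈ : fromℕ k + fromℕ 2 ≈ fromℕ (suc (suc k))
    k+2≈ = solve 1 (λ k → k :+ :2 := :1 :+ (:1 :+ k)) refl (fromℕ k)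

  archimedeanRatio : ∀ y {z} → 0# < z → ∃[ k ] (y ≤ z * fromℕ k)
  archimedeanRatio y {z} 0<z with archimedean (recip z 0<z * y)
  ... | k , y/z<k = k , (begin
    y                        ≈⟨ x≈1*x (*-recip 0<z) ⟩
    (z * recip z 0<z) * y    ≈⟨ *-assoc _ _ _ ⟩
    z * (recip z 0<z * y)    ≤⟨ *-monoˡ-≤ (<⇒≤ 0<z) (<⇒≤ y/z<k) ⟩
    z * fromℕ k ∎)

  sum-mono-≤ : ∀ {k} {f g : Fin k → Carrier} → (∀ i → f i ≤ g i) → sum f ≤ sum g
  sum-mono-≤ {zero}  f≤g = ≤-refl
  sum-mono-≤ {suc k} f≤g = +-mono-≤ (f≤g zero) (sum-mono-≤ (λ i → f≤g (suc i)))

  sum-nonneg : ∀ {k} {f : Fin k → Carrier} → (∀ i → 0# ≤ f i) → 0# ≤ sum f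
  sum-nonneg {zero}  0≤f = ≤-refl
  sum-nonneg {suc k} 0≤f = +-nonneg (0≤f zero) (sum-nonneg (λ i → 0≤f (suc i)))

  Converges⇒≤ : ∀ {s x y} → Converges s x → (∀ k → s k ≤ y) → x ≤ y
  Converges⇒≤ {s} {x} {y} s→x s≤y y<x with s→x (x - y) (x<y⇒0<y-x y<x)
  ... | N , close = s≤y N (begin-strict
    y                     ≈⟨ solve 3 (λ x y s → y := s :+ ((:- (s :- x)) :- (x :- y))) refl x y (s N) ⟩
    s N + (- (s N - x) - (x - y)) <⟨ +-monoʳ-< (s N) (+-monoˡ-< (- (x - y)) (≤-<-trans (-x≤∣x∣ (s N - x)) (close N ℕ.≤-refl))) ⟩
    s N + ((x - y) - (x - y)) ≈⟨ solve 2 (λ z s → s :+ (z :- z) := s) refl (x - y) (s N) ⟩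
    s N ∎)

  Converges⇒≥ : ∀ {s x y} M → Converges s x → (∀ k → M ℕ.≤ k → y ≤ s k) → y ≤ x
  Converges⇒≥ {s} {x} {y} M s→x y≤s x<y with s→x (y - x) (x<y⇒0<y-x x<y)
  ... | N , close = y≤s (N ℕ.⊔ M) (ℕ.m≤n⊔m N M) (begin-strict
    s k           ≈⟨ solve 2 (λ s x → s := (s :- x) :+ x) refl (s k) x ⟩
    (s k - x) + x <⟨ +-monoˡ-< x (≤-<-trans (x≤∣x∣ (s k - x)) (close k (ℕ.m≤m⊔n N M))) ⟩
    (y - x) + x   ≈⟨ solve 2 (λ y x → (y :- x) :+ x := y) refl y x ⟩
    y ∎)
    where k = N ℕ.⊔ M

-- The exponential series

module ExponentialProperties {c ℓ₁ ℓ₂} (F : CompleteOrderedField c ℓ₁ ℓ₂) where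
  open CompleteOrderedField F hiding (zero)
  open OrderedFieldProperties F

  ∑< : ℕ → (ℕ → Carrier) → Carrier
  ∑< m f = sum {m} (λ k → f (Fin.toℕ k))

  -- The region i + j < m, which carries the partial sums of a Cauchy product. Enclosing it between
  -- rectangles replaces any rearrangement of infinite series.
  triangle : ℕ → (ℕ → ℕ → Carrier) → Carrier
  triangle zero    f = 0#
  triangle (suc m) f = ∑< (suc m) (f 0) + triangle m (λ i → f (suc i))

  antidiagonal : ℕ → (ℕ → ℕ → Carrier) → Carrier
  antidiagonal zero    f = f 0 0
  antidiagonal (suc m) f = f 0 (suc m) + antidiagonal m (λ i → f (suc i))

  ∑<-suc : ∀ m f → ∑< (suc m) f ≈ ∑< m f + f m
  ∑<-suc zero    f = trans (+-identityʳ _) (sym (+-identityˡ _))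
  ∑<-suc (suc m) f = trans (+-congˡ (∑<-suc m (λ k → f (suc k)))) (sym (+-assoc _ _ _))

  ∑<-cong : ∀ m {f g} → (∀ k → f k ≈ g k) → ∑< m f ≈ ∑< m g
  ∑<-cong m f≈g = sum-cong-≋ {m} (λ k → f≈g (Fin.toℕ k))

  ∑<-*ˡ : ∀ m x f → x * ∑< m f ≈ ∑< m (λ k → x * f k)
  ∑<-*ˡ m x f = *-distribˡ-sum {m} x _

  ∑<-mono-≤ : ∀ m {f g} → (∀ k → f k ≤ g k) → ∑< m f ≤ ∑< m g
  ∑<-mono-≤ m f≤g = sum-mono-≤ {m} (λ k → f≤g (Fin.toℕ k))

  ∑<-monoʳ-≤ : ∀ {m n f} → (∀ k → 0# ≤ f k) → m ℕ.≤ n → ∑< m f ≤ ∑< n f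
  ∑<-monoʳ-≤ {n = n} 0≤f ℕ.z≤n = sum-nonneg {n} (λ k → 0≤f (Fin.toℕ k))
  ∑<-monoʳ-≤ 0≤f (ℕ.s≤s m≤n)   = +-monoʳ-≤ (∑<-monoʳ-≤ (λ k → 0≤f (suc k)) m≤n)

  triangle-suc : ∀ m f → triangle (suc m) f ≈ triangle m f + antidiagonal m f
  triangle-suc zero    f = trans (+-identityʳ _) (trans (+-identityʳ _) (sym (+-identityˡ _)))
  triangle-suc (suc m) f = begin
    ∑< (suc (suc m)) (f 0) + triangle (suc m) f′
      ≈⟨ +-cong (∑<-suc (suc m) (f 0)) (triangle-suc m f′) ⟩
    (∑< (suc m) (f 0) + f 0 (suc m)) + (triangle m f′ + antidiagonal m f′)
      ≈⟨ solve 4 (λ a b c d → (a :+ b) :+ (c :+ d) := (a :+ c) :+ (b :+ d)) refl _ _ _ _ ⟩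
    triangle (suc m) f + antidiagonal (suc m) f ∎
    where
    f′ = λ i → f (suc i)
    open SetoidReasoning setoid

  triangle≤square : ∀ m k {f} → (∀ i j → 0# ≤ f i j) → m ℕ.≤ k →
                    triangle m f ≤ ∑< m (λ i → ∑< k (f i))
  triangle≤square zero    k 0≤f m≤k = ≤-refl
  triangle≤square (suc m) k 0≤f m≤k = +-mono-≤ (∑<-monoʳ-≤ (0≤f 0) m≤k)
    (triangle≤square m k (λ i → 0≤f (suc i)) (ℕ.<⇒≤ m≤k))

  triangle-nonneg : ∀ m {f} → (∀ i j → 0# ≤ f i j) → 0# ≤ triangle m f
  triangle-nonneg zero    0≤f = ≤-refl
  triangle-nonneg (suc m) 0≤f = +-nonneg (sum-nonneg {suc m} (λ k → 0≤f 0 (Fin.toℕ k)))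
    (triangle-nonneg m (λ i → 0≤f (suc i)))

  rectangle≤triangle : ∀ m k {f} → (∀ i j → 0# ≤ f i j) →
                       ∑< m (λ i → ∑< k (f i)) ≤ triangle (m ℕ.+ k) f
  rectangle≤triangle zero    k 0≤f = triangle-nonneg k 0≤f
  rectangle≤triangle (suc m) k 0≤f = +-mono-≤
    (∑<-monoʳ-≤ (0≤f 0) (ℕ.m≤n⇒m≤1+n (ℕ.m≤n+m k m)))
    (rectangle≤triangle m k (λ i → 0≤f (suc i)))

  antidiagonal-cong : ∀ m {f g} → (∀ i j → i ℕ.+ j ≡ m → f i j ≈ g i j) →
                      antidiagonal m f ≈ antidiagonal m g
  antidiagonal-cong zero    f≈g = f≈g 0 0 ≡.refl
  antidiagonal-cong (suc m) f≈g = +-cong (f≈g 0 (suc m) ≡.refl)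
    (antidiagonal-cong m (λ i j i+j≡m → f≈g (suc i) j (≡.cong suc i+j≡m)))

  antidiagonal-*ˡ : ∀ m x f → x * antidiagonal m f ≈ antidiagonal m (λ i j → x * f i j)
  antidiagonal-*ˡ zero    x f = refl
  antidiagonal-*ˡ (suc m) x f = trans (distribˡ x _ _) (+-congˡ (antidiagonal-*ˡ m x _))

  antidiagonal-+ : ∀ m f g →
    antidiagonal m (λ i j → f i j + g i j) ≈ antidiagonal m f + antidiagonal m g
  antidiagonal-+ zero    f g = refl
  antidiagonal-+ (suc m) f g = trans (+-congˡ (antidiagonal-+ m _ _))
    (solve 4 (λ a b c d → (a :+ b) :+ (c :+ d) := (a :+ c) :+ (b :+ d)) refl _ _ _ _)

  antidiagonal-last : ∀ m f →
    antidiagonal (suc m) f ≈ antidiagonal m (λ i j → f i (suc j)) + f (suc m) 0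
  antidiagonal-last zero    f = refl
  antidiagonal-last (suc m) f =
    trans (+-congˡ (antidiagonal-last m (λ i → f (suc i)))) (sym (+-assoc _ _ _))

  private
    factorialRecip : ℕ → Carrier
    factorialRecip k = recip (fromℕ (k !)) (0<fromℕ′ (k !) {{k ℕ.!≢0}})

    0<fromℕ[k!] : ∀ k → 0# < fromℕ (k !)
    0<fromℕ[k!] k = 0<fromℕ′ (k !) {{k ℕ.!≢0}}

    *-factorialRecip : ∀ k → fromℕ (k !) * factorialRecip k ≈ 1#
    *-factorialRecip k = *-recip (0<fromℕ′ (k !) {{k ℕ.!≢0}})

    factorialRecip-nonneg : ∀ k → 0# ≤ factorialRecip k
    factorialRecip-nonneg k = <⇒≤ (0<recip (0<fromℕ′ (k !) {{k ℕ.!≢0}}))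

    factorialRecip-suc : ∀ k → fromℕ (suc k) * factorialRecip (suc k) ≈ factorialRecip k
    factorialRecip-suc k = *-cancelˡ-≈ (0<fromℕ[k!] k) (begin
      fromℕ (k !) * (fromℕ (suc k) * factorialRecip (suc k))
        ≈⟨ x∙yz≈yx∙z (fromℕ (k !)) (fromℕ (suc k)) (factorialRecip (suc k)) ⟩
      (fromℕ (suc k) * fromℕ (k !)) * factorialRecip (suc k)
        ≈⟨ *-congʳ (sym (fromℕ-* (suc k) (k !))) ⟩
      fromℕ (suc k !) * factorialRecip (suc k)  ≈⟨ *-factorialRecip (suc k) ⟩
      1#                                        ≈⟨ sym (*-factorialRecip k) ⟩
      fromℕ (k !) * factorialRecip k ∎)
      where open SetoidReasoning setoid

    factorialRecip≤1 : ∀ k → factorialRecip k ≤ 1#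
    factorialRecip≤1 k = begin
      factorialRecip k               ≈⟨ sym (*-identityˡ _) ⟩
      1# * factorialRecip k          ≈⟨ *-congʳ (sym fromℕ-1) ⟩
      fromℕ 1 * factorialRecip k
        ≤⟨ *-monoʳ-≤ (factorialRecip-nonneg k) (fromℕ-mono-≤ {1} {k !} (ℕ.1≤n! k)) ⟩
      fromℕ (k !) * factorialRecip k ≈⟨ *-factorialRecip k ⟩
      1# ∎
      where open ≤-Reasoning

  expTerm-0 : ∀ x → expTerm x 0 ≈ 1#
  expTerm-0 x = begin
    1# * factorialRecip 0      ≈⟨ *-congʳ (sym fromℕ-1) ⟩
    fromℕ 1 * factorialRecip 0 ≈⟨ *-factorialRecip 0 ⟩
    1# ∎
    where open SetoidReasoning setoid

  expTerm-suc : ∀ x k → fromℕ (suc k) * expTerm x (suc k) ≈ x * expTerm x k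
  expTerm-suc x k = begin
    fromℕ (suc k) * ((x * x ^ k) * factorialRecip (suc k))
      ≈⟨ solve 4 (λ s x y r → s :* ((x :* y) :* r) := x :* (y :* (s :* r))) refl (fromℕ (suc k)) x (x ^ k) _ ⟩
    x * (x ^ k * (fromℕ (suc k) * factorialRecip (suc k)))
      ≈⟨ *-congˡ (*-congˡ (factorialRecip-suc k)) ⟩
    x * expTerm x k ∎
    where open SetoidReasoning setoid

  expTerm-1 : ∀ x → expTerm x 1 ≈ x
  expTerm-1 x = begin
    expTerm x 1           ≈⟨ sym (*-identityˡ _) ⟩
    1# * expTerm x 1      ≈⟨ *-congʳ (sym fromℕ-1) ⟩
    fromℕ 1 * expTerm x 1 ≈⟨ expTerm-suc x 0 ⟩
    x * expTerm x 0       ≈⟨ *-congˡ (expTerm-0 x) ⟩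
    x * 1#                ≈⟨ *-identityʳ x ⟩
    x ∎
    where open SetoidReasoning setoid

  expTerm-nonneg : ∀ {x} k → 0# ≤ x → 0# ≤ expTerm x k
  expTerm-nonneg k 0≤x = *-nonneg (^-nonneg k 0≤x) (factorialRecip-nonneg k)

  expTerm-mono-≤ : ∀ {x y} k → 0# ≤ x → x ≤ y → expTerm x k ≤ expTerm y k
  expTerm-mono-≤ k 0≤x x≤y = *-monoʳ-≤ (factorialRecip-nonneg k) (^-monoˡ-≤ k 0≤x x≤y)

  expTerm≤power : ∀ {x} k → 0# ≤ x → expTerm x k ≤ x ^ k
  expTerm≤power k 0≤x = ≤-trans (*-monoˡ-≤ (^-nonneg k 0≤x) (factorialRecip≤1 k))
    (≤-reflexive (*-identityʳ _))

  -- The binomial theorem divided by m!. Multiplying the sum over i + j = m + 1 by m + 1 and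
  -- splitting this weight into i and j yields x and y times the sum for m, so binomial coefficients
  -- never occur.
  binomial : ∀ x y m → antidiagonal m (λ i j → expTerm x i * expTerm y j) ≈ expTerm (x + y) m
  binomial x y zero = begin
    expTerm x 0 * expTerm y 0 ≈⟨ *-cong (expTerm-0 x) (expTerm-0 y) ⟩
    1# * 1#                   ≈⟨ *-identityˡ 1# ⟩
    1#                        ≈⟨ sym (expTerm-0 (x + y)) ⟩
    expTerm (x + y) 0 ∎
    where open SetoidReasoning setoid
  binomial x y (suc m) = *-cancelˡ-≈ (0<fromℕ m) (begin
    M * antidiagonal (suc m) t
      ≈⟨ antidiagonal-*ˡ (suc m) M t ⟩
    antidiagonal (suc m) (λ i j → M * t i j)
      ≈⟨ antidiagonal-cong (suc m) (λ i j i+j≡1+m → trans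
           (*-congʳ {t i j} (trans (reflexive (≡.cong fromℕ (≡.sym i+j≡1+m))) (fromℕ-+ i j))) (distribʳ (t i j) _ _)) ⟩
    antidiagonal (suc m) (λ i j → fromℕ i * t i j + fromℕ j * t i j)
      ≈⟨ antidiagonal-+ (suc m) (λ i j → fromℕ i * t i j) (λ i j → fromℕ j * t i j) ⟩
    antidiagonal (suc m) (λ i j → fromℕ i * t i j) + antidiagonal (suc m) (λ i j → fromℕ j * t i j)
      ≈⟨ +-cong
          (trans (+-congʳ (zeroˡ _)) (trans (+-identityˡ _) (antidiagonal-cong m λ i j _ → left i j)))
          (trans (antidiagonal-last m (λ i j → fromℕ j * t i j)) (trans (+-congˡ (zeroˡ _)) (trans (+-identityʳ _)
            (antidiagonal-cong m λ i j _ → right i j)))) ⟩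
    antidiagonal m (λ i j → x * t i j) + antidiagonal m (λ i j → y * t i j)
      ≈⟨ +-cong (sym (antidiagonal-*ˡ m x t)) (sym (antidiagonal-*ˡ m y t)) ⟩
    x * antidiagonal m t + y * antidiagonal m t
      ≈⟨ sym (distribʳ _ x y) ⟩
    (x + y) * antidiagonal m t
      ≈⟨ *-congˡ (binomial x y m) ⟩
    (x + y) * expTerm (x + y) m
      ≈⟨ sym (expTerm-suc (x + y) m) ⟩
    M * expTerm (x + y) (suc m) ∎)
    where
    open SetoidReasoning setoid
    M = fromℕ (suc m)
    t : ℕ → ℕ → Carrier
    t i j = expTerm x i * expTerm y j
    left : ∀ i j → fromℕ (suc i) * t (suc i) j ≈ x * t i j
    left i j = trans (sym (*-assoc _ _ _)) (trans (*-congʳ (expTerm-suc x i)) (*-assoc _ _ _))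
    right : ∀ i j → fromℕ (suc j) * t i (suc j) ≈ y * t i j
    right i j = begin
      fromℕ (suc j) * (expTerm x i * expTerm y (suc j))
        ≈⟨ x∙yz≈y∙xz (fromℕ (suc j)) (expTerm x i) (expTerm y (suc j)) ⟩
      expTerm x i * (fromℕ (suc j) * expTerm y (suc j)) ≈⟨ *-congˡ (expTerm-suc y j) ⟩
      expTerm x i * (y * expTerm y j)
        ≈⟨ x∙yz≈y∙xz (expTerm x i) y (expTerm y j) ⟩
      y * (expTerm x i * expTerm y j) ∎

  expSum : ℕ → Carrier → Carrier
  expSum m x = ∑< m (expTerm x)

  expSum-+ : ∀ x y m → expSum m (x + y) ≈ triangle m (λ i j → expTerm x i * expTerm y j)
  expSum-+ x y zero    = refl
  expSum-+ x y (suc m) = begin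
    expSum (suc m) (x + y)                  ≈⟨ ∑<-suc m (expTerm (x + y)) ⟩
    expSum m (x + y) + expTerm (x + y) m    ≈⟨ +-cong (expSum-+ x y m) (sym (binomial x y m)) ⟩
    triangle m t + antidiagonal m t         ≈⟨ sym (triangle-suc m t) ⟩
    triangle (suc m) t ∎
    where
    open SetoidReasoning setoid
    t = λ i j → expTerm x i * expTerm y j

  expSum-* : ∀ x y m k → ∑< m (λ i → ∑< k (λ j → expTerm x i * expTerm y j)) ≈ expSum m x * expSum k y
  expSum-* x y m k = begin
    ∑< m (λ i → ∑< k (λ j → expTerm x i * expTerm y j))
      ≈⟨ ∑<-cong m (λ i → sym (∑<-*ˡ k (expTerm x i) (expTerm y))) ⟩
    ∑< m (λ i → expTerm x i * expSum k y)
      ≈⟨ sym (*-distribʳ-sum {m} (expSum k y) _) ⟩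
    expSum m x * expSum k y ∎
    where open SetoidReasoning setoid

  -- For x ≥ 0 the exponential is the supremum of the partial sums of its
  -- series; this order-theoretic form avoids all further limit arguments.
  SupExp : Carrier → Carrier → Set _
  SupExp x a = (∀ m → expSum m x ≤ a) × (∀ u → (∀ m → expSum m x ≤ u) → a ≤ u)

  IsExp⇒SupExp : ∀ {x a} → 0# ≤ x → IsExp x a → SupExp x a
  IsExp⇒SupExp {x} 0≤x x↦a =
    (λ m → Converges⇒≥ m x↦a (λ k m≤k → ∑<-monoʳ-≤ {m} {k} (λ i → expTerm-nonneg i 0≤x) m≤k)) ,
    (λ u → Converges⇒≤ x↦a)

  SupExp-resp-≈ : ∀ {x y a b} → x ≈ y → a ≈ b → SupExp x a → SupExp y b
  SupExp-resp-≈ {x} {y} x≈y a≈b (upper , least) =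
    (λ m → ≤-trans (≤-reflexive (sym (sums m))) (≤-trans (upper m) (≤-reflexive a≈b))) ,
    (λ u bound → ≤-trans (≤-reflexive (sym a≈b))
      (least u (λ m → ≤-trans (≤-reflexive (sums m)) (bound m))))
    where
    sums : ∀ m → expSum m x ≈ expSum m y
    sums m = ∑<-cong m (λ k → *-congʳ {factorialRecip k} (^-congˡ k x≈y))

  SupExp-mono-≤ : ∀ {x y a b} → 0# ≤ x → x ≤ y → SupExp x a → SupExp y b → a ≤ b
  SupExp-mono-≤ 0≤x x≤y (_ , least) (upper , _) =
    least _ (λ m → ≤-trans (∑<-mono-≤ m (λ k → expTerm-mono-≤ k 0≤x x≤y)) (upper m))

  private
    expSum-1 : ∀ x → expSum 1 x ≈ 1#
    expSum-1 x = trans (+-identityʳ _) (expTerm-0 x)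

    expSum-2 : ∀ x → expSum 2 x ≈ 1# + x
    expSum-2 x = +-cong (expTerm-0 x) (trans (+-identityʳ _) (expTerm-1 x))

  SupExp⇒1≤ : ∀ {x a} → SupExp x a → 1# ≤ a
  SupExp⇒1≤ {x} (upper , _) = ≤-trans (≤-reflexive (sym (expSum-1 x))) (upper 1)

  SupExp⇒1+x≤ : ∀ {x a} → SupExp x a → 1# + x ≤ a
  SupExp⇒1+x≤ {x} (upper , _) = ≤-trans (≤-reflexive (sym (expSum-2 x))) (upper 2)

  -- Since 1/k! ≤ 1, the geometric series dominates; the factor 1 - x stays on the left so that
  -- nothing is divided.
  expSum-geometric : ∀ {x} m → 0# ≤ x → x ≤ 1# → expSum m x * (1# - x) ≤ 1#
  expSum-geometric {x} m 0≤x x≤1 = ≤-trans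
    (*-monoʳ-≤ (x≤y⇒0≤y-x x≤1) (∑<-mono-≤ m (λ k → expTerm≤power k 0≤x))) (bound m)
    where
    open ≤-Reasoning
    bound : ∀ m → ∑< m (x ^_) * (1# - x) ≤ 1#
    bound zero    = ≤-trans (≤-reflexive (zeroˡ _)) 0≤1
    bound (suc m) = begin
      (1# + ∑< m (λ k → x * x ^ k)) * (1# - x)
        ≈⟨ *-congʳ (+-congˡ (sym (∑<-*ˡ m x (x ^_)))) ⟩
      (1# + x * ∑< m (x ^_)) * (1# - x)
        ≈⟨ solve 2 (λ x s → (:1 :+ x :* s) :* (:1 :- x) := (:1 :- x) :+ x :* (s :* (:1 :- x))) refl x _ ⟩
      (1# - x) + x * (∑< m (x ^_) * (1# - x))
        ≤⟨ +-monoʳ-≤ (*-monoˡ-≤ 0≤x (bound m)) ⟩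
      (1# - x) + x * 1#
        ≈⟨ solve 1 (λ x → (:1 :- x) :+ x :* :1 := :1) refl x ⟩
      1# ∎

  -- The supremum property bounds `a` by bounds on the partial sums themselves; dividing by `e`
  -- makes it available for their multiples.
  least-* : ∀ {x a e u} → SupExp x a → 0# < e → (∀ m → e * expSum m x ≤ u) → e * a ≤ u
  least-* {x} {a} {e} {u} (_ , least) 0<e bound = begin
    e * a          ≤⟨ *-monoˡ-≤ (<⇒≤ 0<e) (least (r * u) (λ m → begin
      expSum m x             ≈⟨ cancel (expSum m x) ⟩
      r * (e * expSum m x)   ≤⟨ *-monoˡ-≤ (<⇒≤ (0<recip 0<e)) (bound m) ⟩
      r * u ∎)) ⟩
    e * (r * u)    ≈⟨ x∙yz≈y∙xz e r u ⟩
    r * (e * u)    ≈⟨ sym (cancel u) ⟩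
    u ∎
    where
    open ≤-Reasoning
    r = recip e 0<e
    cancel : ∀ z → z ≈ r * (e * z)
    cancel z = sym (trans (solve 3 (λ e r z → r :* (e :* z) := (e :* r) :* z) refl e r z)
      (trans (*-congʳ (*-recip 0<e)) (*-identityˡ z)))

  SupExp⇒*[1-x]≤1 : ∀ {x a} → 0# ≤ x → x < 1# → SupExp x a → a * (1# - x) ≤ 1#
  SupExp⇒*[1-x]≤1 0≤x x<1 x↦a = ≤-trans (≤-reflexive (*-comm _ _))
    (least-* x↦a (x<y⇒0<y-x x<1) (λ m → ≤-trans (≤-reflexive (*-comm _ _)) (expSum-geometric m 0≤x (<⇒≤ x<1))))

  -- The triangle of side m lies in the square of side m, which gives the upper bound, and the m by
  -- k rectangle lies in the triangle of side m + k, which gives leastness after taking the supremum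
  -- in one variable at a time.
  SupExp-+ : ∀ {x y a b} → 0# ≤ x → 0# ≤ y → SupExp x a → SupExp y b → SupExp (x + y) (a * b)
  SupExp-+ {x} {y} {a} {b} 0≤x 0≤y x↦a y↦b = upper , least
    where
    open ≤-Reasoning
    0≤t : ∀ i j → 0# ≤ expTerm x i * expTerm y j
    0≤t i j = *-nonneg (expTerm-nonneg i 0≤x) (expTerm-nonneg j 0≤y)
    0≤expSum : ∀ {z} m → 0# ≤ z → 0# ≤ expSum m z
    0≤expSum m 0≤z = sum-nonneg {m} (λ k → expTerm-nonneg (Fin.toℕ k) 0≤z)
    0<b : 0# < b
    0<b = <-≤-trans 0<1 (SupExp⇒1≤ y↦b)
    upper : ∀ m → expSum m (x + y) ≤ a * b
    upper m = begin
      expSum m (x + y)                ≈⟨ expSum-+ x y m ⟩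
      triangle m (λ i j → expTerm x i * expTerm y j)
        ≤⟨ triangle≤square m m 0≤t ℕ.≤-refl ⟩
      ∑< m (λ i → ∑< m (λ j → expTerm x i * expTerm y j))
                                      ≈⟨ expSum-* x y m m ⟩
      expSum m x * expSum m y
        ≤⟨ *-mono-≤ (0≤expSum m 0≤x) (proj₁ x↦a m) (0≤expSum m 0≤y) (proj₁ y↦b m) ⟩
      a * b ∎
    least : ∀ u → (∀ m → expSum m (x + y) ≤ u) → a * b ≤ u
    least u bound = ≤-trans (≤-reflexive (*-comm a b)) (least-* x↦a 0<b (λ m → row m))
      where
      row : ∀ m → b * expSum m x ≤ u
      -- The empty partial sum is 0 and cannot serve as the positive factor of `least-*`.
      row zero    = begin
        b * 0#           ≈⟨ zeroʳ b ⟩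
        0#               ≤⟨ bound 0 ⟩
        u ∎
      row (suc m) = ≤-trans (≤-reflexive (*-comm _ _)) (least-* y↦b 0<e (λ k → begin
        expSum (suc m) x * expSum k y   ≈⟨ sym (expSum-* x y (suc m) k) ⟩
        ∑< (suc m) (λ i → ∑< k (λ j → expTerm x i * expTerm y j))
                                        ≤⟨ rectangle≤triangle (suc m) k 0≤t ⟩
        triangle (suc m ℕ.+ k) (λ i j → expTerm x i * expTerm y j)
                                        ≈⟨ sym (expSum-+ x y (suc m ℕ.+ k)) ⟩
        expSum (suc m ℕ.+ k) (x + y)    ≤⟨ bound (suc m ℕ.+ k) ⟩
        u ∎))
        where
        0<e : 0# < expSum (suc m) x
        0<e = +-pos (<-≤-trans 0<1 (≤-reflexive (sym (expTerm-0 x))))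
          (sum-nonneg {m} (λ k → expTerm-nonneg (suc (Fin.toℕ k)) 0≤x))

  SupExp-0 : SupExp 0# 1#
  SupExp-0 = upper , (λ u bound → ≤-trans (≤-reflexive (sym (expSum-1 0#))) (bound 1))
    where
    upper : ∀ m → expSum m 0# ≤ 1#
    upper zero    = 0≤1
    upper (suc m) = ≤-reflexive (trans (+-cong (expTerm-0 0#)
      (trans (sum-cong-≋ {m} (λ k → trans (*-congʳ (zeroˡ _)) (zeroˡ _))) (sum-replicate-zero m)))
      (+-identityʳ 1#))

  SupExp-· : ∀ {x a} k → 0# ≤ x → SupExp x a → SupExp (fromℕ k * x) (a ^ k)
  SupExp-· zero    0≤x x↦a = SupExp-resp-≈ (sym (zeroˡ _)) refl SupExp-0
  SupExp-· {x} (suc k) 0≤x x↦a = SupExp-resp-≈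
    (solve 2 (λ x k → x :+ k :* x := (:1 :+ k) :* x) refl x (fromℕ k)) refl
    (SupExp-+ 0≤x (*-nonneg (0≤fromℕ k) 0≤x) x↦a (SupExp-· k 0≤x x↦a))

-- Finite sums, products and expectations

any : ∀ {k} → (Fin k → Bool) → Bool
any {zero}  b = false
any {suc k} b = b zero ∨ any (λ i → b (suc i))

count : ∀ {k} → (Fin k → Bool) → ℕ
count {zero}  b = 0
count {suc k} b = (if b zero then 1 else 0) ℕ.+ count (λ i → b (suc i))

module FiniteExpectation {c ℓ₁ ℓ₂} (F : CompleteOrderedField c ℓ₁ ℓ₂) where
  open CompleteOrderedField F hiding (zero; _∨_)
  open OrderedFieldProperties F
  open SetoidReasoning setoid

  𝟙 : Bool → Carrier
  𝟙 b = if b then 1# else 0#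

  0≤𝟙 : ∀ b → 0# ≤ 𝟙 b
  0≤𝟙 true  = 0≤1
  0≤𝟙 false = ≤-refl

  𝟙≤1 : ∀ b → 𝟙 b ≤ 1#
  𝟙≤1 true  = ≤-refl
  𝟙≤1 false = 0≤1

  𝟙-not : ∀ b → 𝟙 (not b) ≈ 1# - 𝟙 b
  𝟙-not true  = sym (-‿inverseʳ 1#)
  𝟙-not false = solve 0 (:1 := :1 :- :0) refl

  𝟙-∧ : ∀ a b → 𝟙 (a ∧ b) ≈ 𝟙 a * 𝟙 b
  𝟙-∧ true  b = sym (*-identityˡ _)
  𝟙-∧ false b = sym (zeroˡ _)

  𝟙*𝟙 : ∀ b → 𝟙 b * 𝟙 b ≈ 𝟙 b
  𝟙*𝟙 true  = *-identityˡ 1#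
  𝟙*𝟙 false = zeroˡ 0#

  𝟙-mono : ∀ a b → (T a → T b) → 𝟙 a ≤ 𝟙 b
  𝟙-mono true  true  _ = ≤-refl
  𝟙-mono true  false f with () ← f _
  𝟙-mono false b     _ = 0≤𝟙 b

  fromℕ-count : ∀ {k} (b : Fin k → Bool) → fromℕ (count b) ≈ sum (λ i → 𝟙 (b i))
  fromℕ-count {zero}  b = refl
  fromℕ-count {suc k} b with b zero
  ... | true  = +-congˡ (fromℕ-count (λ i → b (suc i)))
  ... | false = trans (fromℕ-count (λ i → b (suc i))) (sym (+-identityˡ _))

  ∏ : ∀ {k} → (Fin k → Carrier) → Carrier
  ∏ {zero}  f = 1#
  ∏ {suc k} f = f zero * ∏ (λ i → f (suc i))

  ∏-cong : ∀ {k} {f g : Fin k → Carrier} → (∀ i → f i ≈ g i) → ∏ f ≈ ∏ g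
  ∏-cong {zero}  f≈g = refl
  ∏-cong {suc k} f≈g = *-cong (f≈g zero) (∏-cong (λ i → f≈g (suc i)))

  ∏-nonneg : ∀ {k} {f : Fin k → Carrier} → (∀ i → 0# ≤ f i) → 0# ≤ ∏ f
  ∏-nonneg {zero}  0≤f = 0≤1
  ∏-nonneg {suc k} 0≤f = *-nonneg (0≤f zero) (∏-nonneg (λ i → 0≤f (suc i)))

  ∏-mono-≤ : ∀ {k} {f g : Fin k → Carrier} → (∀ i → 0# ≤ f i) → (∀ i → f i ≤ g i) → ∏ f ≤ ∏ g
  ∏-mono-≤ {zero}  0≤f f≤g = ≤-refl
  ∏-mono-≤ {suc k} 0≤f f≤g = *-mono-≤ (0≤f zero) (f≤g zero)
    (∏-nonneg (λ i → 0≤f (suc i))) (∏-mono-≤ (λ i → 0≤f (suc i)) (λ i → f≤g (suc i)))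

  ∏-* : ∀ {k} (f g : Fin k → Carrier) → ∏ (λ i → f i * g i) ≈ ∏ f * ∏ g
  ∏-* {zero}  f g = sym (*-identityˡ 1#)
  ∏-* {suc k} f g = trans (*-congˡ (∏-* (λ i → f (suc i)) (λ i → g (suc i))))
    (solve 4 (λ a b c d → (a :* b) :* (c :* d) := (a :* c) :* (b :* d)) refl _ _ _ _)

  ∏-𝟙-not : ∀ {k} (b : Fin k → Bool) → ∏ (λ i → 𝟙 (not (b i))) ≈ 𝟙 (not (any b))
  ∏-𝟙-not {zero}  b = refl
  ∏-𝟙-not {suc k} b with b zero
  ... | true  = zeroˡ _
  ... | false = trans (*-identityˡ _) (∏-𝟙-not (λ i → b (suc i)))

  ∏-power : ∀ {k} (b : Fin k → Bool) x → ∏ (λ i → 1# - x * 𝟙 (b i)) ≈ (1# - x) ^ count b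
  ∏-power {zero}  b x = refl
  ∏-power {suc k} b x with b zero
  ... | true  = *-cong (solve 1 (λ x → :1 :- x :* :1 := :1 :- x) refl x) (∏-power (λ i → b (suc i)) x)
  ... | false = trans (*-cong (solve 1 (λ x → :1 :- x :* :0 := :1) refl x) (∏-power (λ i → b (suc i)) x))
                      (*-identityˡ _)

  ∑-*ˡ : ∀ {k} x (f : Fin k → Carrier) → sum (λ i → x * f i) ≈ x * sum f
  ∑-*ˡ x f = sym (*-distribˡ-sum x f)

  ∑-*ʳ : ∀ {k} x (f : Fin k → Carrier) → sum (λ i → f i * x) ≈ sum f * x
  ∑-*ʳ x f = sym (*-distribʳ-sum x f)

  ∑-const : ∀ k x → sum {k} (λ _ → x) ≈ fromℕ k * x
  ∑-const zero    x = sym (zeroˡ x)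
  ∑-const (suc k) x = trans (+-congˡ (∑-const k x))
    (solve 2 (λ k x → x :+ k :* x := (:1 :+ k) :* x) refl (fromℕ k) x)

  ∑-distrib-- : ∀ {k} (f g : Fin k → Carrier) → sum (λ i → f i - g i) ≈ sum f - sum g
  ∑-distrib-- {zero}  f g = sym (-‿inverseʳ 0#)
  ∑-distrib-- {suc k} f g = trans (+-congˡ (∑-distrib-- (λ i → f (suc i)) (λ i → g (suc i))))
    (solve 4 (λ a b c d → (a :- b) :+ (c :- d) := (a :+ c) :- (b :+ d)) refl _ _ _ _)

  ∑-δ : ∀ {k} (f : Fin k → Carrier) u → sum (λ w → f w * 𝟙 (does (w Fin.≟ u))) ≈ f u
  ∑-δ {suc k} f zero    = trans (+-cong (*-identityʳ _)
    (trans (sum-cong-≋ (λ w → zeroʳ (f (suc w)))) (sum-replicate-zero k))) (+-identityʳ _)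
  ∑-δ {suc k} f (suc u) = trans (+-congʳ (zeroʳ _)) (trans (+-identityˡ _) (∑-δ (λ w → f (suc w)) u))

  module _ {a} {A : Set a} where
    ∑ₗ : List A → (A → Carrier) → Carrier
    ∑ₗ []       f = 0#
    ∑ₗ (x ∷ xs) f = f x + ∑ₗ xs f

    ∑ₗ-cong : ∀ xs {f g} → (∀ x → f x ≈ g x) → ∑ₗ xs f ≈ ∑ₗ xs g
    ∑ₗ-cong []       f≈g = refl
    ∑ₗ-cong (x ∷ xs) f≈g = +-cong (f≈g x) (∑ₗ-cong xs f≈g)

    ∑ₗ-mono-≤ : ∀ xs {f g} → (∀ x → f x ≤ g x) → ∑ₗ xs f ≤ ∑ₗ xs g
    ∑ₗ-mono-≤ []       f≤g = ≤-refl
    ∑ₗ-mono-≤ (x ∷ xs) f≤g = +-mono-≤ (f≤g x) (∑ₗ-mono-≤ xs f≤g)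

    ∑ₗ-+ : ∀ xs f g → ∑ₗ xs (λ x → f x + g x) ≈ ∑ₗ xs f + ∑ₗ xs g
    ∑ₗ-+ []       f g = sym (+-identityˡ 0#)
    ∑ₗ-+ (x ∷ xs) f g = trans (+-congˡ (∑ₗ-+ xs f g))
      (solve 4 (λ a b c d → (a :+ b) :+ (c :+ d) := (a :+ c) :+ (b :+ d)) refl _ _ _ _)

    ∑ₗ-*ˡ : ∀ xs k f → ∑ₗ xs (λ x → k * f x) ≈ k * ∑ₗ xs f
    ∑ₗ-*ˡ []       k f = sym (zeroʳ k)
    ∑ₗ-*ˡ (x ∷ xs) k f = trans (+-congˡ (∑ₗ-*ˡ xs k f)) (sym (distribˡ k _ _))

    ∑ₗ-++ : ∀ xs ys f → ∑ₗ (xs ++ ys) f ≈ ∑ₗ xs f + ∑ₗ ys f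
    ∑ₗ-++ []       ys f = sym (+-identityˡ _)
    ∑ₗ-++ (x ∷ xs) ys f = trans (+-congˡ (∑ₗ-++ xs ys f)) (sym (+-assoc _ _ _))

    ∑ₗ-1 : ∀ xs → ∑ₗ xs (λ _ → 1#) ≈ fromℕ (length xs)
    ∑ₗ-1 []       = refl
    ∑ₗ-1 (x ∷ xs) = +-congˡ (∑ₗ-1 xs)

    ∑ₗ-𝟙 : ∀ (p : A → Bool) xs → ∑ₗ xs (λ x → 𝟙 (p x)) ≈ fromℕ (length (filterᵇ p xs))
    ∑ₗ-𝟙 p []       = refl
    ∑ₗ-𝟙 p (x ∷ xs) with p x
    ... | true  = +-congˡ (∑ₗ-𝟙 p xs)
    ... | false = trans (+-identityˡ _) (∑ₗ-𝟙 p xs)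

    ∑ₗ-filter-tabulate : ∀ {k} (p : A → Bool) (h : Fin k → A) f →
      ∑ₗ (filterᵇ p (List.tabulate h)) f ≈ sum (λ i → 𝟙 (p (h i)) * f (h i))
    ∑ₗ-filter-tabulate {zero}  p h f = refl
    ∑ₗ-filter-tabulate {suc k} p h f with p (h zero)
    ... | true  = +-cong (sym (*-identityˡ _)) (∑ₗ-filter-tabulate p (λ i → h (suc i)) f)
    ... | false = trans (∑ₗ-filter-tabulate p (λ i → h (suc i)) f)
                    (sym (trans (+-congʳ (zeroˡ _)) (+-identityˡ _)))

  ∑ₗ-map : ∀ {a b} {A : Set a} {B : Set b} (h : A → B) xs f → ∑ₗ (List.map h xs) f ≈ ∑ₗ xs (λ x → f (h x))
  ∑ₗ-map h []       f = refl
  ∑ₗ-map h (x ∷ xs) f = +-congˡ (∑ₗ-map h xs f)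

  ∑ₗ-cartesianProductWith : ∀ {a b c} {A : Set a} {B : Set b} {C : Set c} (h : A → B → C) xs ys f →
    ∑ₗ (cartesianProductWith h xs ys) f ≈ ∑ₗ xs (λ x → ∑ₗ ys (λ y → f (h x y)))
  ∑ₗ-cartesianProductWith h []       ys f = refl
  ∑ₗ-cartesianProductWith h (x ∷ xs) ys f = trans (∑ₗ-++ (List.map (h x) ys) _ f)
    (+-cong (∑ₗ-map (h x) ys f) (∑ₗ-cartesianProductWith h xs ys f))

  -- A positive linear functional of total mass 1: the probabilistic arguments use these laws alone,
  -- and `_UniformOn_` restores the link to counting outcomes.
  record Expectation {a} (A : Set a) : Set (c ⊔ ℓ₁ ⊔ ℓ₂ ⊔ a) where
    field
      𝔼      : (A → Carrier) → Carrier
      𝔼-mono : ∀ {f g} → (∀ x → f x ≤ g x) → 𝔼 f ≤ 𝔼 g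
      𝔼-+    : ∀ f g → 𝔼 (λ x → f x + g x) ≈ 𝔼 f + 𝔼 g
      𝔼-*ˡ   : ∀ k f → 𝔼 (λ x → k * f x) ≈ k * 𝔼 f
      𝔼-1    : 𝔼 (λ _ → 1#) ≈ 1#

    𝔼-cong : ∀ {f g} → (∀ x → f x ≈ g x) → 𝔼 f ≈ 𝔼 g
    𝔼-cong f≈g = ≤-antisym (𝔼-mono (λ x → ≤-reflexive (f≈g x))) (𝔼-mono (λ x → ≤-reflexive (sym (f≈g x))))

    𝔼-const : ∀ k → 𝔼 (λ _ → k) ≈ k
    𝔼-const k = begin
      𝔼 (λ _ → k)        ≈⟨ 𝔼-cong (λ _ → sym (*-identityʳ k)) ⟩
      𝔼 (λ _ → k * 1#)   ≈⟨ 𝔼-*ˡ k _ ⟩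
      k * 𝔼 (λ _ → 1#)   ≈⟨ *-congˡ 𝔼-1 ⟩
      k * 1#             ≈⟨ *-identityʳ k ⟩
      k ∎

    𝔼-*ʳ : ∀ k f → 𝔼 (λ x → f x * k) ≈ 𝔼 f * k
    𝔼-*ʳ k f = trans (𝔼-cong (λ x → *-comm (f x) k)) (trans (𝔼-*ˡ k f) (*-comm k _))

    𝔼-sum : ∀ {k} (f : Fin k → A → Carrier) → 𝔼 (λ x → sum (λ i → f i x)) ≈ sum (λ i → 𝔼 (f i))
    𝔼-sum {zero}  f = 𝔼-const 0#
    𝔼-sum {suc k} f = trans (𝔼-+ _ _) (+-congˡ (𝔼-sum (λ i → f (suc i))))

    𝔼-linear : ∀ a b f → 𝔼 (λ x → a - b * f x) ≈ a - b * 𝔼 f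
    𝔼-linear a b f = begin
      𝔼 (λ x → a - b * f x)
        ≈⟨ 𝔼-cong (λ x → solve 3 (λ a b f → a :- b :* f := a :+ (:- b) :* f) refl a b (f x)) ⟩
      𝔼 (λ x → a + - b * f x)         ≈⟨ 𝔼-+ _ _ ⟩
      𝔼 (λ _ → a) + 𝔼 (λ x → - b * f x) ≈⟨ +-cong (𝔼-const a) (𝔼-*ˡ (- b) f) ⟩
      a + - b * 𝔼 f                   ≈⟨ solve 3 (λ a b f → a :+ (:- b) :* f := a :- b :* f) refl a b (𝔼 f) ⟩
      a - b * 𝔼 f ∎

  open Expectation public

  uniform : ∀ {a} {A : Set a} (xs : List A) ι → 0# ≤ ι → ι * fromℕ (length xs) ≈ 1# → Expectation A
  uniform xs ι 0≤ι ι*∣xs∣≈1 = record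
    { 𝔼      = λ f → ι * ∑ₗ xs f
    ; 𝔼-mono = λ f≤g → *-monoˡ-≤ 0≤ι (∑ₗ-mono-≤ xs f≤g)
    ; 𝔼-+    = λ f g → trans (*-congˡ (∑ₗ-+ xs f g)) (distribˡ ι _ _)
    ; 𝔼-*ˡ   = λ k f → trans (*-congˡ (∑ₗ-*ˡ xs k f)) (x∙yz≈y∙xz ι k _)
    ; 𝔼-1    = trans (*-congˡ (∑ₗ-1 xs)) ι*∣xs∣≈1
    }

  -- The product measure as an iterated expectation, so that conditioning on the first coordinate
  -- holds by definition.
  independent : ∀ {a} {A : Set a} k → (Fin k → Expectation A) → Expectation (Vec A k)
  independent zero    e = record
    { 𝔼 = λ f → f [] ; 𝔼-mono = λ f≤g → f≤g [] ; 𝔼-+ = λ f g → refl ; 𝔼-*ˡ = λ k f → refl ; 𝔼-1 = refl }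
  independent (suc k) e = record
    { 𝔼      = λ f → 𝔼 e₀ (λ x → 𝔼 es (λ v → f (x ∷ v)))
    ; 𝔼-mono = λ f≤g → 𝔼-mono e₀ (λ x → 𝔼-mono es (λ v → f≤g (x ∷ v)))
    ; 𝔼-+    = λ f g → trans (𝔼-cong e₀ (λ x → 𝔼-+ es _ _)) (𝔼-+ e₀ _ _)
    ; 𝔼-*ˡ   = λ k f → trans (𝔼-cong e₀ (λ x → 𝔼-*ˡ es k _)) (𝔼-*ˡ e₀ k _)
    ; 𝔼-1    = trans (𝔼-cong e₀ (λ x → 𝔼-1 es)) (𝔼-1 e₀)
    }
    where
    e₀ = e zero
    es = independent k (λ i → e (suc i))

  𝔼-∏ : ∀ {a} {A : Set a} k (e : Fin k → Expectation A) (g : Fin k → A → Carrier) →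
    𝔼 (independent k e) (λ v → ∏ (λ i → g i (Vec.lookup v i))) ≈ ∏ (λ i → 𝔼 (e i) (g i))
  𝔼-∏ zero    e g = refl
  𝔼-∏ (suc k) e g = begin
    𝔼 e₀ (λ x → 𝔼 es (λ v → g zero x * ∏ (λ i → g (suc i) (Vec.lookup v i))))
      ≈⟨ 𝔼-cong e₀ (λ x → 𝔼-*ˡ es (g zero x) _) ⟩
    𝔼 e₀ (λ x → g zero x * 𝔼 es (λ v → ∏ (λ i → g (suc i) (Vec.lookup v i))))
      ≈⟨ 𝔼-*ʳ e₀ _ (g zero) ⟩
    𝔼 e₀ (g zero) * 𝔼 es (λ v → ∏ (λ i → g (suc i) (Vec.lookup v i)))
      ≈⟨ *-congˡ (𝔼-∏ k (λ i → e (suc i)) (λ i → g (suc i))) ⟩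
    𝔼 e₀ (g zero) * ∏ (λ i → 𝔼 (e (suc i)) (g (suc i))) ∎
    where
    e₀ = e zero
    es = independent k (λ i → e (suc i))

  -- Multiplying by the length instead of dividing by it avoids a nonemptiness condition and matches
  -- the counting form of `Prob≥`.
  _UniformOn_ : ∀ {a} {A : Set a} → Expectation A → List A → Set _
  e UniformOn xs = ∀ f → ∑ₗ xs f ≈ fromℕ (length xs) * 𝔼 e f

  uniform-UniformOn : ∀ {a} {A : Set a} (xs : List A) ι 0≤ι ι*∣xs∣≈1 → uniform xs ι 0≤ι ι*∣xs∣≈1 UniformOn xs
  uniform-UniformOn xs ι _ ι*∣xs∣≈1 f = sym (begin
    fromℕ (length xs) * (ι * ∑ₗ xs f)
      ≈⟨ x∙yz≈yx∙z (fromℕ (length xs)) ι _ ⟩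
    (ι * fromℕ (length xs)) * ∑ₗ xs f ≈⟨ *-congʳ ι*∣xs∣≈1 ⟩
    1# * ∑ₗ xs f                      ≈⟨ *-identityˡ _ ⟩
    ∑ₗ xs f ∎)

  module _ {n} (G : Graph n) where
    open PushModel G using (product)

    independent-UniformOn : ∀ {a} {A : Set a} k (e : Fin k → Expectation A) (xss : Vec (List A) k) →
      (∀ i → e i UniformOn Vec.lookup xss i) → independent k e UniformOn product xss
    independent-UniformOn zero    e []         uni f =
      sym (trans (*-congʳ fromℕ-1) (trans (*-identityˡ _) (sym (+-identityʳ _))))
    independent-UniformOn (suc k) e (xs ∷ xss) uni f = begin
      ∑ₗ (product (xs ∷ xss)) f
        ≈⟨ both f ⟩
      N * M * 𝔼 (e zero) (λ x → 𝔼 es (λ v → f (x ∷ v)))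
        -- The length of the product list is itself a sum, that of the constant 1, so `both`
        -- identifies it with N * M.
        ≈⟨ *-congʳ (sym (begin
            fromℕ (length (product (xs ∷ xss)))     ≈⟨ sym (∑ₗ-1 (product (xs ∷ xss))) ⟩
            ∑ₗ (product (xs ∷ xss)) (λ _ → 1#)      ≈⟨ both (λ _ → 1#) ⟩
            N * M * 𝔼 (e zero) (λ x → 𝔼 es (λ v → 1#)) ≈⟨ *-congˡ (𝔼-1 (independent (suc k) e)) ⟩
            N * M * 1#                              ≈⟨ *-identityʳ _ ⟩
            N * M ∎)) ⟩
      fromℕ (length (product (xs ∷ xss))) * 𝔼 (e zero) (λ x → 𝔼 es (λ v → f (x ∷ v))) ∎
      where
      es = independent k (λ i → e (suc i))
      N = fromℕ (length xs)
      M = fromℕ (length (product xss))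
      both : ∀ f → ∑ₗ (product (xs ∷ xss)) f ≈ N * M * 𝔼 (e zero) (λ x → 𝔼 es (λ v → f (x ∷ v)))
      both f = begin
        ∑ₗ (product (xs ∷ xss)) f
          ≈⟨ ∑ₗ-cartesianProductWith _∷_ xs (product xss) f ⟩
        ∑ₗ xs (λ x → ∑ₗ (product xss) (λ v → f (x ∷ v)))
          ≈⟨ ∑ₗ-cong xs (λ x → independent-UniformOn k (λ i → e (suc i)) xss (λ i → uni (suc i)) (λ v → f (x ∷ v))) ⟩
        ∑ₗ xs (λ x → M * 𝔼 es (λ v → f (x ∷ v)))
          ≈⟨ ∑ₗ-*ˡ xs M _ ⟩
        M * ∑ₗ xs (λ x → 𝔼 es (λ v → f (x ∷ v)))
          ≈⟨ *-congˡ (uni zero _) ⟩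
        M * (N * 𝔼 (e zero) (λ x → 𝔼 es (λ v → f (x ∷ v))))
          ≈⟨ x∙yz≈yx∙z M N _ ⟩
        N * M * 𝔼 (e zero) (λ x → 𝔼 es (λ v → f (x ∷ v))) ∎

-- Eigenvalue bounds in regular graphs

module RegularGraph {c ℓ₁ ℓ₂} (ℝ : Reals c ℓ₁ ℓ₂) {n} (G : Graph n) (d : ℕ) (regular : Graph.Regular G d) where
  open Reals ℝ hiding (zero)
  open OrderedFieldProperties completeOrderedField
  open FiniteExpectation completeOrderedField
  open Graph G

  degree : ∀ u → sum (λ w → 𝟙 (adj u w)) ≈ fromℕ d
  degree u = begin
    sum (λ w → 𝟙 (adj u w))                ≈⟨ sum-cong-≋ (λ w → sym (*-identityʳ (𝟙 (adj u w)))) ⟩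
    sum (λ w → 𝟙 (adj u w) * 1#)           ≈⟨ sym (∑ₗ-filter-tabulate (adj u) (λ w → w) (λ _ → 1#)) ⟩
    ∑ₗ (neighbours u) (λ _ → 1#)           ≈⟨ ∑ₗ-1 (neighbours u) ⟩
    fromℕ (length (neighbours u))          ≡⟨ ≡.cong fromℕ (regular u) ⟩
    fromℕ d ∎
    where open SetoidReasoning setoid

module SpectralBounds {c ℓ₁ ℓ₂} (ℝ : Reals c ℓ₁ ℓ₂) {m} (G : Graph (suc m)) (d : ℕ) (lam : Reals.Carrier ℝ)
  (ndλ : IsNdλGraph ℝ G d lam) (lam<d : Reals._<_ ℝ lam (Reals.fromℕ ℝ d)) where
  open Reals ℝ hiding (zero; _∨_)
  open OrderedFieldProperties completeOrderedField
  open FiniteExpectation completeOrderedField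
  open IsNdλGraph ndλ
  open Spectrum spectrum
  open Graph G
  open RegularGraph ℝ G d regular public

  private
    n = suc m
    Vector = Fin n → Carrier
    N = fromℕ n

  ⟪_,_⟫ : Vector → Vector → Carrier
  ⟪ x , y ⟫ = sum (λ u → x u * y u)

  A·_ : Vector → Vector
  (A· x) u = sum (λ w → 𝟙 (adj u w) * x w)

  private
    ones : Vector
    ones _ = 1#

    foldr-∨-upper : ∀ {k} (f : Fin k → Carrier) i → f i ≤ Vector.foldr (Reals._∨_ ℝ) 0# f
    foldr-∨-upper f zero    = x≤x∨y _ _
    foldr-∨-upper f (suc i) = ≤-trans (foldr-∨-upper (λ j → f (suc j)) i) (y≤x∨y _ _)

    0≤foldr-∨ : ∀ {k} (f : Fin k → Carrier) → 0# ≤ Vector.foldr (Reals._∨_ ℝ) 0# f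
    0≤foldr-∨ {zero}  f = ≤-refl
    0≤foldr-∨ {suc k} f = ≤-trans (0≤foldr-∨ (λ j → f (suc j))) (y≤x∨y _ _)

  0≤lam : 0# ≤ lam
  0≤lam = ≤-trans (0≤foldr-∨ (λ j → ∣ value (suc j) ∣)) (≤-reflexive (sym lam≈max))

  ∣value∣≤lam : ∀ i → ∣ value (suc i) ∣ ≤ lam
  ∣value∣≤lam i = ≤-trans (foldr-∨-upper (λ j → ∣ value (suc j) ∣) i) (≤-reflexive (sym lam≈max))

  private
    open SetoidReasoning setoid

    parseval : ∀ x y → ⟪ x , y ⟫ ≈ sum (λ i → ⟪ x , vector i ⟫ * ⟪ y , vector i ⟫)
    parseval x y = begin
      sum (λ u → x u * y u)
        ≈⟨ sum-cong-≋ (λ u → *-congˡ {x u} (spanning y u)) ⟩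
      sum (λ u → x u * sum (λ i → ⟪ y , vector i ⟫ * vector i u))
        ≈⟨ sum-cong-≋ (λ u → *-distribˡ-sum (x u) (λ i → ⟪ y , vector i ⟫ * vector i u)) ⟩
      sum (λ u → sum (λ i → x u * (⟪ y , vector i ⟫ * vector i u)))
        ≈⟨ ∑-comm (λ u i → x u * (⟪ y , vector i ⟫ * vector i u)) ⟩
      sum (λ i → sum (λ u → x u * (⟪ y , vector i ⟫ * vector i u)))
        ≈⟨ sum-cong-≋ (λ i → trans
             (sum-cong-≋ (λ u → solve 3 (λ a b c → a :* (b :* c) := (a :* c) :* b) refl (x u) ⟪ y , vector i ⟫ (vector i u)))
             (∑-*ʳ ⟪ y , vector i ⟫ (λ u → x u * vector i u))) ⟩
      sum (λ i → ⟪ x , vector i ⟫ * ⟪ y , vector i ⟫) ∎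

    selfAdjoint : ∀ x y → ⟪ A· x , y ⟫ ≈ ⟪ x , A· y ⟫
    selfAdjoint x y = begin
      sum (λ u → sum (λ w → 𝟙 (adj u w) * x w) * y u)
        ≈⟨ sum-cong-≋ (λ u → *-distribʳ-sum (y u) (λ w → 𝟙 (adj u w) * x w)) ⟩
      sum (λ u → sum (λ w → 𝟙 (adj u w) * x w * y u))
        ≈⟨ ∑-comm (λ u w → 𝟙 (adj u w) * x w * y u) ⟩
      sum (λ w → sum (λ u → 𝟙 (adj u w) * x w * y u))
        ≈⟨ sum-cong-≋ (λ w → sum-cong-≋ (λ u → trans
             (*-congʳ (*-congʳ (reflexive (≡.cong 𝟙 (symm u w)))))
             (solve 3 (λ a b c → a :* b :* c := b :* (a :* c)) refl (𝟙 (adj w u)) (x w) (y u)))) ⟩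
      sum (λ w → sum (λ u → x w * (𝟙 (adj w u) * y u)))
        ≈⟨ sum-cong-≋ (λ w → ∑-*ˡ (x w) (λ u → 𝟙 (adj w u) * y u)) ⟩
      sum (λ w → x w * (A· y) w) ∎

    coefficient-A : ∀ x i → ⟪ A· x , vector i ⟫ ≈ value i * ⟪ x , vector i ⟫
    coefficient-A x i = begin
      ⟪ A· x , vector i ⟫                    ≈⟨ selfAdjoint x (vector i) ⟩
      sum (λ u → x u * (A· vector i) u)      ≈⟨ sum-cong-≋ (λ u → *-congˡ {x u} (eigen i u)) ⟩
      sum (λ u → x u * (value i * vector i u))
        ≈⟨ sum-cong-≋ (λ u → x∙yz≈y∙xz (x u) (value i) (vector i u)) ⟩
      sum (λ u → value i * (x u * vector i u)) ≈⟨ ∑-*ˡ (value i) (λ u → x u * vector i u) ⟩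
      value i * ⟪ x , vector i ⟫ ∎

    A-ones : ∀ u → (A· ones) u ≈ fromℕ d
    A-ones u = trans (sum-cong-≋ (λ w → *-identityʳ (𝟙 (adj u w)))) (degree u)

    -- The constant vector has eigenvalue d by regularity, and all later eigenvalues are at most λ <
    -- d; eigenvectors of a self-adjoint map with different eigenvalues are orthogonal.
    ones⊥vector : ∀ i → ⟪ ones , vector (suc i) ⟫ ≈ 0#
    ones⊥vector i = *-cancelˡ-≈ (x<y⇒0<y-x (≤-<-trans (≤-trans (x≤∣x∣ (value (suc i))) (∣value∣≤lam i)) lam<d)) (begin
      (fromℕ d - value (suc i)) * z      ≈⟨ solve 3 (λ d v z → (d :- v) :* z := d :* z :- v :* z) refl (fromℕ d) _ z ⟩
      fromℕ d * z - value (suc i) * z    ≈⟨ +-congˡ (-‿cong (sym (coefficient-A ones (suc i)))) ⟩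
      fromℕ d * z - ⟪ A· ones , vector (suc i) ⟫
        ≈⟨ +-congˡ (-‿cong (trans (sum-cong-≋ (λ u → *-congʳ {vector (suc i) u} (trans (A-ones u) (sym (*-identityʳ _)))))
             (trans (sum-cong-≋ (λ u → *-assoc (fromℕ d) 1# (vector (suc i) u))) (∑-*ˡ (fromℕ d) (λ u → 1# * vector (suc i) u))))) ⟩
      fromℕ d * z - fromℕ d * z          ≈⟨ -‿inverseʳ _ ⟩
      0#                                 ≈⟨ sym (zeroʳ _) ⟩
      (fromℕ d - value (suc i)) * 0# ∎)
      where z = ⟪ ones , vector (suc i) ⟫

    ⟪x,ones⟫ : ∀ x → ⟪ x , ones ⟫ ≈ ⟪ x , vector zero ⟫ * ⟪ ones , vector zero ⟫
    ⟪x,ones⟫ x = begin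
      ⟪ x , ones ⟫ ≈⟨ parseval x ones ⟩
      ⟪ x , vector zero ⟫ * ⟪ ones , vector zero ⟫ + sum (λ i → ⟪ x , vector (suc i) ⟫ * ⟪ ones , vector (suc i) ⟫)
        ≈⟨ +-congˡ (trans (sum-cong-≋ (λ i → trans (*-congˡ (ones⊥vector i)) (zeroʳ _))) (sum-replicate-zero m)) ⟩
      ⟪ x , vector zero ⟫ * ⟪ ones , vector zero ⟫ + 0# ≈⟨ +-identityʳ _ ⟩
      ⟪ x , vector zero ⟫ * ⟪ ones , vector zero ⟫ ∎

    -- Instead of identifying the first eigenvector with a multiple of the constant vector, which
    -- would bring in a sign and √n, its products with `x` and with `ones` are combined: ⟪ ones , v₀
    -- ⟫² = n and ⟪ x , v₀ ⟫ ⟪ ones , v₀ ⟫ = sum x.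
    first-coefficient : ∀ x → N * (⟪ x , vector zero ⟫ * ⟪ x , vector zero ⟫) ≈ sum x * sum x
    first-coefficient x = begin
      N * (c₀ * c₀)                    ≈⟨ *-congʳ (trans (sym (trans (∑-const n (1# * 1#)) (trans (*-congˡ (*-identityˡ 1#)) (*-identityʳ N)))) (⟪x,ones⟫ ones)) ⟩
      (z * z) * (c₀ * c₀)              ≈⟨ solve 2 (λ z c → (z :* z) :* (c :* c) := (c :* z) :* (c :* z)) refl z c₀ ⟩
      (c₀ * z) * (c₀ * z)              ≈⟨ *-cong sum-x sum-x ⟩
      sum x * sum x ∎
      where
      c₀ = ⟪ x , vector zero ⟫
      z = ⟪ ones , vector zero ⟫
      sum-x : c₀ * z ≈ sum x
      sum-x = trans (sym (⟪x,ones⟫ x)) (sum-cong-≋ (λ u → *-identityʳ (x u)))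

    -- Common core of the two bounds below, with the eigenvalues or their squares as weights. Adding
    -- K times the square of the first coefficient completes the tail to the full norm of `x`.
    weighted-coefficients : ∀ (w : Fin n → Carrier) {W K} x → w zero ≈ W → 0# ≤ K → (∀ i → w (suc i) ≤ K) →
      N * sum (λ i → w i * (⟪ x , vector i ⟫ * ⟪ x , vector i ⟫)) ≤ W * (sum x * sum x) + K * (N * ⟪ x , x ⟫)
    weighted-coefficients w {W} {K} x w₀≈W 0≤K w≤K = ≤B.begin
      N * sum (λ i → w i * (cf i * cf i))
        ≤B.≤⟨ *-monoˡ-≤ (0≤fromℕ n) (+-mono-≤ (≤-reflexive (*-congʳ w₀≈W))
              (≤-trans (sum-mono-≤ (λ i → *-monoʳ-≤ (0≤x*x (cf (suc i))) (w≤K i)))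
                (≤-reflexive (∑-*ˡ K (λ i → cf (suc i) * cf (suc i)))))) ⟩
      N * (W * (cf zero * cf zero) + K * sum (λ i → cf (suc i) * cf (suc i)))
        ≤B.≤⟨ ≤-by (*-nonneg (0≤fromℕ n) (*-nonneg 0≤K (0≤x*x (cf zero))))
              (solve 5 (λ n w k a s → w :* (n :* a) :+ k :* (n :* (a :+ s)) := n :* (w :* a :+ k :* s) :+ n :* (k :* a)) refl
                N W K (cf zero * cf zero) (sum (λ i → cf (suc i) * cf (suc i)))) ⟩
      W * (N * (cf zero * cf zero)) + K * (N * sum (λ i → cf i * cf i))
        ≤B.≈⟨ +-cong (*-congˡ (first-coefficient x)) (*-congˡ (*-congˡ (sym (parseval x x)))) ⟩
      W * (sum x * sum x) + K * (N * ⟪ x , x ⟫) ≤B.∎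
      where
      module ≤B = ≤-Reasoning
      cf : Fin n → Carrier
      cf i = ⟪ x , vector i ⟫

  -- For the indicator of a set this is the upper half of the expander mixing lemma for e(S,S),
  -- multiplied by n.
  quadraticForm≤ : ∀ x → N * ⟪ x , A· x ⟫ ≤ fromℕ d * (sum x * sum x) + lam * (N * ⟪ x , x ⟫)
  quadraticForm≤ x = ≤-trans (≤-reflexive (*-congˡ (trans (parseval x (A· x))
      (sum-cong-≋ (λ i → trans (*-congˡ (coefficient-A x i))
        (solve 2 (λ c v → c :* (v :* c) := v :* (c :* c)) refl ⟪ x , vector i ⟫ (value i)))))))
    (weighted-coefficients value x λ₁≈d 0≤lam (λ i → ≤-trans (x≤∣x∣ _) (∣value∣≤lam i)))

  normSquared≤ : ∀ x → N * ⟪ A· x , A· x ⟫ ≤ (fromℕ d * fromℕ d) * (sum x * sum x) + (lam * lam) * (N * ⟪ x , x ⟫)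
  normSquared≤ x = ≤-trans (≤-reflexive (*-congˡ (trans (parseval (A· x) (A· x))
      (sum-cong-≋ (λ i → trans (*-cong (coefficient-A x i) (coefficient-A x i))
        (solve 2 (λ c v → (v :* c) :* (v :* c) := (v :* v) :* (c :* c)) refl ⟪ x , vector i ⟫ (value i)))))))
    (weighted-coefficients (λ i → value i * value i) x (*-cong λ₁≈d λ₁≈d) (0≤x*x lam)
      (λ i → ∣x∣≤y⇒x*x≤y*y (∣value∣≤lam i)))

-- States and the one-round update

State : ℕ → Set
State n = Fin n → Bool

hits : ∀ {n} → Vec (Fin n) n → Fin n → Fin n → Bool
hits r u z = does (Vec.lookup r z Fin.≟ u)

step : ∀ {n} → State n → Vec (Fin n) n → State n
step S r u = S u ∨ any (λ z → S z ∧ hits r u z)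

-- Unlike in step, the choices of uninformed vertices count too, so that the
-- outcome no longer depends on who is informed.
avoid : ∀ {n} → State n → Vec (Fin n) n → State n
avoid V r u = V u ∧ not (any (hits r u))

complement : ∀ {n} → State n → State n
complement S u = not (S u)

-- Powers of 1 - 1/d

module PowerBounds {c ℓ₁ ℓ₂} (F : CompleteOrderedField c ℓ₁ ℓ₂) (d : ℕ) (2≤d : 2 ℕ.≤ d) where
  open CompleteOrderedField F hiding (zero; _∨_)
  open OrderedFieldProperties F
  open ≤-Reasoning

  0<d : 0# < fromℕ d
  0<d = <-trans 0<1 (fromℕ>1 2≤d)

  ι : Carrier
  ι = recip (fromℕ d) 0<d

  0<ι : 0# < ι
  0<ι = 0<recip 0<d

  0≤ι : 0# ≤ ι
  0≤ι = <⇒≤ 0<ι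

  ι*d≈1 : ι * fromℕ d ≈ 1#
  ι*d≈1 = trans (*-comm _ _) (*-recip 0<d)

  ι<1 : ι < 1#
  ι<1 = begin-strict
    ι            ≈⟨ sym (*-identityʳ ι) ⟩
    ι * 1#       <⟨ *-monoˡ-< 0<ι (fromℕ>1 2≤d) ⟩
    ι * fromℕ d  ≈⟨ ι*d≈1 ⟩
    1# ∎

  q : Carrier
  q = 1# - ι

  0≤q : 0# ≤ q
  0≤q = x≤y⇒0≤y-x (<⇒≤ ι<1)

  q≤1 : q ≤ 1#
  q≤1 = ≤-by 0≤ι (solve 1 (λ i → :1 := (:1 :- i) :+ i) refl ι)

  q^k≤1 : ∀ k → q ^ k ≤ 1#
  q^k≤1 k = x≤1⇒x^k≤1 k 0≤q q≤1

  private
    -- The difference 1 - q^k is the sum of ι q^j over j < k, and each of these k terms is at least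
    -- ι q^k.
    tangent : ∀ k → fromℕ k * (ι * q ^ k) ≤ 1# - q ^ k
    tangent zero    = ≤-reflexive (trans (zeroˡ _) (sym (-‿inverseʳ 1#)))
    tangent (suc k) = begin
      (1# + fromℕ k) * (ι * (q * q ^ k))
        ≤⟨ *-monoˡ-≤ (0≤fromℕ (suc k)) (*-monoˡ-≤ 0≤ι
             (≤-trans (*-monoʳ-≤ (^-nonneg k 0≤q) q≤1) (≤-reflexive (*-identityˡ _)))) ⟩
      (1# + fromℕ k) * (ι * q ^ k)
        ≈⟨ solve 3 (λ k i p → (:1 :+ k) :* (i :* p) := k :* (i :* p) :+ i :* p) refl (fromℕ k) ι (q ^ k) ⟩
      fromℕ k * (ι * q ^ k) + ι * q ^ k ≤⟨ +-mono-≤ (tangent k) ≤-refl ⟩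
      (1# - q ^ k) + ι * q ^ k
        ≈⟨ solve 2 (λ i p → (:1 :- p) :+ i :* p := :1 :- (:1 :- i) :* p) refl ι (q ^ k) ⟩
      1# - q * q ^ k ∎

    -- Convexity of k ↦ q^k in cross-multiplied form: the average decrease (1 - q^k)/k does not grow
    -- with k, because by `tangent` every further decrease is below the average so far.
    secant : ∀ k j → fromℕ k * (1# - q ^ (j ℕ.+ k)) ≤ fromℕ (j ℕ.+ k) * (1# - q ^ k)
    secant k zero    = ≤-refl
    secant k (suc j) = begin
      fromℕ k * (1# - q * q ^ (j ℕ.+ k))
        ≈⟨ solve 3 (λ k i p → k :* (:1 :- (:1 :- i) :* p) := k :* (:1 :- p) :+ k :* (i :* p)) refl (fromℕ k) ι (q ^ (j ℕ.+ k)) ⟩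
      fromℕ k * (1# - q ^ (j ℕ.+ k)) + fromℕ k * (ι * q ^ (j ℕ.+ k))
        ≤⟨ +-mono-≤ (secant k j) (≤-trans (*-monoˡ-≤ (0≤fromℕ k) (*-monoˡ-≤ 0≤ι smaller)) (tangent k)) ⟩
      fromℕ (j ℕ.+ k) * (1# - q ^ k) + (1# - q ^ k)
        ≈⟨ solve 2 (λ n p → n :* p :+ p := (:1 :+ n) :* p) refl (fromℕ (j ℕ.+ k)) (1# - q ^ k) ⟩
      (1# + fromℕ (j ℕ.+ k)) * (1# - q ^ k) ∎
      where
      smaller : q ^ (j ℕ.+ k) ≤ q ^ k
      smaller = begin
        q ^ (j ℕ.+ k)   ≈⟨ ^-homo-* q j k ⟩
        q ^ j * q ^ k   ≤⟨ *-monoʳ-≤ (^-nonneg k 0≤q) (q^k≤1 j) ⟩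
        1# * q ^ k      ≈⟨ *-identityˡ _ ⟩
        q ^ k ∎

  -- A convex function lies below its chord between 0 and d. Being linear in k, the bound needs no
  -- more than an edge count once it is summed over vertices.
  q^k≤chord : ∀ {k} → k ℕ.≤ d → q ^ k ≤ 1# - (ι * (1# - q ^ d)) * fromℕ k
  q^k≤chord {k} k≤d = ≤-by (x≤y⇒0≤y-x bound)
    (solve 4 (λ i p k r → :1 :- (i :* (:1 :- p)) :* k := r :+ ((:1 :- r) :- i :* (k :* (:1 :- p)))) refl ι (q ^ d) (fromℕ k) (q ^ k))
    where
    bound : ι * (fromℕ k * (1# - q ^ d)) ≤ 1# - q ^ k
    bound = begin
      ι * (fromℕ k * (1# - q ^ d))
        ≤⟨ *-monoˡ-≤ 0≤ι (≡.subst (λ e → fromℕ k * (1# - q ^ e) ≤ fromℕ e * (1# - q ^ k)) (ℕ.m∸n+n≡m k≤d) (secant k (d ℕ.∸ k))) ⟩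
      ι * (fromℕ d * (1# - q ^ k)) ≈⟨ sym (*-assoc _ _ _) ⟩
      ι * fromℕ d * (1# - q ^ k)   ≈⟨ *-congʳ ι*d≈1 ⟩
      1# * (1# - q ^ k)            ≈⟨ *-identityˡ _ ⟩
      1# - q ^ k ∎

  -- Inclusion-exclusion cut after the second order, doubled to avoid fractions. It has k² where k(k
  -- - 1) would do, since the sum of squared degrees is what the spectrum controls. In the
  -- induction, Bernoulli's inequality bounds the decrease ι q^k from below.
  2q^k≤bonferroni : ∀ k → fromℕ 2 * q ^ k ≤
    fromℕ 2 - (fromℕ 2 * ι) * fromℕ k + (ι * ι) * (fromℕ k * fromℕ k)
  2q^k≤bonferroni zero    = ≤-reflexive
    (solve 1 (λ i → :2 :* :1 := :2 :- (:2 :* i) :* :0 :+ (i :* i) :* (:0 :* :0)) refl ι)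
  2q^k≤bonferroni (suc k) = begin
    fromℕ 2 * (q * q ^ k)
      ≈⟨ solve 2 (λ i p → :2 :* ((:1 :- i) :* p) := :2 :* p :+ :- (:2 :* (i :* p))) refl ι (q ^ k) ⟩
    fromℕ 2 * q ^ k + - (fromℕ 2 * (ι * q ^ k))
      ≤⟨ +-mono-≤ (2q^k≤bonferroni k) (neg-anti-≤ (*-monoˡ-≤ (0≤fromℕ 2) (*-monoˡ-≤ 0≤ι (bernoulli k 0≤q)))) ⟩
    (fromℕ 2 - (fromℕ 2 * ι) * fromℕ k + (ι * ι) * (fromℕ k * fromℕ k)) + - (fromℕ 2 * (ι * (1# + fromℕ k * - ι)))
      ≤⟨ ≤-by (0≤x*x ι) (solve 2 (λ i k →
           :2 :- (:2 :* i) :* (:1 :+ k) :+ (i :* i) :* ((:1 :+ k) :* (:1 :+ k))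
           := ((:2 :- (:2 :* i) :* k :+ (i :* i) :* (k :* k)) :+ :- (:2 :* (i :* (:1 :+ k :* (:- i))))) :+ i :* i)
           refl ι (fromℕ k)) ⟩
    fromℕ 2 - (fromℕ 2 * ι) * (1# + fromℕ k) + (ι * ι) * ((1# + fromℕ k) * (1# + fromℕ k)) ∎

-- Probabilities within one round

module PushRound {c ℓ₁ ℓ₂} (ℝ : Reals c ℓ₁ ℓ₂) {n} (G : Graph n) (d : ℕ)
  (regular : Graph.Regular G d) (2≤d : 2 ℕ.≤ d) where
  open Reals ℝ hiding (zero; _∨_)
  open OrderedFieldProperties completeOrderedField
  open FiniteExpectation completeOrderedField
  open PowerBounds completeOrderedField d 2≤d
  open Graph G
  open RegularGraph ℝ G d regular
  open PushModel G using (Round; rounds)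

  p : Carrier
  p = q ^ d

  0≤p : 0# ≤ p
  0≤p = ^-nonneg d 0≤q

  0≤1-p : 0# ≤ 1# - p
  0≤1-p = x≤y⇒0≤y-x (q^k≤1 d)

  size : State n → Carrier
  size S = sum (λ u → 𝟙 (S u))

  size≥0 : ∀ S → 0# ≤ size S
  size≥0 S = sum-nonneg (λ u → 0≤𝟙 (S u))

  size-complement : ∀ S → size (complement S) ≈ fromℕ n - size S
  size-complement S = trans (sum-cong-≋ (λ u → 𝟙-not (S u))) (trans (∑-distrib-- (λ _ → 1#) (λ u → 𝟙 (S u)))
    (+-congʳ (trans (∑-const n 1#) (*-identityʳ _))))

  private
    ι*degree≈1 : ∀ z → ι * fromℕ (length (neighbours z)) ≈ 1#
    ι*degree≈1 z = trans (*-congˡ (reflexive (≡.cong fromℕ (regular z)))) ι*d≈1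

  targetE : Fin n → Expectation (Fin n)
  targetE z = uniform (neighbours z) ι 0≤ι (ι*degree≈1 z)

  roundE : Expectation Round
  roundE = independent n targetE

  roundE-UniformOn : roundE UniformOn rounds
  roundE-UniformOn = independent-UniformOn G n targetE (Vec.tabulate neighbours) (λ z →
    ≡.subst (targetE z UniformOn_) (≡.sym (lookup∘tabulate neighbours z)) (uniform-UniformOn (neighbours z) ι 0≤ι (ι*degree≈1 z)))

  private
    open SetoidReasoning setoid

    𝔼-target : ∀ z u → 𝔼 (targetE z) (λ x → 𝟙 (does (x Fin.≟ u))) ≈ ι * 𝟙 (adj z u)
    𝔼-target z u = *-congˡ (trans (∑ₗ-filter-tabulate (adj z) (λ w → w) _) (∑-δ (λ w → 𝟙 (adj z w)) u))

    𝔼-missed : ∀ b z u →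
      𝔼 (targetE z) (λ x → 𝟙 (not (b ∧ does (x Fin.≟ u)))) ≈ 1# - ι * 𝟙 (b ∧ adj z u)
    𝔼-missed b z u = begin
      𝔼 (targetE z) (λ x → 𝟙 (not (b ∧ does (x Fin.≟ u))))
        ≈⟨ 𝔼-cong (targetE z) (λ x → trans (𝟙-not (b ∧ does (x Fin.≟ u))) (+-congˡ (-‿cong (𝟙-∧ b (does (x Fin.≟ u)))))) ⟩
      𝔼 (targetE z) (λ x → 1# - 𝟙 b * 𝟙 (does (x Fin.≟ u)))
        ≈⟨ 𝔼-linear (targetE z) 1# (𝟙 b) _ ⟩
      1# - 𝟙 b * 𝔼 (targetE z) (λ x → 𝟙 (does (x Fin.≟ u)))
        ≈⟨ +-congˡ (-‿cong (trans (*-congˡ (𝔼-target z u))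
             (trans (x∙yz≈y∙xz (𝟙 b) ι (𝟙 (adj z u))) (*-congˡ (sym (𝟙-∧ b (adj z u))))))) ⟩
      1# - ι * 𝟙 (b ∧ adj z u) ∎

  degreeInto : State n → Fin n → ℕ
  degreeInto S u = count (λ z → S z ∧ adj z u)

  private
    -- Missing `u` is a product of events over the independent senders, and only an informed
    -- neighbour contributes a factor different from 1.
    P-missedBy : ∀ S u →
      𝔼 roundE (λ r → 𝟙 (not (any (λ z → S z ∧ hits r u z)))) ≈ q ^ degreeInto S u
    P-missedBy S u = begin
      𝔼 roundE (λ r → 𝟙 (not (any (λ z → S z ∧ hits r u z))))
        ≈⟨ 𝔼-cong roundE (λ r → sym (∏-𝟙-not (λ z → S z ∧ hits r u z))) ⟩
      𝔼 roundE (λ r → ∏ (λ z → 𝟙 (not (S z ∧ hits r u z))))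
        ≈⟨ 𝔼-∏ n targetE (λ z x → 𝟙 (not (S z ∧ does (x Fin.≟ u)))) ⟩
      ∏ (λ z → 𝔼 (targetE z) (λ x → 𝟙 (not (S z ∧ does (x Fin.≟ u)))))
        ≈⟨ ∏-cong (λ z → 𝔼-missed (S z) z u) ⟩
      ∏ (λ z → 1# - ι * 𝟙 (S z ∧ adj z u))
        ≈⟨ ∏-power (λ z → S z ∧ adj z u) ι ⟩
      q ^ degreeInto S u ∎

    𝟙-uninformed : ∀ a b → 𝟙 (not (a ∨ b)) ≈ 𝟙 (not a) * 𝟙 (not b)
    𝟙-uninformed true  b = sym (zeroˡ _)
    𝟙-uninformed false b = sym (*-identityˡ _)

  𝔼-uninformed : ∀ S → 𝔼 roundE (λ r → size (complement (step S r))) ≈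
                       sum (λ u → 𝟙 (not (S u)) * q ^ degreeInto S u)
  𝔼-uninformed S = begin
    𝔼 roundE (λ r → sum (λ u → 𝟙 (not (step S r u))))
      ≈⟨ 𝔼-sum roundE (λ u r → 𝟙 (not (step S r u))) ⟩
    sum (λ u → 𝔼 roundE (λ r → 𝟙 (not (step S r u))))
      ≈⟨ sum-cong-≋ (λ u → trans (𝔼-cong roundE (λ r → 𝟙-uninformed (S u) _))
           (trans (𝔼-*ˡ roundE (𝟙 (not (S u))) _) (*-congˡ (P-missedBy S u)))) ⟩
    sum (λ u → 𝟙 (not (S u)) * q ^ degreeInto S u) ∎

  -- `Regular` measures a neighbour list along a row of the adjacency matrix, while misses are
  -- counted along a column; the two meet as sums in the field and the equality is then pulled back
  -- to ℕ.
  degree-column : ∀ u → count (λ z → adj z u) ≡ d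
  degree-column u = ℕ.≤-antisym (fromℕ-cancel-≤ (≤-reflexive eq)) (fromℕ-cancel-≤ (≤-reflexive (sym eq)))
    where
    eq : fromℕ (count (λ z → adj z u)) ≈ fromℕ d
    eq = begin
      fromℕ (count (λ z → adj z u))      ≈⟨ fromℕ-count (λ z → adj z u) ⟩
      sum (λ z → 𝟙 (adj z u))            ≈⟨ sum-cong-≋ (λ z → reflexive (≡.cong 𝟙 (symm z u))) ⟩
      sum (λ z → 𝟙 (adj u z))            ≈⟨ degree u ⟩
      fromℕ d ∎

  private
    P-missed : ∀ u → 𝔼 roundE (λ r → 𝟙 (not (any (hits r u)))) ≈ p
    P-missed u = trans (P-missedBy (λ _ → true) u) (reflexive (≡.cong (q ^_) (degree-column u)))

    -- The source of the negative correlation: a sender cannot choose both vertices, so it misses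
    -- both with probability 1 - α - β, which is at most (1 - α)(1 - β).
    missedBoth : ∀ u w z → u ≢ w →
      𝔼 (targetE z) (λ x → 𝟙 (not (does (x Fin.≟ u))) * 𝟙 (not (does (x Fin.≟ w))))
        ≤ (1# - ι * 𝟙 (adj z u)) * (1# - ι * 𝟙 (adj z w))
    missedBoth u w z u≢w = ≤-trans (≤-reflexive (begin
      𝔼 (targetE z) (λ x → 𝟙 (not (does (x Fin.≟ u))) * 𝟙 (not (does (x Fin.≟ w))))
        ≈⟨ 𝔼-cong (targetE z) exclusive ⟩
      𝔼 (targetE z) (λ x → 1# - 1# * (𝟙 (does (x Fin.≟ u)) + 𝟙 (does (x Fin.≟ w))))
        ≈⟨ 𝔼-linear (targetE z) 1# 1# _ ⟩
      1# - 1# * 𝔼 (targetE z) (λ x → 𝟙 (does (x Fin.≟ u)) + 𝟙 (does (x Fin.≟ w)))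
        ≈⟨ +-congˡ (-‿cong (*-congˡ (trans (𝔼-+ (targetE z) _ _) (+-cong (𝔼-target z u) (𝔼-target z w))))) ⟩
      1# - 1# * (ι * 𝟙 (adj z u) + ι * 𝟙 (adj z w)) ∎))
      (≤-by (*-nonneg (*-nonneg 0≤ι (0≤𝟙 (adj z u))) (*-nonneg 0≤ι (0≤𝟙 (adj z w))))
        (solve 2 (λ a b → (:1 :- a) :* (:1 :- b) := (:1 :- :1 :* (a :+ b)) :+ a :* b) refl (ι * 𝟙 (adj z u)) (ι * 𝟙 (adj z w))))
      where
      exclusive : ∀ x → 𝟙 (not (does (x Fin.≟ u))) * 𝟙 (not (does (x Fin.≟ w)))
                    ≈ 1# - 1# * (𝟙 (does (x Fin.≟ u)) + 𝟙 (does (x Fin.≟ w)))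
      exclusive x with x Fin.≟ u | x Fin.≟ w
      ... | yes ≡.refl | yes ≡.refl with () ← u≢w ≡.refl
      ... | yes _ | no  _ = solve 0 (:0 :* :1 := :1 :- :1 :* (:1 :+ :0)) refl
      ... | no  _ | yes _ = solve 0 (:1 :* :0 := :1 :- :1 :* (:0 :+ :1)) refl
      ... | no  _ | no  _ = solve 0 (:1 :* :1 := :1 :- :1 :* (:0 :+ :0)) refl

    column-power : ∀ u → ∏ (λ z → 1# - ι * 𝟙 (adj z u)) ≈ p
    column-power u = trans (∏-power (λ z → adj z u) ι) (reflexive (≡.cong (q ^_) (degree-column u)))

    missed : Fin n → Round → Carrier
    missed u r = 𝟙 (not (any (hits r u)))

    P-missedBoth-≢ : ∀ u w → u ≢ w → 𝔼 roundE (λ r → missed u r * missed w r) ≤ p * p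
    P-missedBoth-≢ u w u≢w = ≤B.begin
      𝔼 roundE (λ r → missed u r * missed w r)
        ≤B.≈⟨ 𝔼-cong roundE (λ r → sym (trans (∏-* (λ z → 𝟙 (not (hits r u z))) (λ z → 𝟙 (not (hits r w z))))
               (*-cong (∏-𝟙-not (hits r u)) (∏-𝟙-not (hits r w))))) ⟩
      𝔼 roundE (λ r → ∏ (λ z → 𝟙 (not (hits r u z)) * 𝟙 (not (hits r w z))))
        ≤B.≈⟨ 𝔼-∏ n targetE (λ z x → 𝟙 (not (does (x Fin.≟ u))) * 𝟙 (not (does (x Fin.≟ w)))) ⟩
      ∏ (λ z → 𝔼 (targetE z) (λ x → 𝟙 (not (does (x Fin.≟ u))) * 𝟙 (not (does (x Fin.≟ w)))))
        ≤B.≤⟨ ∏-mono-≤ (λ z → ≤-trans (≤-reflexive (sym (𝔼-const (targetE z) 0#)))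
                 (𝔼-mono (targetE z) (λ x → *-nonneg (0≤𝟙 _) (0≤𝟙 _))))
               (λ z → missedBoth u w z u≢w) ⟩
      ∏ (λ z → (1# - ι * 𝟙 (adj z u)) * (1# - ι * 𝟙 (adj z w)))
        ≤B.≈⟨ ∏-* (λ z → 1# - ι * 𝟙 (adj z u)) (λ z → 1# - ι * 𝟙 (adj z w)) ⟩
      ∏ (λ z → 1# - ι * 𝟙 (adj z u)) * ∏ (λ z → 1# - ι * 𝟙 (adj z w))
        ≤B.≈⟨ *-cong (column-power u) (column-power w) ⟩
      p * p ≤B.∎
      where module ≤B = ≤-Reasoning

    P-missedBoth-≡ : ∀ u → 𝔼 roundE (λ r → missed u r * missed u r) ≈ p
    P-missedBoth-≡ u = trans (𝔼-cong roundE (λ r → 𝟙*𝟙 (not (any (hits r u))))) (P-missed u)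

    -- The Kronecker delta merges the diagonal, where the probability is p, with the off-diagonal
    -- bound p², so that the double sum of the second moment collapses by `∑-δ`.
    P-missedBoth : ∀ u w → 𝔼 roundE (λ r → missed u r * missed w r) ≤ p * p + 𝟙 (does (w Fin.≟ u)) * (p - p * p)
    P-missedBoth u w = split (w Fin.≟ u)
      where
      split : (w≟u : Dec (w ≡ u)) →
        𝔼 roundE (λ r → missed u r * missed w r) ≤ p * p + 𝟙 (does w≟u) * (p - p * p)
      split (yes ≡.refl) = ≤-reflexive (trans (P-missedBoth-≡ u)
        (solve 1 (λ p → p := p :* p :+ :1 :* (p :- p :* p)) refl p))
      split (no w≢u) = ≤-trans (P-missedBoth-≢ u w (λ u≡w → w≢u (≡.sym u≡w)))
        (≤-reflexive (solve 1 (λ p → p :* p := p :* p :+ :0 :* (p :- p :* p)) refl p))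

  𝔼-avoid : ∀ V → 𝔼 roundE (λ r → size (avoid V r)) ≈ p * size V
  𝔼-avoid V = begin
    𝔼 roundE (λ r → sum (λ u → 𝟙 (avoid V r u)))
      ≈⟨ 𝔼-sum roundE (λ u r → 𝟙 (avoid V r u)) ⟩
    sum (λ u → 𝔼 roundE (λ r → 𝟙 (avoid V r u)))
      ≈⟨ sum-cong-≋ (λ u → trans (𝔼-cong roundE (λ r → 𝟙-∧ (V u) _))
           (trans (𝔼-*ˡ roundE (𝟙 (V u)) (missed u)) (trans (*-congˡ (P-missed u)) (*-comm _ _)))) ⟩
    sum (λ u → p * 𝟙 (V u)) ≈⟨ ∑-*ˡ p (λ u → 𝟙 (V u)) ⟩
    p * size V ∎

  𝔼-avoid² : ∀ V → 𝔼 roundE (λ r → size (avoid V r) * size (avoid V r)) ≤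
                   (p * p) * (size V * size V) + (p - p * p) * size V
  𝔼-avoid² V = ≤B.begin
    𝔼 roundE (λ r → size (avoid V r) * size (avoid V r))
      ≤B.≈⟨ 𝔼-cong roundE (λ r → trans (*-distribʳ-sum (size (avoid V r)) (λ u → 𝟙 (avoid V r u)))
             (sum-cong-≋ (λ u → trans (*-distribˡ-sum (𝟙 (avoid V r u)) (λ w → 𝟙 (avoid V r w)))
               (sum-cong-≋ (λ w → trans (*-cong (𝟙-∧ (V u) _) (𝟙-∧ (V w) _))
                  (solve 4 (λ a b c d → (a :* b) :* (c :* d) := (a :* c) :* (b :* d)) refl (𝟙 (V u)) (missed u r) (𝟙 (V w)) (missed w r))))))) ⟩
    𝔼 roundE (λ r → sum (λ u → sum (λ w → (𝟙 (V u) * 𝟙 (V w)) * (missed u r * missed w r))))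
      ≤B.≈⟨ trans (𝔼-sum roundE (λ u r → sum (λ w → (𝟙 (V u) * 𝟙 (V w)) * (missed u r * missed w r))))
             (sum-cong-≋ (λ u → trans (𝔼-sum roundE (λ w r → (𝟙 (V u) * 𝟙 (V w)) * (missed u r * missed w r)))
               (sum-cong-≋ (λ w → 𝔼-*ˡ roundE (𝟙 (V u) * 𝟙 (V w)) (λ r → missed u r * missed w r))))) ⟩
    sum (λ u → sum (λ w → (𝟙 (V u) * 𝟙 (V w)) * 𝔼 roundE (λ r → missed u r * missed w r)))
      ≤B.≤⟨ sum-mono-≤ (λ u → sum-mono-≤ (λ w → *-monoˡ-≤ (*-nonneg (0≤𝟙 (V u)) (0≤𝟙 (V w))) (P-missedBoth u w))) ⟩
    sum (λ u → sum (λ w → (𝟙 (V u) * 𝟙 (V w)) * (p * p + 𝟙 (does (w Fin.≟ u)) * (p - p * p))))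
      ≤B.≈⟨ sum-cong-≋ inner ⟩
    sum (λ u → ((p * p) * size V) * 𝟙 (V u) + (p - p * p) * 𝟙 (V u))
      ≤B.≈⟨ trans (∑-distrib-+ (λ u → ((p * p) * size V) * 𝟙 (V u)) (λ u → (p - p * p) * 𝟙 (V u)))
             (+-cong (trans (∑-*ˡ ((p * p) * size V) (λ u → 𝟙 (V u))) (*-assoc _ _ _)) (∑-*ˡ (p - p * p) (λ u → 𝟙 (V u)))) ⟩
    (p * p) * (size V * size V) + (p - p * p) * size V ≤B.∎
    where
    module ≤B = ≤-Reasoning
    inner : ∀ u → sum (λ w → (𝟙 (V u) * 𝟙 (V w)) * (p * p + 𝟙 (does (w Fin.≟ u)) * (p - p * p)))
                    ≈ ((p * p) * size V) * 𝟙 (V u) + (p - p * p) * 𝟙 (V u)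
    inner u = begin
      sum (λ w → (𝟙 (V u) * 𝟙 (V w)) * (p * p + 𝟙 (does (w Fin.≟ u)) * (p - p * p)))
        ≈⟨ sum-cong-≋ (λ w → solve 4 (λ a b p e → (a :* b) :* (p :* p :+ e :* (p :- p :* p))
             := ((p :* p) :* a) :* b :+ (((p :- p :* p) :* a) :* b) :* e) refl (𝟙 (V u)) (𝟙 (V w)) p (𝟙 (does (w Fin.≟ u)))) ⟩
      sum (λ w → ((p * p) * 𝟙 (V u)) * 𝟙 (V w) + (((p - p * p) * 𝟙 (V u)) * 𝟙 (V w)) * 𝟙 (does (w Fin.≟ u)))
        ≈⟨ ∑-distrib-+ (λ w → ((p * p) * 𝟙 (V u)) * 𝟙 (V w)) (λ w → (((p - p * p) * 𝟙 (V u)) * 𝟙 (V w)) * 𝟙 (does (w Fin.≟ u))) ⟩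
      sum (λ w → ((p * p) * 𝟙 (V u)) * 𝟙 (V w)) + sum (λ w → (((p - p * p) * 𝟙 (V u)) * 𝟙 (V w)) * 𝟙 (does (w Fin.≟ u)))
        ≈⟨ +-cong (∑-*ˡ ((p * p) * 𝟙 (V u)) (λ w → 𝟙 (V w))) (∑-δ (λ w → ((p - p * p) * 𝟙 (V u)) * 𝟙 (V w)) u) ⟩
      ((p * p) * 𝟙 (V u)) * size V + ((p - p * p) * 𝟙 (V u)) * 𝟙 (V u)
        ≈⟨ +-cong (solve 3 (λ a b c → a :* b :* c := a :* c :* b) refl (p * p) (𝟙 (V u)) (size V))
             (trans (*-assoc _ _ _) (*-congˡ (𝟙*𝟙 (V u)))) ⟩
      ((p * p) * size V) * 𝟙 (V u) + (p - p * p) * 𝟙 (V u) ∎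

-- Iterated rounds and the coupling with never-chosen vertices

run : ∀ {a b} {A : Set a} {B : Set b} (f : A → B → A) → A → ∀ {h} → Vec B h → A
run f S []      = S
run f S (r ∷ v) = run f (f S r) v

full : ∀ {n} → State n → Bool
full S = not (any (complement S))

_⊆_ : ∀ {n} → State n → State n → Set
S ⊆ S′ = ∀ u → T (S u) → T (S′ u)

any-false : ∀ {k} (b : Fin k → Bool) → T (not (any b)) → ∀ i → T (not (b i))
any-false {suc k} b ¬any zero with b zero
... | false = tt
any-false {suc k} b ¬any (suc i) with b zero
... | false = any-false (λ j → b (suc j)) ¬any i

any-true : ∀ {k} (b : Fin k → Bool) i → T (b i) → T (any b)
any-true {suc k} b zero bᵢ with b zero
... | true = tt
any-true {suc k} b (suc i) bᵢ with b zero
... | true  = tt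
... | false = any-true (λ j → b (suc j)) i bᵢ

step-⊇ : ∀ {n} (S : State n) r → S ⊆ step S r
step-⊇ S r u Su with S u
... | true = tt

-- A vertex chosen by nobody is in particular chosen by no informed vertex. Both processes read the
-- same choices, so this is a pathwise coupling.
avoid-⊆-complement-step : ∀ {n} {S V : State n} r → V ⊆ complement S → avoid V r ⊆ complement (step S r)
avoid-⊆-complement-step {n} {S} {V} r V⊆U u u∈ with V u in Vu | S u in Su
... | true | true  = ⊥-elim (≡.subst T (≡.cong not Su) (V⊆U u (≡.subst T (≡.sym Vu) tt)))
... | true | false = restrict S (hits r u) (any-false (hits r u) u∈)
  where
  restrict : ∀ {k} (a b : Fin k → Bool) → (∀ i → T (not (b i))) → T (not (any (λ i → a i ∧ b i)))
  restrict {zero}  a b ¬b = tt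
  restrict {suc k} a b ¬b with a zero | b zero | ¬b zero
  ... | true  | false | _ = restrict (λ i → a (suc i)) (λ i → b (suc i)) (λ i → ¬b (suc i))
  ... | false | _     | _ = restrict (λ i → a (suc i)) (λ i → b (suc i)) (λ i → ¬b (suc i))

run-avoid-⊆ : ∀ {n} {S V : State n} {h} (v : Vec (Vec (Fin n) n) h) → V ⊆ complement S →
              run avoid V v ⊆ complement (run step S v)
run-avoid-⊆ []      V⊆U = V⊆U
run-avoid-⊆ {S = S} (r ∷ v) V⊆U = run-avoid-⊆ v (avoid-⊆-complement-step {S = S} r V⊆U)

-- Expectations over whole histories

module Histories {c ℓ₁ ℓ₂} (ℝ : Reals c ℓ₁ ℓ₂) {n} (G : Graph n) (d : ℕ)
  (regular : Graph.Regular G d) (2≤d : 2 ℕ.≤ d) where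
  open Reals ℝ hiding (zero; _∨_)
  open OrderedFieldProperties completeOrderedField
  open FiniteExpectation completeOrderedField
  open PowerBounds completeOrderedField d 2≤d
  open PushRound ℝ G d regular 2≤d
  open PushModel G using (Round; rounds; histories)

  historyE : ∀ h → Expectation (Vec Round h)
  historyE h = independent h (λ _ → roundE)

  historyE-UniformOn : ∀ h → historyE h UniformOn histories h
  historyE-UniformOn h = independent-UniformOn G h (λ _ → roundE) (Vec.replicate h rounds)
    (λ i → ≡.subst (roundE UniformOn_) (≡.sym (lookup-replicate i rounds)) roundE-UniformOn)

  -- The h-step transition operator of the Markov chain of informed sets; `after-+` is its semigroup
  -- law and lets the phases be composed.
  after : ∀ h → (State n → Carrier) → State n → Carrier
  after h φ S = 𝔼 (historyE h) (λ v → φ (run step S v))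

  after-+ : ∀ a b φ S → after (a ℕ.+ b) φ S ≈ after a (after b φ) S
  after-+ zero    b φ S = refl
  after-+ (suc a) b φ S = 𝔼-cong roundE (λ r → after-+ a b φ (step S r))

  after-mono : ∀ h {φ ψ} S → (∀ S′ → φ S′ ≤ ψ S′) → after h φ S ≤ after h ψ S
  after-mono h S φ≤ψ = 𝔼-mono (historyE h) (λ v → φ≤ψ (run step S v))

  -- Iterating a one-round contraction. The invariant has to survive every possible round, because
  -- the contraction is applied again at each state reached.
  drift : ∀ {i} (I : State n → Set i) φ {ρ} → 0# ≤ ρ →
    (∀ S r → I S → I (step S r)) → (∀ S → I S → 𝔼 roundE (λ r → φ (step S r)) ≤ ρ * φ S) →
    ∀ h S → I S → after h φ S ≤ ρ ^ h * φ S
  drift I φ {ρ} 0≤ρ I-step φ-step zero    S IS = ≤-reflexive (sym (*-identityˡ _))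
  drift I φ {ρ} 0≤ρ I-step φ-step (suc h) S IS = begin
    𝔼 roundE (λ r → after h φ (step S r))
      ≤⟨ 𝔼-mono roundE (λ r → drift I φ 0≤ρ I-step φ-step h (step S r) (I-step S r IS)) ⟩
    𝔼 roundE (λ r → ρ ^ h * φ (step S r)) ≈⟨ 𝔼-*ˡ roundE (ρ ^ h) _ ⟩
    ρ ^ h * 𝔼 roundE (λ r → φ (step S r)) ≤⟨ *-monoˡ-≤ (^-nonneg h 0≤ρ) (φ-step S IS) ⟩
    ρ ^ h * (ρ * φ S)                     ≈⟨ x∙yz≈yx∙z (ρ ^ h) ρ (φ S) ⟩
    ρ ^ suc h * φ S ∎
    where open ≤-Reasoning

  size-mono : ∀ {S S′} → S ⊆ S′ → size S ≤ size S′
  size-mono {S} {S′} S⊆S′ = sum-mono-≤ (λ u → 𝟙-mono (S u) (S′ u) (S⊆S′ u))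

  size-step≥ : ∀ S r → size S ≤ size (step S r)
  size-step≥ S r = size-mono (step-⊇ S r)

  size-run≥ : ∀ S {h} (v : Vec Round h) → size S ≤ size (run step S v)
  size-run≥ S []      = ≤-refl
  size-run≥ S (r ∷ v) = ≤-trans (size-step≥ S r) (size-run≥ (step S r) v)

  size-complement-step≤ : ∀ S r → size (complement (step S r)) ≤ size (complement S)
  size-complement-step≤ S r = begin
    size (complement (step S r)) ≈⟨ size-complement (step S r) ⟩
    fromℕ n - size (step S r)    ≤⟨ +-monoʳ-≤ (neg-anti-≤ (size-step≥ S r)) ⟩
    fromℕ n - size S             ≈⟨ sym (size-complement S) ⟩
    size (complement S) ∎
    where open ≤-Reasoning

  size-count : ∀ S → size S ≈ fromℕ (count S)
  size-count S = sym (fromℕ-count S)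

  size≤n : ∀ S → size S ≤ fromℕ n
  size≤n S = ≤-trans (sum-mono-≤ (λ u → 𝟙≤1 (S u))) (≤-reflexive (trans (∑-const n 1#) (*-identityʳ _)))

  𝟙-any≤ : ∀ {k} (b : Fin k → Bool) → 𝟙 (any b) ≤ sum (λ i → 𝟙 (b i))
  𝟙-any≤ {zero}  b = ≤-refl
  𝟙-any≤ {suc k} b with b zero
  ... | true  = ≤-by (sum-nonneg (λ i → 0≤𝟙 (b (suc i)))) refl
  ... | false = ≤-trans (𝟙-any≤ (λ i → b (suc i))) (≤-reflexive (sym (+-identityˡ _)))

  private
    ∑-δ′ : ∀ {k} (x : Fin k) → sum (λ u → 𝟙 (does (x Fin.≟ u))) ≈ 1#
    ∑-δ′ {suc k} zero    = trans (+-congˡ (sum-replicate-zero k)) (+-identityʳ 1#)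
    ∑-δ′ {suc k} (suc x) = trans (+-identityˡ _) (∑-δ′ x)

    𝟙-∨≤ : ∀ a b → 𝟙 (a ∨ b) ≤ 𝟙 a + 𝟙 b
    𝟙-∨≤ true  b = ≤-by (0≤𝟙 b) refl
    𝟙-∨≤ false b = ≤-reflexive (sym (+-identityˡ _))

  -- Exchanging the two sums charges each newly informed vertex to an informed sender, and a sender
  -- has exactly one target.
  size-step≤ : ∀ S r → size (step S r) ≤ fromℕ 2 * size S
  size-step≤ S r = begin
    sum (λ u → 𝟙 (step S r u))
      ≤⟨ sum-mono-≤ (λ u → ≤-trans (𝟙-∨≤ (S u) (hit u)) (+-mono-≤ ≤-refl
           (≤-trans (𝟙-any≤ (λ z → S z ∧ hits r u z))
             (≤-reflexive (sum-cong-≋ (λ z → 𝟙-∧ (S z) (hits r u z))))))) ⟩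
    sum (λ u → 𝟙 (S u) + sum (λ z → 𝟙 (S z) * 𝟙 (hits r u z)))
      ≈⟨ ∑-distrib-+ (λ u → 𝟙 (S u)) (λ u → sum (λ z → 𝟙 (S z) * 𝟙 (hits r u z))) ⟩
    size S + sum (λ u → sum (λ z → 𝟙 (S z) * 𝟙 (hits r u z)))
      ≈⟨ +-congˡ (trans (∑-comm (λ u z → 𝟙 (S z) * 𝟙 (hits r u z)))
           (sum-cong-≋ (λ z → trans (∑-*ˡ (𝟙 (S z)) (λ u → 𝟙 (hits r u z)))
             (trans (*-congˡ {𝟙 (S z)} (∑-δ′ (Vec.lookup r z))) (*-identityʳ _))))) ⟩
    size S + size S
      ≈⟨ solve 1 (λ s → s :+ s := :2 :* s) refl (size S) ⟩
    fromℕ 2 * size S ∎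
    where
    open ≤-Reasoning
    hit : Fin n → Bool
    hit u = any (λ z → S z ∧ hits r u z)

  size-run≤ : ∀ S {h} (v : Vec Round h) → size (run step S v) ≤ fromℕ 2 ^ h * size S
  size-run≤ S []              = ≤-reflexive (sym (*-identityˡ _))
  size-run≤ S {suc h} (r ∷ v) = begin
    size (run step (step S r) v)   ≤⟨ size-run≤ (step S r) v ⟩
    fromℕ 2 ^ h * size (step S r)  ≤⟨ *-monoˡ-≤ (^-nonneg h (0≤fromℕ 2)) (size-step≤ S r) ⟩
    fromℕ 2 ^ h * (fromℕ 2 * size S) ≈⟨ x∙yz≈yx∙z (fromℕ 2 ^ h) (fromℕ 2) (size S) ⟩
    fromℕ 2 ^ suc h * size S ∎
    where open ≤-Reasoning

  -- Pointwise form of Markov's inequality for the integer-valued number of uninformed vertices.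
  𝟙-not-full≤ : ∀ S → 𝟙 (not (full S)) ≤ size (complement S)
  𝟙-not-full≤ S = ≤-trans (≤-reflexive (reflexive (≡.cong 𝟙 (not-involutive _)))) (𝟙-any≤ (complement S))
    where
    not-involutive : ∀ b → not (not b) ≡ b
    not-involutive true  = ≡.refl
    not-involutive false = ≡.refl

  𝔼-run-avoid : ∀ h V → 𝔼 (historyE h) (λ v → size (run avoid V v)) ≈ p ^ h * size V
  𝔼-run-avoid zero    V = sym (*-identityˡ _)
  𝔼-run-avoid (suc h) V = begin
    𝔼 roundE (λ r → 𝔼 (historyE h) (λ v → size (run avoid (avoid V r) v)))
      ≈⟨ 𝔼-cong roundE (λ r → 𝔼-run-avoid h (avoid V r)) ⟩
    𝔼 roundE (λ r → p ^ h * size (avoid V r)) ≈⟨ 𝔼-*ˡ roundE (p ^ h) (λ r → size (avoid V r)) ⟩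
    p ^ h * 𝔼 roundE (λ r → size (avoid V r)) ≈⟨ *-congˡ (𝔼-avoid V) ⟩
    p ^ h * (p * size V) ≈⟨ x∙yz≈yx∙z (p ^ h) p (size V) ⟩
    p ^ suc h * size V ∎
    where open SetoidReasoning setoid

  -- The shape P² s² + (P - P²) s is closed under a further round: inserting the one-round bound
  -- replaces P by p P exactly, the terms P² p s cancelling.
  𝔼-run-avoid² : ∀ h V → 𝔼 (historyE h) (λ v → size (run avoid V v) * size (run avoid V v)) ≤
    (p ^ h * p ^ h) * (size V * size V) + (p ^ h - p ^ h * p ^ h) * size V
  𝔼-run-avoid² zero    V = ≤-reflexive (solve 1 (λ s → s :* s := (:1 :* :1) :* (s :* s) :+ (:1 :- :1 :* :1) :* s) refl (size V))
  𝔼-run-avoid² (suc h) V = begin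
    𝔼 roundE (λ r → 𝔼 (historyE h) (λ v → size (run avoid (avoid V r) v) * size (run avoid (avoid V r) v)))
      ≤⟨ 𝔼-mono roundE (λ r → 𝔼-run-avoid² h (avoid V r)) ⟩
    𝔼 roundE (λ r → (P * P) * (size (avoid V r) * size (avoid V r)) + (P - P * P) * size (avoid V r))
      ≈⟨ trans (𝔼-+ roundE (λ r → (P * P) * (size (avoid V r) * size (avoid V r))) (λ r → (P - P * P) * size (avoid V r)))
           (+-cong (𝔼-*ˡ roundE (P * P) (λ r → size (avoid V r) * size (avoid V r)))
             (𝔼-*ˡ roundE (P - P * P) (λ r → size (avoid V r)))) ⟩
    (P * P) * 𝔼 roundE (λ r → size (avoid V r) * size (avoid V r)) + (P - P * P) * 𝔼 roundE (λ r → size (avoid V r))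
      ≤⟨ +-mono-≤ (*-monoˡ-≤ (0≤x*x P) (𝔼-avoid² V)) (≤-reflexive (*-congˡ (𝔼-avoid V))) ⟩
    (P * P) * ((p * p) * (s * s) + (p - p * p) * s) + (P - P * P) * (p * s)
      ≈⟨ solve 3 (λ P p s → (P :* P) :* ((p :* p) :* (s :* s) :+ (p :- p :* p) :* s) :+ (P :- P :* P) :* (p :* s)
           := ((p :* P) :* (p :* P)) :* (s :* s) :+ (p :* P :- (p :* P) :* (p :* P)) :* s) refl P p s ⟩
    (p * P * (p * P)) * (s * s) + (p * P - p * P * (p * P)) * s ∎
    where
    open ≤-Reasoning
    P = p ^ h
    s = size V

  -- Chebyshev's inequality for the number of never-chosen vertices, whose
  -- variance is at most its mean because the avoidance events are negatively
  -- correlated.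
  P-full≤ : ∀ h S {M} → M ≈ p ^ h * size (complement S) → 0# < M → M * after h (λ S′ → 𝟙 (full S′)) S ≤ 1#
  P-full≤ h S {M} M≈ 0<M = *-cancelˡ-≤ 0<M (begin
    M * (M * after h (λ S′ → 𝟙 (full S′)) S)
      ≈⟨ trans (sym (*-assoc _ _ _)) (sym (𝔼-*ˡ (historyE h) (M * M) _)) ⟩
    𝔼 (historyE h) (λ v → (M * M) * 𝟙 (full (run step S v)))
      ≤⟨ 𝔼-mono (historyE h) (λ v → deviation (full (run step S v)) (X v) (empty v)) ⟩
    𝔼 (historyE h) (λ v → X v * X v + (M * M - (fromℕ 2 * M) * X v))
      ≈⟨ trans (𝔼-+ (historyE h) (λ v → X v * X v) (λ v → M * M - (fromℕ 2 * M) * X v))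
           (+-congˡ (𝔼-linear (historyE h) (M * M) (fromℕ 2 * M) X)) ⟩
    𝔼 (historyE h) (λ v → X v * X v) + (M * M - (fromℕ 2 * M) * 𝔼 (historyE h) X)
      ≤⟨ +-mono-≤ (𝔼-run-avoid² h V) (≤-reflexive (+-congˡ (-‿cong (*-congˡ (𝔼-run-avoid h V))))) ⟩
    ((P * P) * (s * s) + (P - P * P) * s) + (M * M - (fromℕ 2 * M) * (P * s))
      ≈⟨ +-congˡ (+-cong (*-cong M≈ M≈) (-‿cong (*-congʳ (*-congˡ M≈)))) ⟩
    ((P * P) * (s * s) + (P - P * P) * s) + ((P * s) * (P * s) - (fromℕ 2 * (P * s)) * (P * s))
      ≤⟨ ≤-by (*-nonneg (0≤x*x P) (size≥0 V))
           (solve 2 (λ P s → P :* s := (((P :* P) :* (s :* s) :+ (P :- P :* P) :* s) :+ ((P :* s) :* (P :* s) :- (:2 :* (P :* s)) :* (P :* s))) :+ (P :* P) :* s) refl P s) ⟩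
    P * s  ≈⟨ trans (sym M≈) (sym (*-identityʳ M)) ⟩
    M * 1# ∎)
    where
    open ≤-Reasoning
    V = complement S
    P = p ^ h
    s = size V
    X : Vec Round h → Carrier
    X v = size (run avoid V v)
    empty : ∀ v → T (full (run step S v)) → X v ≈ 0#
    empty v isFull = ≤-antisym (≤-trans (size-mono (run-avoid-⊆ {S = S} v (λ u u∈ → u∈)))
      (≤-reflexive (trans (sum-cong-≋ (λ u → no-one u)) (sum-replicate-zero n)))) (size≥0 _)
      where
      no-one : ∀ u → 𝟙 (complement (run step S v) u) ≈ 0#
      no-one u with complement (run step S v) u | any-false (complement (run step S v)) isFull u
      ... | false | _ = refl
    -- The right-hand side is (x - M)² expanded so that the moments can be taken separately; it
    -- equals M² at x = 0, which is forced on the event.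
    deviation : ∀ b x → (T b → x ≈ 0#) → (M * M) * 𝟙 b ≤ x * x + (M * M - (fromℕ 2 * M) * x)
    deviation true  x x≈0 = ≤-reflexive (trans
      (solve 1 (λ m → (m :* m) :* :1 := :0 :* :0 :+ (m :* m :- (:2 :* m) :* :0)) refl M)
      (+-cong (*-cong (sym (x≈0 tt)) (sym (x≈0 tt))) (+-congˡ (-‿cong (*-congˡ (sym (x≈0 tt)))))))
    deviation false x _   = ≤-by (0≤x*x (x - M))
      (solve 2 (λ x m → x :* x :+ (m :* m :- (:2 :* m) :* x) := (m :* m) :* :0 :+ (x :- m) :* (x :- m)) refl x M)

-- Drift of the informed and uninformed sets

module PushDrift {c ℓ₁ ℓ₂} (ℝ : Reals c ℓ₁ ℓ₂) {m} (G : Graph (suc m)) (d : ℕ) (lam : Reals.Carrier ℝ)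
  (ndλ : IsNdλGraph ℝ G d lam) (lam<d : Reals._<_ ℝ lam (Reals.fromℕ ℝ d))
  (2≤d : 2 ℕ.≤ d)
  (θ : Reals.Carrier ℝ) (0≤θ : Reals._≤_ ℝ (Reals.0# ℝ) θ) (θ≤1 : Reals._≤_ ℝ θ (Reals.1# ℝ))
  (lam≤θd : Reals._≤_ ℝ lam (Reals._*_ ℝ θ (Reals.fromℕ ℝ d))) where
  open Reals ℝ hiding (zero; _∨_)
  open OrderedFieldProperties completeOrderedField
  open FiniteExpectation completeOrderedField
  open PowerBounds completeOrderedField d 2≤d
  open Graph G
  open SpectralBounds ℝ G d lam ndλ lam<d
  open PushRound ℝ G d (IsNdλGraph.regular ndλ) 2≤d
  open Histories ℝ G d (IsNdλGraph.regular ndλ) 2≤d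

  private
    n = suc m
    N = fromℕ n
    D = fromℕ d

    indicator : State n → Fin n → Carrier
    indicator S u = 𝟙 (S u)

    ⟪S,S⟫ : ∀ S → ⟪ indicator S , indicator S ⟫ ≈ size S
    ⟪S,S⟫ S = sum-cong-≋ (λ u → 𝟙*𝟙 (S u))

    -- One factor θ ≤ 1 is given away so that the edge count and the squared degrees carry the same
    -- error κ + θ.
    lam*lam≤ : lam * lam ≤ θ * (D * D)
    lam*lam≤ = begin
      lam * lam             ≤⟨ *-mono-≤ 0≤lam lam≤θd 0≤lam lam≤θd ⟩
      (θ * D) * (θ * D)     ≈⟨ solve 2 (λ t d → (t :* d) :* (t :* d) := t :* (t :* (d :* d))) refl θ D ⟩
      θ * (θ * (D * D))     ≤⟨ *-monoˡ-≤ 0≤θ (*-monoʳ-≤ (0≤x*x D) θ≤1) ⟩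
      θ * (1# * (D * D))    ≈⟨ *-congˡ (*-identityˡ _) ⟩
      θ * (D * D) ∎
      where open ≤-Reasoning

    edgesInside≤ : ∀ S {κ} → size S ≤ κ * N → ⟪ indicator S , A· indicator S ⟫ ≤ (κ + θ) * (D * size S)
    edgesInside≤ S {κ} s≤κN = *-cancelˡ-≤ (0<fromℕ m) (begin
      N * ⟪ indicator S , A· indicator S ⟫        ≤⟨ quadraticForm≤ (indicator S) ⟩
      D * (s * s) + lam * (N * ⟪ indicator S , indicator S ⟫)
        ≤⟨ +-mono-≤ (*-monoˡ-≤ (0≤fromℕ d) (*-monoʳ-≤ (size≥0 S) s≤κN))
             (≤-trans (≤-reflexive (*-congˡ (*-congˡ (⟪S,S⟫ S)))) (*-monoʳ-≤ (*-nonneg (0≤fromℕ n) (size≥0 S)) lam≤θd)) ⟩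
      D * ((κ * N) * s) + (θ * D) * (N * s)
        ≈⟨ solve 5 (λ n d s k t → d :* ((k :* n) :* s) :+ (t :* d) :* (n :* s) := n :* ((k :+ t) :* (d :* s))) refl N D s κ θ ⟩
      N * ((κ + θ) * (D * s)) ∎)
      where
      open ≤-Reasoning
      s = size S

    squaredDegrees≤ : ∀ S {κ} → size S ≤ κ * N →
      ⟪ A· indicator S , A· indicator S ⟫ ≤ (κ + θ) * ((D * D) * size S)
    squaredDegrees≤ S {κ} s≤κN = *-cancelˡ-≤ (0<fromℕ m) (begin
      N * ⟪ A· indicator S , A· indicator S ⟫        ≤⟨ normSquared≤ (indicator S) ⟩
      (D * D) * (s * s) + (lam * lam) * (N * ⟪ indicator S , indicator S ⟫)
        ≤⟨ +-mono-≤ (*-monoˡ-≤ (0≤x*x D) (*-monoʳ-≤ (size≥0 S) s≤κN))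
             (≤-trans (≤-reflexive (*-congˡ (*-congˡ (⟪S,S⟫ S)))) (*-monoʳ-≤ (*-nonneg (0≤fromℕ n) (size≥0 S)) lam*lam≤)) ⟩
      (D * D) * ((κ * N) * s) + (θ * (D * D)) * (N * s)
        ≈⟨ solve 5 (λ n d s k t → d :* ((k :* n) :* s) :+ (t :* d) :* (n :* s) := n :* ((k :+ t) :* (d :* s))) refl N (D * D) s κ θ ⟩
      N * ((κ + θ) * ((D * D) * s)) ∎)
      where
      open ≤-Reasoning
      s = size S

    fromℕ-degreeInto : ∀ S u → fromℕ (degreeInto S u) ≈ (A· indicator S) u
    fromℕ-degreeInto S u = trans (fromℕ-count (λ z → S z ∧ adj z u))
      (sum-cong-≋ (λ z → trans (𝟙-∧ (S z) (adj z u))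
        (trans (*-comm _ _) (*-congʳ (reflexive (≡.cong 𝟙 (symm z u)))))))

    degreeInto≤d : ∀ S u → degreeInto S u ℕ.≤ d
    degreeInto≤d S u = ≡.subst (degreeInto S u ℕ.≤_) (degree-column u) (fromℕ-cancel-≤ (begin
      fromℕ (degreeInto S u)          ≈⟨ fromℕ-count (λ z → S z ∧ adj z u) ⟩
      sum (λ z → 𝟙 (S z ∧ adj z u))   ≤⟨ sum-mono-≤ (λ z → ≤-trans (≤-reflexive (𝟙-∧ (S z) (adj z u)))
                                           (≤-trans (*-monoʳ-≤ (0≤𝟙 (adj z u)) (𝟙≤1 (S z))) (≤-reflexive (*-identityˡ _)))) ⟩
      sum (λ z → 𝟙 (adj z u))         ≈⟨ sym (fromℕ-count (λ z → adj z u)) ⟩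
      fromℕ (count (λ z → adj z u)) ∎))
      where open ≤-Reasoning

    A-complement : ∀ S u → (A· indicator S) u ≈ D - (A· indicator (complement S)) u
    A-complement S u = begin
      sum (λ w → 𝟙 (adj u w) * 𝟙 (S w))
        ≈⟨ sum-cong-≋ (λ w → trans (solve 2 (λ a s → a :* s := a :- a :* (:1 :- s)) refl (𝟙 (adj u w)) (𝟙 (S w)))
             (+-congˡ (-‿cong (*-congˡ {𝟙 (adj u w)} (sym (𝟙-not (S w))))))) ⟩
      sum (λ w → 𝟙 (adj u w) - 𝟙 (adj u w) * 𝟙 (not (S w)))
        ≈⟨ ∑-distrib-- (λ w → 𝟙 (adj u w)) (λ w → 𝟙 (adj u w) * 𝟙 (not (S w))) ⟩
      sum (λ w → 𝟙 (adj u w)) - (A· indicator (complement S)) u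
        ≈⟨ +-congʳ (degree u) ⟩
      D - (A· indicator (complement S)) u ∎
      where open SetoidReasoning setoid

    edgesBetween-U : ∀ S → let y = indicator (complement S) in
      ⟪ y , A· indicator S ⟫ ≈ D * size (complement S) - ⟪ y , A· y ⟫
    edgesBetween-U S = begin
      sum (λ u → y u * (A· indicator S) u)
        ≈⟨ sum-cong-≋ (λ u → trans (*-congˡ {y u} (A-complement S u))
             (solve 3 (λ y d a → y :* (d :- a) := d :* y :- y :* a) refl (y u) D ((A· y) u))) ⟩
      sum (λ u → D * y u - y u * (A· y) u)
        ≈⟨ ∑-distrib-- (λ u → D * y u) (λ u → y u * (A· y) u) ⟩
      sum (λ u → D * y u) - ⟪ y , A· y ⟫ ≈⟨ +-congʳ (∑-*ˡ D y) ⟩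
      D * size (complement S) - ⟪ y , A· y ⟫ ∎
      where
      open SetoidReasoning setoid
      y = indicator (complement S)

    sum-A : ∀ x → sum (A· x) ≈ D * sum x
    sum-A x = begin
      sum (λ u → sum (λ w → 𝟙 (adj u w) * x w)) ≈⟨ ∑-comm (λ u w → 𝟙 (adj u w) * x w) ⟩
      sum (λ w → sum (λ u → 𝟙 (adj u w) * x w))
        ≈⟨ sum-cong-≋ (λ w → trans (∑-*ʳ (x w) (λ u → 𝟙 (adj u w)))
             (*-congʳ {x w} (trans (sum-cong-≋ (λ u → reflexive (≡.cong 𝟙 (symm u w)))) (degree w)))) ⟩
      sum (λ w → D * x w) ≈⟨ ∑-*ˡ D x ⟩
      D * sum x ∎
      where open SetoidReasoning setoid

    edgesBetween-S : ∀ S → let x = indicator S in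
      ⟪ indicator (complement S) , A· x ⟫ ≈ D * size S - ⟪ x , A· x ⟫
    edgesBetween-S S = begin
      sum (λ u → 𝟙 (not (S u)) * (A· x) u)
        ≈⟨ sum-cong-≋ (λ u → trans (*-congʳ {(A· x) u} (𝟙-not (S u)))
             (solve 2 (λ x a → (:1 :- x) :* a := a :- x :* a) refl (x u) ((A· x) u))) ⟩
      sum (λ u → (A· x) u - x u * (A· x) u) ≈⟨ ∑-distrib-- (A· x) (λ u → x u * (A· x) u) ⟩
      sum (A· x) - ⟪ x , A· x ⟫             ≈⟨ +-congʳ (sum-A x) ⟩
      D * size S - ⟪ x , A· x ⟫ ∎
      where
      open SetoidReasoning setoid
      x = indicator S

  -- The chord makes the expectation linear in the number of edges from U to S. This number is d|U|
  -- - e(U,U), so the spectral upper bound on e(U,U) is what enters.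
  𝔼-uninformed≤ : ∀ S {κ} → size (complement S) ≤ κ * N →
    𝔼 roundE (λ r → size (complement (step S r))) ≤ (p + (1# - p) * (κ + θ)) * size (complement S)
  𝔼-uninformed≤ S {κ} U≤κN = begin
    𝔼 roundE (λ r → size (complement (step S r)))  ≈⟨ 𝔼-uninformed S ⟩
    sum (λ u → y u * q ^ degreeInto S u)
      ≤⟨ sum-mono-≤ (λ u → *-monoˡ-≤ (0≤𝟙 (not (S u))) (≤-trans (q^k≤chord (degreeInto≤d S u))
           (≤-reflexive (+-congˡ (-‿cong (*-congˡ {ι * (1# - p)} (fromℕ-degreeInto S u))))))) ⟩
    sum (λ u → y u * (1# - b * (A· x) u))
      ≈⟨ sum-cong-≋ (λ u → solve 3 (λ y b a → y :* (:1 :- b :* a) := y :- b :* (y :* a)) refl (y u) b ((A· x) u)) ⟩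
    sum (λ u → y u - b * (y u * (A· x) u))
      ≈⟨ trans (∑-distrib-- y (λ u → b * (y u * (A· x) u))) (+-congˡ (-‿cong (∑-*ˡ b (λ u → y u * (A· x) u)))) ⟩
    |U| - b * ⟪ y , A· x ⟫
      ≈⟨ +-congˡ (-‿cong (*-congˡ (edgesBetween-U S))) ⟩
    |U| - b * (D * |U| - ⟪ y , A· y ⟫)
      ≤⟨ ≤-by (*-nonneg (*-nonneg 0≤ι (x≤y⇒0≤y-x (q^k≤1 d))) (x≤y⇒0≤y-x (edgesInside≤ (complement S) U≤κN)))
           (solve 5 (λ u b d e f → u :- b :* (d :* u :- f) := (u :- b :* (d :* u :- e)) :+ b :* (f :- e)) refl |U| b D ⟪ y , A· y ⟫ ((κ + θ) * (D * |U|))) ⟩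
    |U| - b * (D * |U| - (κ + θ) * (D * |U|))
      ≈⟨ solve 5 (λ u i p d k → u :- (i :* (:1 :- p)) :* (d :* u :- k :* (d :* u)) := u :- (i :* d) :* ((:1 :- p) :* (u :- k :* u))) refl |U| ι p D (κ + θ) ⟩
    |U| - (ι * D) * ((1# - p) * (|U| - (κ + θ) * |U|))
      ≈⟨ +-congˡ (-‿cong (*-congʳ ι*d≈1)) ⟩
    |U| - 1# * ((1# - p) * (|U| - (κ + θ) * |U|))
      ≈⟨ solve 3 (λ u p k → u :- :1 :* ((:1 :- p) :* (u :- k :* u)) := (p :+ (:1 :- p) :* k) :* u) refl |U| p (κ + θ) ⟩
    (p + (1# - p) * (κ + θ)) * |U| ∎
    where
    open ≤-Reasoning
    x = indicator S
    y = indicator (complement S)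
    |U| = size (complement S)
    b = ι * (1# - p)

  private
    -- The quadratic bound leaves e(U,S) = d|S| - e(S,S) and the squared degrees, whose sum is
    -- enlarged from U to all vertices to become the norm of A x. Of the error 3(κ + θ), two parts
    -- come from e(S,S) and one from the squares.
    twice-𝔼-uninformed≤ : ∀ S {κ} → size S ≤ κ * N →
      fromℕ 2 * 𝔼 roundE (λ r → size (complement (step S r)))
        ≤ fromℕ 2 * size (complement S) - fromℕ 2 * size S + fromℕ 3 * (κ + θ) * size S
    twice-𝔼-uninformed≤ S {κ} S≤κN = begin
      fromℕ 2 * 𝔼 roundE (λ r → size (complement (step S r)))  ≈⟨ *-congˡ (𝔼-uninformed S) ⟩
      fromℕ 2 * sum (λ u → y u * q ^ degreeInto S u)
        ≈⟨ trans (sym (∑-*ˡ (fromℕ 2) (λ u → y u * q ^ degreeInto S u)))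
             (sum-cong-≋ (λ u → solve 2 (λ y p → :2 :* (y :* p) := y :* (:2 :* p)) refl (y u) (q ^ degreeInto S u))) ⟩
      sum (λ u → y u * (fromℕ 2 * q ^ degreeInto S u))
        ≤⟨ sum-mono-≤ (λ u → *-monoˡ-≤ (0≤𝟙 (not (S u))) (≤-trans (2q^k≤bonferroni (degreeInto S u)) (≤-reflexive (degrees u)))) ⟩
      sum (λ u → y u * (fromℕ 2 - (fromℕ 2 * ι) * a u + (ι * ι) * (a u * a u)))
        ≤⟨ sum-mono-≤ (λ u → ≤-by (*-nonneg (x≤y⇒0≤y-x (𝟙≤1 (not (S u)))) (*-nonneg (0≤x*x ι) (0≤x*x (a u))))
             (solve 3 (λ y i a → (:2 :* y :- (:2 :* i) :* (y :* a)) :+ (i :* i) :* (a :* a)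
               := y :* (:2 :- (:2 :* i) :* a :+ (i :* i) :* (a :* a)) :+ (:1 :- y) :* ((i :* i) :* (a :* a))) refl (y u) ι (a u))) ⟩
      sum (λ u → (fromℕ 2 * y u - (fromℕ 2 * ι) * (y u * a u)) + (ι * ι) * (a u * a u))
        ≈⟨ trans (∑-distrib-+ (λ u → fromℕ 2 * y u - (fromℕ 2 * ι) * (y u * a u)) (λ u → (ι * ι) * (a u * a u)))
             (+-cong (trans (∑-distrib-- (λ u → fromℕ 2 * y u) (λ u → (fromℕ 2 * ι) * (y u * a u)))
                (+-cong (∑-*ˡ (fromℕ 2) y) (-‿cong (∑-*ˡ (fromℕ 2 * ι) (λ u → y u * a u)))))
                (∑-*ˡ (ι * ι) (λ u → a u * a u))) ⟩
      (fromℕ 2 * |U| - (fromℕ 2 * ι) * ⟪ y , a ⟫) + (ι * ι) * ⟪ a , a ⟫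
        ≈⟨ +-congʳ (+-congˡ (-‿cong (*-congˡ (edgesBetween-S S)))) ⟩
      (fromℕ 2 * |U| - (fromℕ 2 * ι) * (D * s - ⟪ x , a ⟫)) + (ι * ι) * ⟪ a , a ⟫
        ≤⟨ ≤-by (+-nonneg (*-nonneg (*-nonneg (0≤fromℕ 2) 0≤ι) (x≤y⇒0≤y-x (edgesInside≤ S S≤κN)))
                 (*-nonneg (0≤x*x ι) (x≤y⇒0≤y-x (squaredDegrees≤ S S≤κN))))
             (solve 7 (λ u i D s e f g → ((:2 :* u :- (:2 :* i) :* (D :* s :- f :* (D :* s))) :+ (i :* i) :* (f :* ((D :* D) :* s)))
               := ((:2 :* u :- (:2 :* i) :* (D :* s :- e)) :+ (i :* i) :* g)
                  :+ ((:2 :* i) :* (f :* (D :* s) :- e) :+ (i :* i) :* (f :* ((D :* D) :* s) :- g)))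
               refl |U| ι D s ⟪ x , a ⟫ (κ + θ) ⟪ a , a ⟫) ⟩
      (fromℕ 2 * |U| - (fromℕ 2 * ι) * (D * s - (κ + θ) * (D * s))) + (ι * ι) * ((κ + θ) * ((D * D) * s))
        ≈⟨ solve 5 (λ u i D s t → (:2 :* u :- (:2 :* i) :* (D :* s :- t :* (D :* s))) :+ (i :* i) :* (t :* ((D :* D) :* s))
             := (:2 :* u :- :2 :* ((i :* D) :* (s :- t :* s))) :+ (i :* D) :* ((i :* D) :* (t :* s))) refl |U| ι D s (κ + θ) ⟩
      (fromℕ 2 * |U| - fromℕ 2 * ((ι * D) * (s - (κ + θ) * s))) + (ι * D) * ((ι * D) * ((κ + θ) * s))
        ≈⟨ +-cong (+-congˡ (-‿cong (*-congˡ (*-congʳ ι*d≈1)))) (*-cong ι*d≈1 (*-congʳ ι*d≈1)) ⟩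
      (fromℕ 2 * |U| - fromℕ 2 * (1# * (s - (κ + θ) * s))) + 1# * (1# * ((κ + θ) * s))
        ≈⟨ solve 3 (λ u s t → (:2 :* u :- :2 :* (:1 :* (s :- t :* s))) :+ :1 :* (:1 :* (t :* s))
             := :2 :* u :- :2 :* s :+ :3 :* t :* s) refl |U| s (κ + θ) ⟩
      fromℕ 2 * |U| - fromℕ 2 * s + fromℕ 3 * (κ + θ) * s ∎
      where
      open ≤-Reasoning
      x = indicator S
      y = indicator (complement S)
      a = A· x
      |U| = size (complement S)
      s = size S
      degrees : ∀ u → fromℕ 2 - (fromℕ 2 * ι) * fromℕ (degreeInto S u) + (ι * ι) * (fromℕ (degreeInto S u) * fromℕ (degreeInto S u))
                    ≈ fromℕ 2 - (fromℕ 2 * ι) * a u + (ι * ι) * (a u * a u)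
      degrees u = +-cong (+-congˡ (-‿cong (*-congˡ {fromℕ 2 * ι} (fromℕ-degreeInto S u))))
        (*-congˡ {ι * ι} (*-cong (fromℕ-degreeInto S u) (fromℕ-degreeInto S u)))

  twice-𝔼-informed≥ : ∀ S {κ} → size S ≤ κ * N →
    (fromℕ 4 - fromℕ 3 * (κ + θ)) * size S ≤ fromℕ 2 * 𝔼 roundE (λ r → size (step S r))
  twice-𝔼-informed≥ S {κ} S≤κN = begin
    (fromℕ 4 - fromℕ 3 * (κ + θ)) * s
      ≤⟨ ≤-by (x≤y⇒0≤y-x (≤-trans (twice-𝔼-uninformed≤ S S≤κN) (≤-reflexive (+-congʳ (+-congʳ (*-congˡ (size-complement S)))))))
           (solve 4 (λ n s t e → :2 :* (n :- :1 :* e)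
              := (con (+ 4) :- :3 :* t) :* s :+ ((:2 :* (n :- s) :- :2 :* s :+ :3 :* t :* s) :- :2 :* e)) refl N s (κ + θ) u′) ⟩
    fromℕ 2 * (N - 1# * u′)
      ≈⟨ *-congˡ (sym (𝔼-linear roundE N 1# (λ r → size (complement (step S r))))) ⟩
    fromℕ 2 * 𝔼 roundE (λ r → N - 1# * size (complement (step S r)))
      ≈⟨ *-congˡ (𝔼-cong roundE (λ r → trans (+-congˡ (-‿cong (trans (*-identityˡ _) (size-complement (step S r)))))
           (solve 2 (λ n s → n :- (n :- s) := s) refl N (size (step S r))))) ⟩
    fromℕ 2 * 𝔼 roundE (λ r → size (step S r)) ∎
    where
    open ≤-Reasoning
    s = size S
    u′ = 𝔼 roundE (λ r → size (complement (step S r)))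

  open ≤-Reasoning

  -- Made total by the value 0 at 0. The empty state stays empty, so with this value the growth
  -- estimate holds there as well.
  inv : ℕ → Carrier
  inv zero    = 0#
  inv (suc k) = recip (fromℕ (suc k)) (0<fromℕ k)

  inv-inverse : ∀ {k} → 1 ℕ.≤ k → fromℕ k * inv k ≈ 1#
  inv-inverse {suc k} _ = *-recip (0<fromℕ k)

  0≤inv : ∀ k → 0# ≤ inv k
  0≤inv zero    = ≤-refl
  0≤inv (suc k) = <⇒≤ (0<recip (0<fromℕ k))

  inv≤1 : ∀ k → inv k ≤ 1#
  inv≤1 zero    = 0≤1
  inv≤1 (suc k) = begin
    inv (suc k)                  ≈⟨ sym (*-identityˡ _) ⟩
    1# * inv (suc k)             ≤⟨ *-monoʳ-≤ (0≤inv (suc k)) (≤-by (0≤fromℕ k) refl) ⟩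
    fromℕ (suc k) * inv (suc k)  ≈⟨ inv-inverse {suc k} (ℕ.s≤s ℕ.z≤n) ⟩
    1# ∎

  -- The chord of x ↦ 1/x over the interval [s, 2s].
  inv-chord : ∀ {s x} → 1 ℕ.≤ s → s ℕ.≤ x → fromℕ x ≤ fromℕ 2 * fromℕ s →
    inv x ≤ half * (inv s * inv s) * (fromℕ 3 * fromℕ s) - half * (inv s * inv s) * fromℕ x
  inv-chord {s} {x} 1≤s s≤x x≤2s = ≤-by
    (*-nonneg (*-nonneg (*-nonneg 0≤half (0≤x*x i)) (0≤inv x))
      (*-nonneg (x≤y⇒0≤y-x (fromℕ-mono-≤ s≤x)) (x≤y⇒0≤y-x x≤2s)))
    (sym (begin-equality
      j + h * (i * i) * j * ((X - S) * (fromℕ 2 * S - X))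
        ≈⟨ solve 5 (λ h i j s x → j :+ h :* (i :* i) :* j :* ((x :- s) :* (:2 :* s :- x))
             := j :+ (h :* (i :* i) :* (:3 :* s) :* (x :* j) :- h :* (i :* i) :* x :* (x :* j) :- (h :* :2) :* ((s :* i) :* (s :* i)) :* j)) refl h i j S X ⟩
      j + (h * (i * i) * (fromℕ 3 * S) * (X * j) - h * (i * i) * X * (X * j) - (h * fromℕ 2) * ((S * i) * (S * i)) * j)
        ≈⟨ +-congˡ (+-cong (+-cong (*-congˡ xj) (-‿cong (*-congˡ xj))) (-‿cong (*-congʳ (*-cong half*2≈1 (*-cong si si))))) ⟩
      j + (h * (i * i) * (fromℕ 3 * S) * 1# - h * (i * i) * X * 1# - 1# * (1# * 1#) * j)
        ≈⟨ solve 5 (λ h i j s x → j :+ (h :* (i :* i) :* (:3 :* s) :* :1 :- h :* (i :* i) :* x :* :1 :- :1 :* (:1 :* :1) :* j)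
             := h :* (i :* i) :* (:3 :* s) :- h :* (i :* i) :* x) refl h i j S X ⟩
      h * (i * i) * (fromℕ 3 * S) - h * (i * i) * X ∎))
    where
    h = half
    i = inv s
    j = inv x
    S = fromℕ s
    X = fromℕ x
    xj : X * j ≈ 1#
    xj = inv-inverse (ℕ.≤-trans 1≤s s≤x)
    si : S * i ≈ 1#
    si = inv-inverse 1≤s

  𝟙-guard : ∀ b {x y} → (T b → x ≤ y) → 𝟙 b * x ≤ 𝟙 b * y
  𝟙-guard true  x≤y = *-monoˡ-≤ 0≤1 (x≤y tt)
  𝟙-guard false x≤y = ≤-reflexive (trans (zeroˡ _) (sym (zeroˡ _)))

  -- Charges the indicator of a bad start to the bound; this is how the failure probabilities of
  -- consecutive phases come to be added.
  ≤-unless : ∀ b {x y} → (T (not b) → x ≤ y) → x ≤ 1# → 0# ≤ y → x ≤ y + 𝟙 b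
  ≤-unless true  x≤y x≤1 0≤y = ≤-trans x≤1 (≤-by 0≤y (+-comm _ _))
  ≤-unless false x≤y x≤1 0≤y = ≤-trans (x≤y tt) (≤-reflexive (sym (+-identityʳ _)))

  -- Thresholds compare natural numbers after multiplication by `A`, because an indicator needs a
  -- decidable event and a fraction of n in the field does not provide one.
  few : ℕ → State n → Bool
  few A S = A ℕ.* count S ℕ.<ᵇ n

  large : ℕ → State n → Bool
  large B S = n ℕ.<ᵇ B ℕ.* count (complement S)

  private
    ¬<ᵇ⇒≥ : ∀ a b → T (not (a ℕ.<ᵇ b)) → b ℕ.≤ a
    ¬<ᵇ⇒≥ a b ¬a<b with a ℕ.<ᵇ b in eq
    ... | false = ℕ.≮⇒≥ (λ a<b → ≡.subst T eq (ℕ.<⇒<ᵇ a<b))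

    count-step≥ : ∀ S r → count S ℕ.≤ count (step S r)
    count-step≥ S r = fromℕ-cancel-≤ (≤-trans (≤-reflexive (sym (size-count S)))
      (≤-trans (size-step≥ S r) (≤-reflexive (size-count (step S r)))))

    count-step≤ : ∀ S r → fromℕ (count (step S r)) ≤ fromℕ 2 * fromℕ (count S)
    count-step≤ S r = ≤-trans (≤-reflexive (sym (size-count (step S r))))
      (≤-trans (size-step≤ S r) (≤-reflexive (*-congˡ (size-count S))))

    few-step : ∀ A S r → T (few A (step S r)) → T (few A S)
    few-step A S r few′ = ℕ.<⇒<ᵇ (ℕ.≤-<-trans (ℕ.*-monoʳ-≤ A (count-step≥ S r))
      (ℕ.<ᵇ⇒< (A ℕ.* count (step S r)) n few′))

    -- With τ = κ + θ and s = |S|, the chord gives E[1/|S'|] ≤ (3s - E|S'|)/(2s²), and E|S'| ≥ (2 -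
    -- 3τ/2)s makes this (1 + 3τ/2)/(2s); the factor is rounded up to 1 + 2τ.
    inv-growth : ∀ S {κ} → 0# ≤ κ → size S ≤ κ * N →
      𝔼 roundE (λ r → inv (count (step S r))) ≤ half * (1# + fromℕ 2 * (κ + θ)) * inv (count S)
    inv-growth S {κ} 0≤κ S≤κN = go (count S) ≡.refl
      where
      τ = κ + θ
      0≤τ : 0# ≤ τ
      0≤τ = +-nonneg 0≤κ 0≤θ
      go : ∀ s → s ≡ count S →
        𝔼 roundE (λ r → inv (count (step S r))) ≤ half * (1# + fromℕ 2 * τ) * inv s
      -- Doubling nothing gives nothing, so both sides are 0.
      go zero 0≡s = begin
        𝔼 roundE (λ r → inv (count (step S r)))
          ≈⟨ 𝔼-cong roundE (λ r → reflexive (≡.cong inv {count (step S r)} {0} (ℕ.n≤0⇒n≡0 (fromℕ-cancel-≤ {count (step S r)} {0} (≤-trans (count-step≤ S r)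
               (≤-reflexive (trans (*-congˡ (reflexive (≡.cong fromℕ (≡.sym 0≡s)))) (zeroʳ _)))))))) ⟩
        𝔼 roundE (λ _ → 0#) ≈⟨ 𝔼-const roundE 0# ⟩
        0#                  ≈⟨ sym (zeroʳ _) ⟩
        half * (1# + fromℕ 2 * τ) * 0# ∎
      go (suc k) s≡ = begin
        𝔼 roundE (λ r → inv (count (step S r)))
          ≤⟨ 𝔼-mono roundE (λ r → ≤-trans
               (inv-chord {s} {count (step S r)} (ℕ.s≤s ℕ.z≤n) (ℕ.≤-trans (ℕ.≤-reflexive s≡) (count-step≥ S r))
                 (≤-trans (count-step≤ S r) (≤-reflexive (*-congˡ (reflexive (≡.cong fromℕ (≡.sym s≡)))))))
               (≤-reflexive (+-congˡ (-‿cong (*-congˡ {b} (sym (size-count (step S r)))))))) ⟩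
        𝔼 roundE (λ r → b * (fromℕ 3 * Z) - b * size (step S r))
          ≈⟨ 𝔼-linear roundE (b * (fromℕ 3 * Z)) b (λ r → size (step S r)) ⟩
        b * (fromℕ 3 * Z) - b * E
          ≈⟨ +-congˡ (-‿cong (x≈1*x half*2≈1)) ⟩
        b * (fromℕ 3 * Z) - (half * fromℕ 2) * (b * E)
          ≤⟨ ≤-by (*-nonneg (*-nonneg (*-nonneg 0≤half (0≤x*x i)) 0≤half) (x≤y⇒0≤y-x drift-bound))
               (solve 5 (λ b z e h t → (b :* (:3 :* z) :- (b :* h) :* ((con (+ 4) :- :3 :* t) :* z))
                   := (b :* (:3 :* z) :- (h :* :2) :* (b :* e))
                      :+ (b :* h) :* (:2 :* e :- (con (+ 4) :- :3 :* t) :* z)) refl b Z E half τ) ⟩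
        b * (fromℕ 3 * Z) - (b * half) * ((fromℕ 4 - fromℕ 3 * τ) * Z)
          ≈⟨ solve 4 (λ h i z t → h :* (i :* i) :* (:3 :* z) :- (h :* (i :* i) :* h) :* ((con (+ 4) :- :3 :* t) :* z)
               := h :* i :* (z :* i) :* (:3 :- ((h :* :2) :* :2 :- :3 :* (h :* t)))) refl half i Z τ ⟩
        half * i * (Z * i) * (fromℕ 3 - ((half * fromℕ 2) * fromℕ 2 - fromℕ 3 * (half * τ)))
          ≈⟨ *-cong (*-congˡ (inv-inverse {s} (ℕ.s≤s ℕ.z≤n))) (+-congˡ (-‿cong (+-congʳ (*-congʳ half*2≈1)))) ⟩
        half * i * 1# * (fromℕ 3 - (1# * fromℕ 2 - fromℕ 3 * (half * τ)))
          ≤⟨ ≤-by (*-nonneg (*-nonneg 0≤half (0≤inv s)) (*-nonneg 0≤half 0≤τ))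
               (solve 3 (λ h i t → h :* (:1 :+ (h :* :2) :* (:2 :* t)) :* i
                 := h :* i :* :1 :* (:3 :- (:1 :* :2 :- :3 :* (h :* t))) :+ h :* i :* (h :* t)) refl half i τ) ⟩
        half * (1# + (half * fromℕ 2) * (fromℕ 2 * τ)) * i
          ≈⟨ *-congʳ (*-congˡ (+-congˡ (trans (*-congʳ half*2≈1) (*-identityˡ _)))) ⟩
        half * (1# + fromℕ 2 * τ) * i ∎
        where
        s = suc k
        i = inv s
        b = half * (i * i)
        Z = fromℕ s
        E = 𝔼 roundE (λ r → size (step S r))
        drift-bound : (fromℕ 4 - fromℕ 3 * τ) * Z ≤ fromℕ 2 * E
        drift-bound = ≤-trans (≤-reflexive (*-congˡ (trans (reflexive (≡.cong fromℕ s≡)) (sym (size-count S)))))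
          (twice-𝔼-informed≥ S S≤κN)

  -- The cut-off keeps the contraction valid at every state: 1/|S| shrinks only while S is small,
  -- and since S grows, a state that has stopped being `few` never becomes so again.
  potential : ℕ → State n → Carrier
  potential A S = 𝟙 (few A S) * inv (count S)

  private
    size≤κN : ∀ A S {κ} → 0# ≤ κ → κ * fromℕ A ≈ 1# → A ℕ.* count S ℕ.≤ n → size S ≤ κ * N
    size≤κN A S {κ} 0≤κ κA≈1 A*S≤n = begin
      size S                      ≈⟨ trans (size-count S) (sym (*-identityˡ _)) ⟩
      1# * fromℕ (count S)        ≈⟨ trans (*-congʳ (sym κA≈1)) (*-assoc _ _ _) ⟩
      κ * (fromℕ A * fromℕ (count S)) ≈⟨ *-congˡ (sym (fromℕ-* A (count S))) ⟩
      κ * fromℕ (A ℕ.* count S)   ≤⟨ *-monoˡ-≤ 0≤κ (fromℕ-mono-≤ A*S≤n) ⟩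
      κ * N ∎

    ¬few⇒complement≤ : ∀ A S {κ} → 0# ≤ κ → κ * fromℕ A ≈ 1# → T (not (few A S)) →
      size (complement S) ≤ (1# - κ) * N
    ¬few⇒complement≤ A S {κ} 0≤κ κA≈1 notFew = begin
      size (complement S)          ≈⟨ size-complement S ⟩
      N - size S                   ≤⟨ +-monoʳ-≤ (neg-anti-≤ (begin
        κ * N                           ≤⟨ *-monoˡ-≤ 0≤κ (fromℕ-mono-≤ (¬<ᵇ⇒≥ (A ℕ.* count S) n notFew)) ⟩
        κ * fromℕ (A ℕ.* count S)       ≈⟨ *-congˡ (fromℕ-* A (count S)) ⟩
        κ * (fromℕ A * fromℕ (count S)) ≈⟨ sym (*-assoc _ _ _) ⟩
        κ * fromℕ A * fromℕ (count S)   ≈⟨ *-cong κA≈1 (sym (size-count S)) ⟩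
        1# * size S                     ≈⟨ *-identityˡ _ ⟩
        size S ∎)) ⟩
      N - κ * N                    ≈⟨ solve 2 (λ n k → n :- k :* n := (:1 :- k) :* n) refl N κ ⟩
      (1# - κ) * N ∎

    large⇒ : ∀ B S → N * 𝟙 (large B S) ≤ fromℕ B * size (complement S)
    large⇒ B S = go (large B S) (ℕ.<ᵇ⇒< n (B ℕ.* count U))
      where
      U = complement S
      go : ∀ b → (T b → n ℕ.< B ℕ.* count U) → N * 𝟙 b ≤ fromℕ B * size U
      go true  n< = begin
        N * 1#                      ≈⟨ *-identityʳ N ⟩
        N                           ≤⟨ fromℕ-mono-≤ {n} {B ℕ.* count U} (ℕ.<⇒≤ (n< tt)) ⟩
        fromℕ (B ℕ.* count U)       ≈⟨ fromℕ-* B (count U) ⟩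
        fromℕ B * fromℕ (count U)   ≈⟨ *-congˡ (sym (size-count U)) ⟩
        fromℕ B * size U ∎
      go false _  = ≤-trans (≤-reflexive (zeroʳ N)) (*-nonneg (0≤fromℕ B) (size≥0 U))

  potential-drift : ∀ A {κ} → 0# ≤ κ → κ * fromℕ A ≈ 1# → ∀ S →
    𝔼 roundE (λ r → potential A (step S r)) ≤ half * (1# + fromℕ 2 * (κ + θ)) * potential A S
  potential-drift A {κ} 0≤κ κA≈1 S = begin
    𝔼 roundE (λ r → potential A (step S r))
      ≤⟨ 𝔼-mono roundE (λ r → *-monoʳ-≤ (0≤inv (count (step S r))) (𝟙-mono (few A (step S r)) (few A S) (few-step A S r))) ⟩
    𝔼 roundE (λ r → 𝟙 (few A S) * inv (count (step S r)))
      ≈⟨ 𝔼-*ˡ roundE (𝟙 (few A S)) (λ r → inv (count (step S r))) ⟩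
    𝟙 (few A S) * 𝔼 roundE (λ r → inv (count (step S r)))
      ≤⟨ 𝟙-guard (few A S) (λ isFew → inv-growth S 0≤κ (size≤κN A S 0≤κ κA≈1 (ℕ.<⇒≤ (ℕ.<ᵇ⇒< (A ℕ.* count S) n isFew)))) ⟩
    𝟙 (few A S) * (ρ * inv (count S))
      ≈⟨ x∙yz≈y∙xz (𝟙 (few A S)) ρ (inv (count S)) ⟩
    ρ * potential A S ∎
    where ρ = half * (1# + fromℕ 2 * (κ + θ))

  private
    0≤ρ-growth : ∀ {κ} → 0# ≤ κ → 0# ≤ half * (1# + fromℕ 2 * (κ + θ))
    0≤ρ-growth 0≤κ = *-nonneg 0≤half (+-nonneg 0≤1 (*-nonneg (0≤fromℕ 2) (+-nonneg 0≤κ 0≤θ)))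

    0≤ρ-shrink : ∀ {κ} → 0# ≤ κ → 0# ≤ p + (1# - p) * (κ + θ)
    0≤ρ-shrink 0≤κ = +-nonneg 0≤p (*-nonneg 0≤1-p (+-nonneg 0≤κ 0≤θ))

    after≤1 : ∀ h (b : State n → Bool) S → after h (λ S′ → 𝟙 (b S′)) S ≤ 1#
    after≤1 h b S = ≤-trans (𝔼-mono (historyE h) (λ v → 𝟙≤1 (b (run step S v)))) (≤-reflexive (𝔼-1 (historyE h)))

  -- Markov's inequality: as |S| ≤ n, the indicator is at most n times the potential, which starts
  -- at no more than 1.
  few-after : ∀ A {κ} → 0# ≤ κ → κ * fromℕ A ≈ 1# → ∀ a S → 1 ℕ.≤ count S →
    after a (λ S′ → 𝟙 (few A S′)) S ≤ (half * (1# + fromℕ 2 * (κ + θ))) ^ a * N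
  few-after A {κ} 0≤κ κA≈1 a S 1≤S = begin
    after a (λ S′ → 𝟙 (few A S′)) S
      ≤⟨ 𝔼-mono (historyE a) (λ v → begin
          𝟙 (few A (run step S v))                ≈⟨ sym (*-identityʳ _) ⟩
          𝟙 (few A (run step S v)) * 1#           ≤⟨ *-monoˡ-≤ (0≤𝟙 _) (1≤N*inv v) ⟩
          𝟙 (few A (run step S v)) * (N * inv (count (run step S v)))
            ≈⟨ x∙yz≈y∙xz (𝟙 (few A (run step S v))) N _ ⟩
          N * potential A (run step S v) ∎) ⟩
    after a (λ S′ → N * potential A S′) S         ≈⟨ 𝔼-*ˡ (historyE a) N _ ⟩
    N * after a (potential A) S
      -- The contraction holds at all states, so a trivially true invariant is passed, encoded as
      -- `Fin 1`.
      ≤⟨ *-monoˡ-≤ (0≤fromℕ n) (drift (λ _ → Fin 1) (potential A) (0≤ρ-growth 0≤κ) (λ _ _ z → z)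
           (λ S _ → potential-drift A 0≤κ κA≈1 S) a S zero) ⟩
    N * (ρ ^ a * potential A S)
      ≤⟨ *-monoˡ-≤ (0≤fromℕ n) (*-monoˡ-≤ (^-nonneg a (0≤ρ-growth 0≤κ))
           (*-mono-≤ (0≤𝟙 (few A S)) (𝟙≤1 (few A S)) (0≤inv (count S)) (inv≤1 (count S)))) ⟩
    N * (ρ ^ a * (1# * 1#))                       ≈⟨ solve 2 (λ n r → n :* (r :* (:1 :* :1)) := r :* n) refl N (ρ ^ a) ⟩
    ρ ^ a * N ∎
    where
    ρ = half * (1# + fromℕ 2 * (κ + θ))
    1≤N*inv : ∀ v → 1# ≤ N * inv (count (run step S v))
    1≤N*inv v = begin
      1#                            ≈⟨ sym (inv-inverse 1≤S′) ⟩
      fromℕ (count S′) * inv (count S′)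
        ≤⟨ *-monoʳ-≤ (0≤inv (count S′)) (≤-trans (≤-reflexive (sym (size-count S′))) (size≤n S′)) ⟩
      N * inv (count S′) ∎
      where
      S′ = run step S v
      1≤S′ : 1 ℕ.≤ count S′
      1≤S′ = ℕ.≤-trans 1≤S (fromℕ-cancel-≤ (≤-trans (≤-reflexive (sym (size-count S)))
        (≤-trans (size-run≥ S v) (≤-reflexive (size-count S′)))))

  uninformed-after : ∀ {κ} → 0# ≤ κ → ∀ h S → size (complement S) ≤ κ * N →
    after h (λ S′ → size (complement S′)) S ≤ (p + (1# - p) * (κ + θ)) ^ h * N
  uninformed-after {κ} 0≤κ h S U≤κN = ≤-trans
    (drift (λ S′ → size (complement S′) ≤ κ * N) (λ S′ → size (complement S′)) (0≤ρ-shrink 0≤κ)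
      (λ S r → ≤-trans (size-complement-step≤ S r)) (λ S → 𝔼-uninformed≤ S) h S U≤κN)
    (*-monoˡ-≤ (^-nonneg h (0≤ρ-shrink 0≤κ)) (size≤n (complement S)))

  -- The factor n from Markov's inequality cancels against the size of U, so the bound does not
  -- involve n and a constant number `b` of rounds makes it small.
  large-after : ∀ A B {κ} → 0# ≤ κ → κ ≤ 1# → κ * fromℕ A ≈ 1# → ∀ b S →
    after b (λ S′ → 𝟙 (large B S′)) S ≤ fromℕ B * (p + (1# - p) * ((1# - κ) + θ)) ^ b + 𝟙 (few A S)
  large-after A B {κ} 0≤κ κ≤1 κA≈1 b S = ≤-unless (few A S) (λ notFew → *-cancelˡ-≤ (0<fromℕ m) (begin
      N * after b (λ S′ → 𝟙 (large B S′)) S       ≈⟨ sym (𝔼-*ˡ (historyE b) N _) ⟩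
      after b (λ S′ → N * 𝟙 (large B S′)) S       ≤⟨ after-mono b S (large⇒ B) ⟩
      after b (λ S′ → fromℕ B * size (complement S′)) S ≈⟨ 𝔼-*ˡ (historyE b) (fromℕ B) _ ⟩
      fromℕ B * after b (λ S′ → size (complement S′)) S
        ≤⟨ *-monoˡ-≤ (0≤fromℕ B) (uninformed-after 0≤1-κ b S (¬few⇒complement≤ A S 0≤κ κA≈1 notFew)) ⟩
      fromℕ B * (ρ ^ b * N)                       ≈⟨ x∙yz≈z∙xy (fromℕ B) (ρ ^ b) N ⟩
      N * (fromℕ B * ρ ^ b) ∎))
    (after≤1 b (large B) S) (*-nonneg (0≤fromℕ B) (^-nonneg b (0≤ρ-shrink 0≤1-κ)))
    where
    0≤1-κ = x≤y⇒0≤y-x κ≤1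
    ρ = p + (1# - p) * ((1# - κ) + θ)

  notFull-after : ∀ B {κ} → 0# ≤ κ → κ * fromℕ B ≈ 1# → ∀ c S →
    after c (λ S′ → 𝟙 (not (full S′))) S ≤ (p + (1# - p) * (κ + θ)) ^ c * N + 𝟙 (large B S)
  notFull-after B {κ} 0≤κ κB≈1 c S = ≤-unless (large B S)
    (λ notLarge → ≤-trans (after-mono c S 𝟙-not-full≤) (uninformed-after 0≤κ c S (size≤κN B (complement S) 0≤κ κB≈1 (¬<ᵇ⇒≥ n _ notLarge))))
    (after≤1 c (λ S′ → not (full S′)) S)
    (*-nonneg (^-nonneg c (0≤ρ-shrink 0≤κ)) (0≤fromℕ n))

  -- By the Markov property the phases are peeled off from the last to the first; each turns failure
  -- from a good start into a number and hands the indicator of a bad start to the phase before it.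
  P-notFull≤ : ∀ A B {κ κ′} → 0# ≤ κ → κ ≤ 1# → κ * fromℕ A ≈ 1# → 0# ≤ κ′ → κ′ * fromℕ B ≈ 1# →
    ∀ a b c S → 1 ℕ.≤ count S →
    after (a ℕ.+ (b ℕ.+ c)) (λ S′ → 𝟙 (not (full S′))) S ≤
      (p + (1# - p) * (κ′ + θ)) ^ c * N
      + (fromℕ B * (p + (1# - p) * ((1# - κ) + θ)) ^ b
      + (half * (1# + fromℕ 2 * (κ + θ))) ^ a * N)
  P-notFull≤ A B {κ} {κ′} 0≤κ κ≤1 κA≈1 0≤κ′ κ′B≈1 a b c S 1≤S = begin
    after (a ℕ.+ (b ℕ.+ c)) f S       ≈⟨ after-+ a (b ℕ.+ c) f S ⟩
    after a (after (b ℕ.+ c) f) S     ≤⟨ after-mono a S (λ S′ → begin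
      after (b ℕ.+ c) f S′                   ≈⟨ after-+ b c f S′ ⟩
      after b (after c f) S′                 ≤⟨ after-mono b S′ (notFull-after B 0≤κ′ κ′B≈1 c) ⟩
      after b (λ S″ → x₃ + 𝟙 (large B S″)) S′ ≈⟨ shift b x₃ (large B) S′ ⟩
      x₃ + after b (λ S″ → 𝟙 (large B S″)) S′ ≤⟨ +-monoʳ-≤ (large-after A B 0≤κ κ≤1 κA≈1 b S′) ⟩
      x₃ + (x₂ + 𝟙 (few A S′))               ≈⟨ sym (+-assoc _ _ _) ⟩
      (x₃ + x₂) + 𝟙 (few A S′) ∎) ⟩
    after a (λ S′ → (x₃ + x₂) + 𝟙 (few A S′)) S ≈⟨ shift a (x₃ + x₂) (few A) S ⟩
    (x₃ + x₂) + after a (λ S′ → 𝟙 (few A S′)) S ≤⟨ +-monoʳ-≤ (few-after A 0≤κ κA≈1 a S 1≤S) ⟩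
    (x₃ + x₂) + x₁                    ≈⟨ +-assoc _ _ _ ⟩
    x₃ + (x₂ + x₁) ∎
    where
    f : State n → Carrier
    f S′ = 𝟙 (not (full S′))
    x₃ = (p + (1# - p) * (κ′ + θ)) ^ c * N
    x₂ = fromℕ B * (p + (1# - p) * ((1# - κ) + θ)) ^ b
    x₁ = (half * (1# + fromℕ 2 * (κ + θ))) ^ a * N
    shift : ∀ h x (b : State n → Bool) S → after h (λ S′ → x + 𝟙 (b S′)) S ≈ x + after h (λ S′ → 𝟙 (b S′)) S
    shift h x b S = trans (𝔼-+ (historyE h) _ _) (+-congʳ (𝔼-const (historyE h) x))

-- Informed sets along a run

any-witness : ∀ {k} (b : Fin k → Bool) → T (any b) → ∃[ i ] T (b i)
any-witness {suc k} b anyb with b zero in eq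
... | true  = zero , ≡.subst T (≡.sym eq) tt
... | false with any-witness (λ i → b (suc i)) anyb
...   | i , bᵢ = suc i , bᵢ

full⇒all : ∀ {n} (S : State n) → T (full S) → ∀ u → T (S u)
full⇒all S isFull u with S u | any-false (complement S) isFull u
... | true | _ = tt

all⇒full : ∀ {n} (S : State n) → (∀ u → T (S u)) → T (full S)
all⇒full S all with any (complement S) in eq
... | false = tt
... | true with any-witness (complement S) (≡.subst T (≡.sym eq) tt)
...   | u , ¬Su with S u | all u
...     | true | _ = ¬Su

least : (P : ℕ → Bool) → ∀ t → T (P t) → ∃[ s ] (s ℕ.≤ t × T (P s) × (∀ r → r ℕ.< s → ¬ T (P r)))
least P zero    Pt = 0 , ℕ.z≤n , Pt , λ _ ()
least P (suc t) Pt with P 0 in eq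
... | true  = 0 , ℕ.z≤n , ≡.subst T (≡.sym eq) tt , λ _ ()
... | false with least (λ s → P (suc s)) t Pt
...   | s , s≤t , Ps , minimal = suc s , ℕ.s≤s s≤t , Ps , below
  where
  below : ∀ r → r ℕ.< suc s → ¬ T (P r)
  below zero    _          P0 = ≡.subst T eq P0
  below (suc r) (ℕ.s≤s r<s) = minimal r r<s

singleton : ∀ {n} → Fin n → State n
singleton v u = does (u Fin.≟ v)

-- Reads an earlier time off a longer history, so that the events at two different times live on the
-- same prefix. Past the end the state is frozen, a case excluded by the bound t ≤ h wherever the
-- function is evaluated.
stateAt : ∀ {n} → ℕ → State n → ∀ {h} → Vec (Vec (Fin n) n) h → State n
stateAt zero    S v       = S
stateAt (suc t) S []      = S
stateAt (suc t) S (r ∷ v) = stateAt t (step S r) v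

evolve : ∀ {n} → (ℕ → Fin n → Fin n) → State n → ℕ → State n
evolve choice S zero    = S
evolve choice S (suc t) = evolve (λ s → choice (suc s)) (step S (Vec.tabulate (choice 0))) t

stateAt-evolve : ∀ {n} (choice : ℕ → Fin n → Fin n) S {t h} → t ℕ.≤ h →
  stateAt t S (Vec.tabulate {n = h} (λ k → Vec.tabulate (choice (Fin.toℕ k)))) ≡ evolve choice S t
stateAt-evolve choice S ℕ.z≤n       = ≡.refl
stateAt-evolve choice S (ℕ.s≤s t≤h) = stateAt-evolve (λ s → choice (suc s)) (step S (Vec.tabulate (choice 0))) t≤h

-- `evolve` consumes the first round first, as histories do, whereas `Informed` recurses on the last
-- round; this equation reconciles them.
evolve-suc : ∀ {n} (choice : ℕ → Fin n → Fin n) S t →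
  evolve choice S (suc t) ≡ step (evolve choice S t) (Vec.tabulate (choice t))
evolve-suc choice S zero    = ≡.refl
evolve-suc choice S (suc t) = evolve-suc (λ s → choice (suc s)) (step S (Vec.tabulate (choice 0))) t

evolve-mono : ∀ {n} (choice : ℕ → Fin n → Fin n) S {s t} → s ℕ.≤ t → evolve choice S s ⊆ evolve choice S t
evolve-mono choice S {s} s≤t = go (ℕ.≤⇒≤′ s≤t)
  where
  go : ∀ {t} → s ℕ.≤′ t → evolve choice S s ⊆ evolve choice S t
  go (ℕ.≤′-reflexive ≡.refl) u Su = Su
  go (ℕ.≤′-step {t} s≤t)     u Su = ≡.subst (λ S′ → T (S′ u)) (≡.sym (evolve-suc choice S t))
    (step-⊇ (evolve choice S t) (Vec.tabulate (choice t)) u (go s≤t u Su))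

module InformedVertices {n} (G : Graph n) (v : Fin n) where
  open PushModel G

  private
    T-∧ : ∀ {a b} → T a → T b → T (a ∧ b)
    T-∧ {true} {true} _ _ = tt

    ∧-left : ∀ {a b} → T (a ∧ b) → T a
    ∧-left {true} {true} _ = tt

    ∧-right : ∀ {a b} → T (a ∧ b) → T b
    ∧-right {true} {true} _ = tt

    ∨-right : ∀ a {b} → T b → T (a ∨ b)
    ∨-right true  _  = tt
    ∨-right false Tb = Tb

    ≡⇒T : ∀ {x y : Fin n} → x ≡ y → T (does (x Fin.≟ y))
    ≡⇒T {x} {y} x≡y with x Fin.≟ y
    ... | yes _  = tt
    ... | no x≢y = ⊥-elim (x≢y x≡y)

    T⇒≡ : ∀ {x y : Fin n} → T (does (x Fin.≟ y)) → x ≡ y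
    T⇒≡ {x} {y} _ with yes x≡y ← x Fin.≟ y = x≡y

  informedAt : Run → ℕ → State n
  informedAt ω = evolve (choice ω) (singleton v)

  private
    chooses : Run → ℕ → Fin n → Fin n → Bool
    chooses ω t u w = informedAt ω t w ∧ does (Vec.lookup (Vec.tabulate (choice ω t)) w Fin.≟ u)

  Informed⇒informedAt : ∀ ω t u → Informed v ω t u → T (informedAt ω t u)
  Informed⇒informedAt ω zero    u u≡v = ≡⇒T u≡v
  Informed⇒informedAt ω (suc t) u (inj₁ already) =
    evolve-mono (choice ω) (singleton v) (ℕ.n≤1+n t) u (Informed⇒informedAt ω t u already)
  Informed⇒informedAt ω (suc t) u (inj₂ (w , w-informed , w→u)) =
    ≡.subst (λ S → T (S u)) (≡.sym (evolve-suc (choice ω) (singleton v) t))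
      (∨-right (informedAt ω t u) (any-true (chooses ω t u) w
        (T-∧ (Informed⇒informedAt ω t w w-informed) (≡⇒T (≡.trans (lookup∘tabulate (choice ω t) w) w→u)))))

  informedAt⇒Informed : ∀ ω t u → T (informedAt ω t u) → Informed v ω t u
  informedAt⇒Informed ω zero    u isV = T⇒≡ isV
  informedAt⇒Informed ω (suc t) u isInformed =
    split (informedAt ω t u) ≡.refl (≡.subst (λ S → T (S u)) (evolve-suc (choice ω) (singleton v) t) isInformed)
    where
    split : ∀ b → b ≡ informedAt ω t u → T (b ∨ any (chooses ω t u)) → Informed v ω (suc t) u
    split true  b≡ _   = inj₁ (informedAt⇒Informed ω t u (≡.subst T b≡ tt))
    split false _  new with any-witness (chooses ω t u) new
    ... | w , w-chooses = inj₂ (w , informedAt⇒Informed ω t w (∧-left w-chooses) ,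
            ≡.trans (≡.sym (lookup∘tabulate (choice ω t) w)) (T⇒≡ (∧-right {informedAt ω t w} w-chooses)))

  -- Being full is decidable, so a bounded search below `t` finds the first full time, and
  -- monotonicity of the informed sets keeps it from preceding `s`.
  broadcastTime : ∀ ω {s t} → ¬ T (full (informedAt ω s)) → T (full (informedAt ω t)) →
    ∃[ r ] (v BroadcastTime ω is r × s ℕ.≤ r × r ℕ.≤ t)
  broadcastTime ω {s} {t} notYet done with least (λ r → full (informedAt ω r)) t done
  ... | r , r≤t , isFull , minimal =
    r , ((λ u → informedAt⇒Informed ω r u (full⇒all _ isFull u)) ,
         (λ r′ r′<r all → minimal r′ r′<r (all⇒full _ (λ u → Informed⇒informedAt ω r′ u (all u))))) ,
    ℕ.≮⇒≥ (λ r<s → notYet (all⇒full _ (λ u →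
      evolve-mono (choice ω) (singleton v) (ℕ.<⇒≤ r<s) u (full⇒all _ isFull u)))) ,
    r≤t

-- Probability that the broadcast time lies in a window

module BroadcastProbability {c ℓ₁ ℓ₂} (ℝ : Reals c ℓ₁ ℓ₂) {n} (G : Graph n) (d : ℕ)
  (regular : Graph.Regular G d) (2≤d : 2 ℕ.≤ d) where
  open Reals ℝ hiding (zero; _∨_)
  open OrderedFieldProperties completeOrderedField
  open FiniteExpectation completeOrderedField
  open PushRound ℝ G d regular 2≤d
  open Histories ℝ G d regular 2≤d
  open PushModel G using (Run; Round; histories; prefix; choice; _BroadcastTime_is_)

  private
    𝔼-stateAt : ∀ φ S {t h} → t ℕ.≤ h → 𝔼 (historyE h) (λ v → φ (stateAt t S v)) ≈ after t φ S
    𝔼-stateAt φ S {h = h} ℕ.z≤n = 𝔼-const (historyE h) (φ S)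
    𝔼-stateAt φ S (ℕ.s≤s t≤h)   = 𝔼-cong roundE (λ r → 𝔼-stateAt φ (step S r) t≤h)

  -- The witnessing event, full at `t` but not at `s`, is decided by the first `t` rounds. A union
  -- bound over its two ways to fail gives the probability, and uniformity on histories turns the
  -- expectation into a count.
  broadcastTime-Prob≥ : ∀ v {s t x y δ} → s ℕ.≤ t →
    after s (λ S → 𝟙 (full S)) (singleton v) ≤ x →
    after t (λ S → 𝟙 (not (full S))) (singleton v) ≤ y → x + y ≤ δ →
    ∀ {e} (E : Run → Set e) →
    (∀ ω r → v BroadcastTime ω is r → s ℕ.≤ r → r ℕ.≤ t → E ω) → Prob≥ ℝ G (1# - δ) E
  broadcastTime-Prob≥ v {s} {t} {x} {y} {δ} s≤t early late x+y≤δ E E-holds = t , D , sound , (begin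
    (1# - δ) * H                          ≤⟨ *-monoʳ-≤ (0≤fromℕ (length (histories t))) 1-δ≤ ⟩
    𝔼 (historyE t) (λ w → 𝟙 (D w)) * H    ≈⟨ *-comm _ _ ⟩
    H * 𝔼 (historyE t) (λ w → 𝟙 (D w))    ≈⟨ sym (historyE-UniformOn t (λ w → 𝟙 (D w))) ⟩
    ∑ₗ (histories t) (λ w → 𝟙 (D w))      ≈⟨ ∑ₗ-𝟙 D (histories t) ⟩
    fromℕ (length (filterᵇ D (histories t))) ∎)
    where
    open ≤-Reasoning
    open InformedVertices G v using (informedAt; broadcastTime)
    H = fromℕ (length (histories t))

    fullAt : ℕ → Vec Round t → Bool
    fullAt r w = full (stateAt r (singleton v) w)

    D : Vec Round t → Bool
    D w = fullAt t w ∧ not (fullAt s w)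

    split : ∀ {a b} → T (a ∧ not b) → T a × ¬ T b
    split {true} {false} _ = tt , λ ()

    sound : ∀ ω → T (D (prefix t ω)) → E ω
    sound ω Dω with split {fullAt t (prefix t ω)} {fullAt s (prefix t ω)} Dω
    ... | done , notYet with broadcastTime ω {s} {t}
            (λ isFull → notYet (≡.subst (λ S → T (full S)) (≡.sym (stateAt-evolve (choice ω) (singleton v) s≤t)) isFull))
            (≡.subst (λ S → T (full S)) (stateAt-evolve (choice ω) (singleton v) {t} {t} ℕ.≤-refl) done)
    ...   | r , isTime , s≤r , r≤t = E-holds ω r isTime s≤r r≤t

    union-bound : ∀ a b → 1# - 1# * (𝟙 b + 𝟙 (not a)) ≤ 𝟙 (a ∧ not b)
    union-bound true  true  = ≤-reflexive (solve 0 (:1 :- :1 :* (:1 :+ :0) := :0) refl)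
    union-bound true  false = ≤-reflexive (solve 0 (:1 :- :1 :* (:0 :+ :0) := :1) refl)
    union-bound false true  = ≤-by 0≤1 (solve 0 (:0 := (:1 :- :1 :* (:1 :+ :1)) :+ :1) refl)
    union-bound false false = ≤-reflexive (solve 0 (:1 :- :1 :* (:0 :+ :1) := :0) refl)

    1-δ≤ : 1# - δ ≤ 𝔼 (historyE t) (λ w → 𝟙 (D w))
    1-δ≤ = begin
      1# - δ
        ≤⟨ +-monoʳ-≤ (neg-anti-≤ (≤-trans (+-mono-≤ early late) x+y≤δ)) ⟩
      1# - (after s (λ S → 𝟙 (full S)) (singleton v) + after t (λ S → 𝟙 (not (full S))) (singleton v))
        ≈⟨ +-congˡ (-‿cong (trans (sym (+-cong (𝔼-stateAt (λ S → 𝟙 (full S)) (singleton v) s≤t)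
               (𝔼-stateAt (λ S → 𝟙 (not (full S))) (singleton v) {t} {t} ℕ.≤-refl)))
             (trans (sym (𝔼-+ (historyE t) (λ w → 𝟙 (fullAt s w)) (λ w → 𝟙 (not (fullAt t w))))) (sym (*-identityˡ _))))) ⟩
      1# - 1# * 𝔼 (historyE t) (λ w → 𝟙 (fullAt s w) + 𝟙 (not (fullAt t w)))
        ≈⟨ sym (𝔼-linear (historyE t) 1# 1# (λ w → 𝟙 (fullAt s w) + 𝟙 (not (fullAt t w)))) ⟩
      𝔼 (historyE t) (λ w → 1# - 1# * (𝟙 (fullAt s w) + 𝟙 (not (fullAt t w))))
        ≤⟨ 𝔼-mono (historyE t) (λ w → union-bound (fullAt t w) (fullAt s w)) ⟩
      𝔼 (historyE t) (λ w → 𝟙 (D w)) ∎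

-- Comparing powers through logarithms

module Logarithms {c ℓ₁ ℓ₂} (ℝ : Reals c ℓ₁ ℓ₂) where
  open Reals ℝ hiding (zero)
  open OrderedFieldProperties completeOrderedField
  open ExponentialProperties completeOrderedField
  open ≤-Reasoning

  0≤ln : ∀ {x} (0<x : 0# < x) → 1# < x → 0# ≤ ln x 0<x
  0≤ln 0<x 1<x = <⇒≤ (ln-pos _ 0<x 1<x)

  SupExp-ln : ∀ {x} (0<x : 0# < x) → 1# < x → SupExp (ln x 0<x) x
  SupExp-ln 0<x 1<x = IsExp⇒SupExp (0≤ln 0<x 1<x) (exp-ln _ 0<x)

  0≤lnℕ : ∀ k .{{_ : NonZero k}} → 2 ℕ.≤ k → 0# ≤ lnℕ k
  0≤lnℕ k 2≤k = 0≤ln (0<fromℕ′ k) (fromℕ>1 2≤k)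

  SupExp-lnℕ : ∀ k .{{_ : NonZero k}} → 2 ℕ.≤ k → SupExp (lnℕ k) (fromℕ k)
  SupExp-lnℕ k 2≤k = SupExp-ln (0<fromℕ′ k) (fromℕ>1 2≤k)

  SupExp-ln2 : SupExp (lnℕ 2) (fromℕ 2)
  SupExp-ln2 = SupExp-lnℕ 2 ℕ.≤-refl

  ln2≤1 : lnℕ 2 ≤ 1#
  ln2≤1 = ≤-by (x≤y⇒0≤y-x (SupExp⇒1+x≤ SupExp-ln2))
    (solve 1 (λ l → :1 := l :+ (:2 :- (:1 :+ l))) refl (lnℕ 2))

  -- The inequality exp x ≤ 1/(1 - x) at x = ln 2 reads 2(1 - ln 2) ≤ 1. It requires ln 2 < 1; the
  -- other case is immediate.
  1≤2ln2 : 1# ≤ fromℕ 2 * lnℕ 2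
  1≤2ln2 = ≤-cases 1# (lnℕ 2)
    (λ 1≤l → begin
      1#               ≤⟨ 1≤l ⟩
      lnℕ 2            ≤⟨ ≤-by (<⇒≤ 0<ln2) (solve 1 (λ l → :2 :* l := l :+ l) refl (lnℕ 2)) ⟩
      fromℕ 2 * lnℕ 2 ∎)
    (λ l<1 → ≤-by (x≤y⇒0≤y-x (SupExp⇒*[1-x]≤1 (<⇒≤ 0<ln2) l<1 SupExp-ln2))
      (solve 1 (λ l → :2 :* l := :1 :+ (:1 :- :2 :* (:1 :- l))) refl (lnℕ 2)))

  -- Both sides are exponentials and the hypothesis compares their exponents, with ln(1 + η)
  -- replaced by the larger η to keep it linear.
  power-compare : ∀ {L n lk k η r E} a → 0# ≤ L → SupExp L n → 0# ≤ lk → SupExp lk k → 0# < η →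
    0# ≤ r → SupExp r E → L + lk + fromℕ a * η ≤ fromℕ a * r → (n * k) * (1# + η) ^ a ≤ E ^ a
  power-compare {L} {n} {lk} {k} {η} {r} {E} a 0≤L L↦n 0≤lk lk↦k 0<η 0≤r r↦E bound =
    SupExp-mono-≤ (+-nonneg (+-nonneg 0≤L 0≤lk) (*-nonneg (0≤fromℕ a) 0≤l)) (begin
        L + lk + fromℕ a * l   ≤⟨ +-monoʳ-≤ (*-monoˡ-≤ (0≤fromℕ a) l≤η) ⟩
        L + lk + fromℕ a * η   ≤⟨ bound ⟩
        fromℕ a * r ∎)
      (SupExp-+ (+-nonneg 0≤L 0≤lk) (*-nonneg (0≤fromℕ a) 0≤l) (SupExp-+ 0≤L 0≤lk L↦n lk↦k) (SupExp-· a 0≤l l↦))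
      (SupExp-· a 0≤r r↦E)
    where
    1<1+η : 1# < 1# + η
    1<1+η = 0<z⇒x<x+z 0<η
    0<1+η = <-trans 0<1 1<1+η
    l = ln (1# + η) 0<1+η
    0≤l : 0# ≤ l
    0≤l = 0≤ln 0<1+η 1<1+η
    l↦ : SupExp l (1# + η)
    l↦ = SupExp-ln 0<1+η 1<1+η
    l≤η : l ≤ η
    l≤η = ≤-by (x≤y⇒0≤y-x (SupExp⇒1+x≤ l↦)) (solve 2 (λ l e → e := l :+ ((:1 :+ e) :- (:1 :+ l))) refl l η)

  power-small : ∀ {n k η E ρ} a → 0# ≤ n → 0# ≤ k → 0# < E → 0# ≤ ρ → ρ * E ≤ 1# + η →
    (n * k) * (1# + η) ^ a ≤ E ^ a → k * (ρ ^ a * n) ≤ 1#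
  power-small {n} {k} {η} {E} {ρ} a 0≤n 0≤k 0<E 0≤ρ ρE≤1+η bound = *-cancelˡ-≤ (^-pos a 0<E) (begin
    E ^ a * (k * (ρ ^ a * n))    ≈⟨ solve 4 (λ e k r n → e :* (k :* (r :* n)) := (n :* k) :* (r :* e)) refl (E ^ a) k (ρ ^ a) n ⟩
    (n * k) * (ρ ^ a * E ^ a)    ≈⟨ *-congˡ (sym (^-distrib-* ρ E a)) ⟩
    (n * k) * (ρ * E) ^ a        ≤⟨ *-monoˡ-≤ (*-nonneg 0≤n 0≤k) (^-monoˡ-≤ a (*-nonneg 0≤ρ (<⇒≤ 0<E)) ρE≤1+η) ⟩
    (n * k) * (1# + η) ^ a       ≤⟨ bound ⟩
    E ^ a                        ≈⟨ sym (*-identityʳ _) ⟩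
    E ^ a * 1# ∎)

  -- Here `r` is the logarithmic gain per round. The part L/r of `a` pays for L = ln n; the excess e
  -- L earns e r L, of which one half covers `lk` and the other the loss η in each round.
  enough-rounds : ∀ {L lk e r r′ η} a → r * r′ ≈ 1# → 0# ≤ r → 0# ≤ η → fromℕ 2 ≤ L →
    η * (r′ + e + 1#) ≤ half * (e * r) → lk ≤ half * (e * r) * L →
    L * r′ + e * L ≤ fromℕ a → fromℕ a ≤ (L * r′ + e * L) + fromℕ 2 →
    L + lk + fromℕ a * η ≤ fromℕ a * r
  enough-rounds {L} {lk} {e} {r} {r′} {η} a rr′≈1 0≤r 0≤η 2≤L η-small lk-small a-lower a-upper = begin
    L + lk + fromℕ a * η
      ≤⟨ +-mono-≤ (+-monoʳ-≤ lk-small) (*-monoʳ-≤ 0≤η a-upper) ⟩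
    L + half * (e * r) * L + ((L * r′ + e * L) + fromℕ 2) * η
      -- The rounding error 2 is absorbed into L, whence the summand 1 in the smallness condition on
      -- η.
      ≤⟨ +-monoʳ-≤ (*-monoʳ-≤ 0≤η (+-monoʳ-≤ 2≤L)) ⟩
    L + half * (e * r) * L + ((L * r′ + e * L) + L) * η
      ≈⟨ solve 5 (λ L g r e h → L :+ g :* L :+ ((L :* r :+ e :* L) :+ L) :* h := L :+ g :* L :+ (h :* (r :+ e :+ :1)) :* L) refl L (half * (e * r)) r′ e η ⟩
    L + half * (e * r) * L + (η * (r′ + e + 1#)) * L
      ≤⟨ +-monoʳ-≤ (*-monoʳ-≤ (≤-trans (0≤fromℕ 2) 2≤L) η-small) ⟩
    L + half * (e * r) * L + half * (e * r) * L
      ≈⟨ solve 4 (λ L h e r → L :+ h :* (e :* r) :* L :+ h :* (e :* r) :* L := :1 :* L :+ (h :* :2) :* (e :* r :* L)) refl L half e r ⟩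
    1# * L + (half * fromℕ 2) * (e * r * L)
      ≈⟨ +-cong (*-congʳ (sym rr′≈1)) (*-congʳ half*2≈1) ⟩
    (r * r′) * L + 1# * (e * r * L)
      ≈⟨ solve 4 (λ L e r s → (r :* s) :* L :+ :1 :* (e :* r :* L) := (L :* s :+ e :* L) :* r) refl L e r r′ ⟩
    (L * r′ + e * L) * r
      ≤⟨ *-monoʳ-≤ 0≤r a-lower ⟩
    fromℕ a * r ∎

  -- Bernoulli gives y ≤ (1 + τ)^b, and (1 + τ)(1 - τ) ≤ 1 cancels it against ρ^b, so no logarithm
  -- of 1 - τ is taken.
  geometric-small : ∀ {τ ρ y} b → 0# ≤ τ → 0# ≤ ρ → ρ ≤ 1# - τ → 0# ≤ y → y ≤ 1# + fromℕ b * τ → y * ρ ^ b ≤ 1#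
  geometric-small {τ} {ρ} {y} b 0≤τ 0≤ρ ρ≤1-τ 0≤y y≤ = begin
    y * ρ ^ b                      ≤⟨ *-monoʳ-≤ (^-nonneg b 0≤ρ) (≤-trans y≤ (bernoulli b (+-nonneg 0≤1 0≤τ))) ⟩
    (1# + τ) ^ b * ρ ^ b           ≈⟨ sym (^-distrib-* (1# + τ) ρ b) ⟩
    ((1# + τ) * ρ) ^ b
      ≤⟨ x≤1⇒x^k≤1 b (*-nonneg (+-nonneg 0≤1 0≤τ) 0≤ρ) (≤-trans (*-monoˡ-≤ (+-nonneg 0≤1 0≤τ) ρ≤1-τ)
           (≤-by (0≤x*x τ) (solve 1 (λ t → :1 := (:1 :+ t) :* (:1 :- t) :+ t :* t) refl τ))) ⟩
    1# ∎

  fromℕ-^ : ∀ m k → fromℕ (m ℕ.^ k) ≈ fromℕ m ^ k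
  fromℕ-^ m zero    = fromℕ-1
  fromℕ-^ m (suc k) = trans (fromℕ-* m (m ℕ.^ k)) (*-congˡ (fromℕ-^ m k))

  -- If ln n were below y ≤ j ln 2, exponentiating would give n ≤ 2^j. The threshold 2^j + 2
  -- contradicts this and also secures n ≥ 2, which makes ln n nonnegative.
  lnℕ-unbounded : ∀ y → Σ[ N ∈ ℕ ] (2 ℕ.≤ N × (∀ m → N ℕ.≤ suc m → y ≤ lnℕ (suc m)))
  lnℕ-unbounded y = suc (suc (2 ℕ.^ j)) , ℕ.s≤s (ℕ.s≤s ℕ.z≤n) , λ m N≤ L<y → (begin
      fromℕ (suc m)     ≤⟨ SupExp-mono-≤ (0≤lnℕ (suc m) (2≤ m N≤)) (<⇒≤ (<-≤-trans L<y y≤j*l))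
                             (SupExp-lnℕ (suc m) (2≤ m N≤)) (SupExp-· j (<⇒≤ 0<ln2) SupExp-ln2) ⟩
      fromℕ 2 ^ j       ≈⟨ sym (fromℕ-^ 2 j) ⟩
      fromℕ (2 ℕ.^ j) ∎) (2^j<n m N≤)
    where
    r = recip (lnℕ 2) 0<ln2
    j = proj₁ (archimedean (y * r))
    2≤ : ∀ m → suc (suc (2 ℕ.^ j)) ℕ.≤ suc m → 2 ℕ.≤ suc m
    2≤ m N≤ = ℕ.≤-trans (ℕ.s≤s (ℕ.s≤s ℕ.z≤n)) N≤
    2^j<n : ∀ m → suc (suc (2 ℕ.^ j)) ℕ.≤ suc m → fromℕ (2 ℕ.^ j) < fromℕ (suc m)
    2^j<n m N≤ = fromℕ-mono-< {2 ℕ.^ j} {suc m} (ℕ.≤-trans (ℕ.n≤1+n _) N≤)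
    y≤j*l : y ≤ fromℕ j * lnℕ 2
    y≤j*l = begin
      y                    ≈⟨ sym (trans (*-assoc _ _ _) (trans (*-congˡ (trans (*-comm _ _) (*-recip 0<ln2))) (*-identityʳ y))) ⟩
      y * r * lnℕ 2        ≤⟨ *-monoʳ-≤ (<⇒≤ 0<ln2) (<⇒≤ (proj₂ (archimedean (y * r)))) ⟩
      fromℕ j * lnℕ 2 ∎

-- Estimates for (1 - 1/d)^d

module DegreeEstimates {c ℓ₁ ℓ₂} (ℝ : Reals c ℓ₁ ℓ₂) (d : ℕ) (2≤d : 2 ℕ.≤ d) where
  open Reals ℝ hiding (zero)
  open OrderedFieldProperties completeOrderedField
  open ExponentialProperties completeOrderedField
  open Logarithms ℝ
  open PowerBounds completeOrderedField d 2≤d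
  open ≤-Reasoning

  private
    D = fromℕ d

    0<q : 0# < q
    0<q = x<y⇒0<y-x ι<1

    w = recip q 0<q

    q*w≈1 : q * w ≈ 1#
    q*w≈1 = *-recip 0<q

    1<w : 1# < w
    1<w = <-by (*-pos (0<recip 0<q) 0<ι) (begin-equality
      w                    ≈⟨ solve 2 (λ w i → w := (:1 :- i) :* w :+ w :* i) refl w ι ⟩
      q * w + w * ι        ≈⟨ +-congʳ q*w≈1 ⟩
      1# + w * ι ∎)

    0<w : 0# < w
    0<w = 0<recip 0<q

    l = ln w 0<w

    l↦w : SupExp l w
    l↦w = SupExp-ln 0<w 1<w

    0≤l : 0# ≤ l
    0≤l = 0≤ln 0<w 1<w

    ι≤l : ι ≤ l
    ι≤l = ≤-cases 1# l (λ 1≤l → ≤-trans (<⇒≤ ι<1) 1≤l) (λ l<1 → ≤-by (x≤y⇒0≤y-x (begin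
        1# - l               ≈⟨ x≈1*x q*w≈1 ⟩
        (q * w) * (1# - l)   ≈⟨ *-assoc _ _ _ ⟩
        q * (w * (1# - l))   ≤⟨ *-monoˡ-≤ (<⇒≤ 0<q) (SupExp⇒*[1-x]≤1 0≤l l<1 l↦w) ⟩
        q * 1#               ≈⟨ *-identityʳ q ⟩
        1# - ι ∎))
      (solve 2 (λ i l → l := i :+ ((:1 :- i) :- (:1 :- l))) refl ι l))

    q*l≤ι : q * l ≤ ι
    q*l≤ι = ≤-by (x≤y⇒0≤y-x (begin
        q * (1# + l)         ≤⟨ *-monoˡ-≤ (<⇒≤ 0<q) (SupExp⇒1+x≤ l↦w) ⟩
        q * w                ≈⟨ q*w≈1 ⟩
        1# ∎))
      (solve 2 (λ i l → i := (:1 :- i) :* l :+ (:1 :- (:1 :- i) :* (:1 :+ l))) refl ι l)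

  -- rate and base stand for d ln(d/(d-1)) and (d/(d-1))^d, which are close
  -- to 1 and to Euler's number.
  rate base : Carrier
  rate = D * l
  base = w ^ d

  0≤rate : 0# ≤ rate
  0≤rate = *-nonneg (<⇒≤ 0<d) 0≤l

  SupExp-rate : SupExp rate base
  SupExp-rate = SupExp-· d 0≤l l↦w

  0<base : 0# < base
  0<base = ^-pos d 0<w

  q^d*base≈1 : q ^ d * base ≈ 1#
  q^d*base≈1 = trans (sym (^-distrib-* q w d)) (trans (^-congˡ d q*w≈1) (1^k≈1 d))

  1≤rate : 1# ≤ rate
  1≤rate = begin
    1#     ≈⟨ trans (sym ι*d≈1) (*-comm _ _) ⟩
    D * ι  ≤⟨ *-monoˡ-≤ (<⇒≤ 0<d) ι≤l ⟩
    D * l ∎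

  -- Multiplying q l ≤ ι by d gives (d - 1) l ≤ 1, that is rate ≤ d/(d - 1), here with the
  -- denominator cleared.
  [rate-1]*[d-1]≤1 : (rate - 1#) * (D - 1#) ≤ 1#
  [rate-1]*[d-1]≤1 = ≤-by (*-nonneg (0≤x*x D) (x≤y⇒0≤y-x q*l≤ι)) (begin-equality
      1#   ≈⟨ solve 2 (λ d l → :1 := (d :* l :- :1) :* (d :- :1) :+ (d :* :1 :- d :* l :* (d :- :1))) refl D l ⟩
      (D * l - 1#) * (D - 1#) + (D * 1# - D * l * (D - 1#))
        ≈⟨ +-congˡ (+-cong (*-congˡ (sym ι*d≈1)) (-‿cong (*-congˡ (+-congˡ (-‿cong (sym ι*d≈1)))))) ⟩
      (D * l - 1#) * (D - 1#) + (D * (ι * D) - D * l * (D - ι * D))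
        ≈⟨ +-congˡ (solve 3 (λ d l i → d :* (i :* d) :- d :* l :* (d :- i :* d) := d :* d :* (i :- (:1 :- i) :* l)) refl D l ι) ⟩
      (D * l - 1#) * (D - 1#) + D * D * (ι - q * l) ∎)

  private
    0≤rate-1 : 0# ≤ rate - 1#
    0≤rate-1 = x≤y⇒0≤y-x 1≤rate

    rate≤2 : rate ≤ fromℕ 2
    rate≤2 = begin
      rate                     ≈⟨ solve 1 (λ r → r := :1 :+ (r :- :1) :* :1) refl rate ⟩
      1# + (rate - 1#) * 1#    ≤⟨ +-monoʳ-≤ (*-monoˡ-≤ 0≤rate-1
          (≤-by (x≤y⇒0≤y-x (fromℕ-mono-≤ {2} {d} 2≤d)) (solve 1 (λ d → d :- :1 := :1 :+ (d :- :2)) refl D))) ⟩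
      1# + (rate - 1#) * (D - 1#) ≤⟨ +-monoʳ-≤ [rate-1]*[d-1]≤1 ⟩
      1# + 1#                  ≈⟨ solve 0 (:1 :+ :1 := :2) refl ⟩
      fromℕ 2 ∎

  rate≤1+e/2 : ∀ {e} → 0# ≤ e → fromℕ 2 ≤ e * (D - 1#) → fromℕ 2 * (rate - 1#) ≤ e
  rate≤1+e/2 {e} 0≤e 2≤ = begin
    fromℕ 2 * (rate - 1#)        ≤⟨ *-monoʳ-≤ 0≤rate-1 2≤ ⟩
    e * (D - 1#) * (rate - 1#)   ≈⟨ solve 3 (λ e d r → e :* d :* r := e :* (r :* d)) refl e (D - 1#) (rate - 1#) ⟩
    e * ((rate - 1#) * (D - 1#)) ≤⟨ *-monoˡ-≤ 0≤e [rate-1]*[d-1]≤1 ⟩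
    e * 1#                       ≈⟨ *-identityʳ e ⟩
    e ∎

  -- Since rate ≤ 2 ≤ 4 ln 2, its exponential is at most 2⁴. An absolute constant is enough, because
  -- `base` only multiplies the error θ.
  base≤16 : base ≤ fromℕ 16
  base≤16 = ≤-trans (SupExp-mono-≤ 0≤rate (begin
      rate                        ≤⟨ rate≤2 ⟩
      fromℕ 2                     ≈⟨ sym (*-identityʳ _) ⟩
      fromℕ 2 * 1#                ≤⟨ *-monoˡ-≤ (0≤fromℕ 2) 1≤2ln2 ⟩
      fromℕ 2 * (fromℕ 2 * lnℕ 2) ≈⟨ solve 1 (λ l → :2 :* (:2 :* l) := con (+ 4) :* l) refl (lnℕ 2) ⟩
      fromℕ 4 * lnℕ 2 ∎) SupExp-rate (SupExp-· 4 (<⇒≤ 0<ln2) SupExp-ln2))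
    (≤-reflexive (solve 0 (:2 :* (:2 :* (:2 :* (:2 :* :1))) := con (+ 16)) refl))

  private
    p = q ^ d

    0≤p : 0# ≤ p
    0≤p = ^-nonneg d 0≤q

  2p≤1 : fromℕ 2 * p ≤ 1#
  2p≤1 = begin
    fromℕ 2 * p  ≤⟨ *-monoʳ-≤ 0≤p (≤-trans (≤-by (x≤y⇒0≤y-x 1≤rate)
                      (solve 1 (λ r → :1 :+ r := :2 :+ (r :- :1)) refl rate)) (SupExp⇒1+x≤ SupExp-rate)) ⟩
    base * p     ≈⟨ trans (*-comm _ _) q^d*base≈1 ⟩
    1# ∎

  -- The main term p times `base` is 1; with 1 - p ≤ 1 and base ≤ 16 the error 3θ becomes 48θ, the
  -- origin of the constant 48.
  late-ratio : ∀ {θ} → 0# ≤ θ → (p + (1# - p) * (fromℕ 2 * θ + θ)) * base ≤ 1# + fromℕ 48 * θ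
  late-ratio {θ} 0≤θ = begin
    (p + (1# - p) * (fromℕ 2 * θ + θ)) * base
      ≤⟨ ≤-by (*-nonneg (*-nonneg 0≤p (*-nonneg (0≤fromℕ 3) 0≤θ)) (<⇒≤ 0<base))
           (solve 3 (λ p t b → p :* b :+ :3 :* t :* b := (p :+ (:1 :- p) :* (:2 :* t :+ t)) :* b :+ p :* (:3 :* t) :* b) refl p θ base) ⟩
    p * base + fromℕ 3 * θ * base
      ≤⟨ +-mono-≤ (≤-reflexive q^d*base≈1) (*-monoˡ-≤ (*-nonneg (0≤fromℕ 3) 0≤θ) base≤16) ⟩
    1# + fromℕ 3 * θ * fromℕ 16
      ≈⟨ solve 1 (λ t → :1 :+ :3 :* t :* con (+ 16) := :1 :+ con (+ 48) :* t) refl θ ⟩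
    1# + fromℕ 48 * θ ∎

  -- The bracket is 1 - θ, the cut-off 2θ exceeding the spectral error by θ, and p ≤ 1/2 preserves
  -- at least half of this gain.
  middle-ratio : ∀ {θ} → 0# ≤ θ → p + (1# - p) * ((1# - fromℕ 2 * θ) + θ) ≤ 1# - half * θ
  middle-ratio {θ} 0≤θ = begin
    p + (1# - p) * ((1# - fromℕ 2 * θ) + θ)
      ≈⟨ solve 2 (λ p t → p :+ (:1 :- p) :* ((:1 :- :2 :* t) :+ t) := :1 :- (:1 :- :1 :* p) :* t) refl p θ ⟩
    1# - (1# - 1# * p) * θ
      ≈⟨ +-congˡ (-‿cong (*-congʳ (+-congˡ (-‿cong (*-congʳ (sym half*2≈1)))))) ⟩
    1# - (1# - half * fromℕ 2 * p) * θ
      ≤⟨ +-monoʳ-≤ (neg-anti-≤ (*-monoʳ-≤ 0≤θ half≤)) ⟩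
    1# - half * θ ∎
    where
    half≤ : half ≤ 1# - half * fromℕ 2 * p
    half≤ = begin
      half                       ≤⟨ ≤-by (*-nonneg 0≤half (x≤y⇒0≤y-x 2p≤1))
          (solve 2 (λ h p → h :* :2 :- h :* :2 :* p := h :+ h :* (:1 :- :2 :* p)) refl half p) ⟩
      half * fromℕ 2 - half * fromℕ 2 * p ≈⟨ +-congʳ half*2≈1 ⟩
      1# - half * fromℕ 2 * p ∎

-- Choice of the parameters and concentration

module Concentration {c ℓ₁ ℓ₂} (ℝ : Reals c ℓ₁ ℓ₂) where
  open Reals ℝ hiding (zero; _∨_)
  open OrderedFieldProperties completeOrderedField
  open FiniteExpectation completeOrderedField
  open ExponentialProperties completeOrderedField
  open Logarithms ℝ
  open ≤-Reasoning

  private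
    l₂ = lnℕ 2
    r₂ = recip (lnℕ 2) 0<ln2

  -- e is the accuracy, θ bounds λ/d, 1/A = 2θ is the fraction of informed
  -- (respectively uninformed) vertices at which the phases change, 1/K
  -- bounds each failure probability, and b is the length of the middle phase.
  record Parameters (ε δ : Carrier) : Set (c ⊔ ℓ₁ ⊔ ℓ₂) where
    field
      e       : Carrier
      0<e     : 0# < e
      e≤1     : e ≤ 1#
      3e≤ε    : fromℕ 3 * e ≤ ε
      A       : ℕ
      1≤A     : 1 ℕ.≤ A
      θ       : Carrier
      0<θ     : 0# < θ
      2θA≈1   : (fromℕ 2 * θ) * fromℕ A ≈ 1#
      θ-small : fromℕ 48 * θ * (r₂ + e + 1#) ≤ half * (e * l₂)
      k       : ℕ
    K : ℕ
    K = suc (suc k)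
    field
      4≤δK    : fromℕ 4 ≤ δ * fromℕ K
      b       : ℕ
      b-large : fromℕ K * fromℕ A ≤ 1# + fromℕ b * (half * θ)

    g : Carrier
    g = half * (e * l₂)

    0<g : 0# < g
    0<g = *-pos 0<half (*-pos 0<e 0<ln2)

    threshold : Carrier
    threshold = (lnℕ K + l₂) + (fromℕ b + fromℕ 5)

  parameters : ∀ ε δ → 0# < ε → 0# < δ → Parameters ε δ
  parameters ε δ 0<ε 0<δ = record
    { e = e ; 0<e = 0<e ; e≤1 = e≤1 ; 3e≤ε = 3e≤ε ; A = A ; 1≤A = ℕ.s≤s ℕ.z≤n ; θ = θ ; 0<θ = 0<θ
    ; 2θA≈1 = 2θA≈1 ; θ-small = θ-small ; k = k ; 4≤δK = 4≤δK ; b = proj₁ b-ratio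
    ; b-large = ≤-trans (proj₂ b-ratio) (≤-by 0≤1 (trans (+-congˡ (*-comm _ _)) (+-comm _ _))) }
    where
    -- The quotient ε/(3(1 + ε)) lies below both ε/3 and 1, so it stands in for their minimum.
    Z = fromℕ 3 * (1# + ε)
    0<1+ε : 0# < 1# + ε
    0<1+ε = +-pos 0<1 (<⇒≤ 0<ε)
    0<Z : 0# < Z
    0<Z = *-pos (0<fromℕ 2) 0<1+ε
    e = ε * recip Z 0<Z
    0<e : 0# < e
    0<e = *-pos 0<ε (0<recip 0<Z)
    eZ≈ε : e * Z ≈ ε
    eZ≈ε = trans (*-assoc _ _ _) (trans (*-congˡ (trans (*-comm _ _) (*-recip 0<Z))) (*-identityʳ ε))
    3e≤ε : fromℕ 3 * e ≤ ε
    3e≤ε = ≤-by (*-nonneg (*-nonneg (0≤fromℕ 3) (<⇒≤ 0<e)) (<⇒≤ 0<ε))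
      (trans (sym eZ≈ε) (solve 2 (λ e x → e :* (:3 :* (:1 :+ x)) := :3 :* e :+ :3 :* e :* x) refl e ε))
    e≤1 : e ≤ 1#
    e≤1 = *-cancelˡ-≤ 0<1+ε (≤-by (+-nonneg 0≤1 (*-nonneg (*-nonneg (0≤fromℕ 2) (<⇒≤ 0<e)) (<⇒≤ 0<1+ε)))
      (trans (*-congʳ (+-congˡ (sym eZ≈ε)))
        (solve 2 (λ e x → (:1 :+ e :* (:3 :* (:1 :+ x))) :* :1 := (:1 :+ x) :* e :+ (:1 :+ :2 :* e :* (:1 :+ x))) refl e ε)))
    g = half * (e * l₂)
    0<g : 0# < g
    0<g = *-pos 0<half (*-pos 0<e 0<ln2)
    Y = fromℕ 48 * (r₂ + e + 1#)
    A-ratio = archimedeanRatio Y 0<g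
    -- The ratio makes Y ≤ g A, hence θ Y ≤ g as θ = 1/(2A); the successor makes `A` positive and
    -- thus invertible.
    A = suc (proj₁ A-ratio)
    θ = half * recip (fromℕ A) (0<fromℕ (proj₁ A-ratio))
    0<θ : 0# < θ
    0<θ = *-pos 0<half (0<recip (0<fromℕ (proj₁ A-ratio)))
    2θA≈1 : (fromℕ 2 * θ) * fromℕ A ≈ 1#
    2θA≈1 = begin-equality
      (fromℕ 2 * (half * r)) * fromℕ A   ≈⟨ solve 4 (λ t h r a → (t :* (h :* r)) :* a := (h :* t) :* (a :* r)) refl (fromℕ 2) half r (fromℕ A) ⟩
      (half * fromℕ 2) * (fromℕ A * r)   ≈⟨ *-cong half*2≈1 (*-recip (0<fromℕ (proj₁ A-ratio))) ⟩
      1# * 1#                            ≈⟨ *-identityˡ 1# ⟩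
      1# ∎
      where r = recip (fromℕ A) (0<fromℕ (proj₁ A-ratio))
    θ-small : fromℕ 48 * θ * (r₂ + e + 1#) ≤ g
    θ-small = begin
      fromℕ 48 * θ * (r₂ + e + 1#)       ≈⟨ solve 3 (λ c t y → c :* t :* y := t :* (c :* y)) refl (fromℕ 48) θ (r₂ + e + 1#) ⟩
      θ * Y                              ≤⟨ *-monoˡ-≤ (<⇒≤ 0<θ) (proj₂ A-ratio) ⟩
      θ * (g * fromℕ (proj₁ A-ratio))
        ≤⟨ ≤-by (+-nonneg (*-nonneg (<⇒≤ 0<θ) (<⇒≤ 0<g)) (*-nonneg (<⇒≤ 0<θ) (*-nonneg (<⇒≤ 0<g) (0≤fromℕ A))))
             (solve 3 (λ t g a → ((:2 :* t) :* (:1 :+ a)) :* g := t :* (g :* a) :+ (t :* g :+ t :* (g :* (:1 :+ a)))) refl θ g (fromℕ (proj₁ A-ratio))) ⟩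
      ((fromℕ 2 * θ) * fromℕ A) * g      ≈⟨ trans (*-congʳ 2θA≈1) (*-identityˡ g) ⟩
      g ∎
    -- There are four failure terms of 1/K each: one for finishing too early and three for the
    -- phases of the upper bound.
    k-ratio = archimedeanRatio (fromℕ 4) 0<δ
    k = proj₁ k-ratio
    4≤δK : fromℕ 4 ≤ δ * fromℕ (suc (suc k))
    4≤δK = ≤-trans (proj₂ k-ratio) (*-monoˡ-≤ (<⇒≤ 0<δ) (fromℕ-mono-≤ {k} {suc (suc k)} (ℕ.m≤n+m k 2)))
    b-ratio = archimedeanRatio (fromℕ (suc (suc k)) * fromℕ A) (*-pos 0<half 0<θ)

  module _ {ε δ : Carrier} (par : Parameters ε δ) {m} (G : Graph (suc m)) (d : ℕ) (lam : Carrier)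
    (ndλ : IsNdλGraph ℝ G d lam) (2≤n : 2 ℕ.≤ suc m) (2≤d : 2 ℕ.≤ d)
    (lam≤θd : lam ≤ Parameters.θ par * fromℕ d)
    (d-large : fromℕ 2 ≤ Parameters.e par * (fromℕ d - 1#))
    (n-large : Parameters.threshold par ≤ Parameters.g par * lnℕ (suc m)) where
    open Parameters par

    private
      n = suc m
      N = fromℕ n
      D = fromℕ d
      L = lnℕ n
      lk = lnℕ K
      η = fromℕ 48 * θ
      κ = fromℕ 2 * θ

      0≤θ = <⇒≤ 0<θ

      κ≤1 : κ ≤ 1#
      κ≤1 = begin
        κ             ≈⟨ trans (sym (*-identityʳ κ)) (*-congˡ (sym fromℕ-1)) ⟩
        κ * fromℕ 1   ≤⟨ *-monoˡ-≤ (*-nonneg (0≤fromℕ 2) 0≤θ) (fromℕ-mono-≤ {1} {A} 1≤A) ⟩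
        κ * fromℕ A   ≈⟨ 2θA≈1 ⟩
        1# ∎

      θ<1 : θ < 1#
      θ<1 = <-≤-trans (<-by 0<θ (solve 1 (λ t → :2 :* t := t :+ t) refl θ)) κ≤1

      lam<d : lam < D
      lam<d = ≤-<-trans lam≤θd (begin-strict
        θ * D    ≈⟨ *-comm _ _ ⟩
        D * θ    <⟨ *-monoˡ-< (<-trans 0<1 (fromℕ>1 2≤d)) θ<1 ⟩
        D * 1#   ≈⟨ *-identityʳ D ⟩
        D ∎)

    open PowerBounds completeOrderedField d 2≤d
    open DegreeEstimates ℝ d 2≤d
    open PushRound ℝ G d (IsNdλGraph.regular ndλ) 2≤d
    open Histories ℝ G d (IsNdλGraph.regular ndλ) 2≤d
    open PushDrift ℝ G d lam ndλ lam<d 2≤d θ 0≤θ (<⇒≤ θ<1) lam≤θd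
    open BroadcastProbability ℝ G d (IsNdλGraph.regular ndλ) 2≤d
    open PushModel G using (_BroadcastTime_is_)

    private
      0≤L : 0# ≤ L
      0≤L = 0≤lnℕ n 2≤n

      L↦N : SupExp L N
      L↦N = SupExp-lnℕ n 2≤n

      2≤K : 2 ℕ.≤ K
      2≤K = ℕ.s≤s (ℕ.s≤s ℕ.z≤n)

      0≤lk : 0# ≤ lk
      0≤lk = 0≤lnℕ K 2≤K

      lk↦K : SupExp lk (fromℕ K)
      lk↦K = SupExp-lnℕ K 2≤K

      0≤l₂ = <⇒≤ 0<ln2
      0≤e = <⇒≤ 0<e

      half≤1 : half ≤ 1#
      half≤1 = ≤-by 0≤half (trans (sym half*2≈1) (solve 1 (λ h → h :* :2 := h :+ h) refl half))

      g≤half*e : g ≤ half * (e * 1#)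
      g≤half*e = *-monoˡ-≤ 0≤half (*-monoˡ-≤ 0≤e ln2≤1)

      half*e≤e : half * (e * 1#) ≤ e
      half*e≤e = ≤-trans (*-monoʳ-≤ (*-nonneg 0≤e 0≤1) half≤1) (≤-reflexive (trans (*-identityˡ _) (*-identityʳ e)))

      lk+l₂≤gL : lk + l₂ ≤ g * L
      lk+l₂≤gL = ≤-trans (≤-by (+-nonneg (0≤fromℕ b) (0≤fromℕ 5)) refl) n-large

      b+5≤gL : fromℕ b + fromℕ 5 ≤ g * L
      b+5≤gL = ≤-trans (≤-by (+-nonneg 0≤lk 0≤l₂) (+-comm _ _)) n-large

      b+5≤eL : fromℕ b + fromℕ 5 ≤ e * L
      b+5≤eL = ≤-trans b+5≤gL (*-monoʳ-≤ 0≤L (≤-trans g≤half*e half*e≤e))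

      lk≤gL : lk ≤ g * L
      lk≤gL = ≤-trans (≤-by 0≤l₂ refl) lk+l₂≤gL

      gL≤half*e*L : g * L ≤ half * (e * 1#) * L
      gL≤half*e*L = *-monoʳ-≤ 0≤L g≤half*e

      2≤L : fromℕ 2 ≤ L
      2≤L = begin
        fromℕ 2             ≤⟨ ≤-by (+-nonneg (0≤fromℕ b) (0≤fromℕ 3)) (solve 1 (λ b → b :+ con (+ 5) := :2 :+ (b :+ :3)) refl (fromℕ b)) ⟩
        fromℕ b + fromℕ 5   ≤⟨ b+5≤eL ⟩
        e * L               ≤⟨ *-monoʳ-≤ 0≤L e≤1 ⟩
        1# * L              ≈⟨ *-identityˡ L ⟩
        L ∎

      0<η : 0# < η
      0<η = *-pos (0<fromℕ 47) 0<θ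

      l₂*r₂≈1 : l₂ * r₂ ≈ 1#
      l₂*r₂≈1 = *-recip 0<ln2

      0≤r₂ : 0# ≤ r₂
      0≤r₂ = <⇒≤ (0<recip 0<ln2)

      1≤r₂ : 1# ≤ r₂
      1≤r₂ = begin
        1#         ≈⟨ sym l₂*r₂≈1 ⟩
        l₂ * r₂    ≤⟨ *-monoʳ-≤ 0≤r₂ ln2≤1 ⟩
        1# * r₂    ≈⟨ *-identityˡ r₂ ⟩
        r₂ ∎

      θ-small′ : η * (1# + e + 1#) ≤ half * (e * 1#)
      θ-small′ = begin
        η * (1# + e + 1#)   ≤⟨ *-monoˡ-≤ (<⇒≤ 0<η) (+-mono-≤ (+-mono-≤ 1≤r₂ ≤-refl) ≤-refl) ⟩
        η * (r₂ + e + 1#)   ≤⟨ θ-small ⟩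
        g                   ≤⟨ g≤half*e ⟩
        half * (e * 1#) ∎

      -- As `r₂` is 1/ln 2, L r₂ is log₂ n. The doubling and final phases get e ln n extra rounds,
      -- and the avoidance period of the lower bound is shortened by e ln n.
      a-ceiling = approximateCeiling (+-nonneg (*-nonneg 0≤L 0≤r₂) (*-nonneg 0≤e 0≤L))
      c-ceiling = approximateCeiling (+-nonneg (*-nonneg 0≤L 0≤1) (*-nonneg 0≤e 0≤L))
      R-floor = approximateFloor (*-nonneg (x≤y⇒0≤y-x e≤1) 0≤L)
      -- Subtracting 1 secures 2 · 2^t₀ ≤ n, so half of the vertices remain uninformed.
      t₀-floor = approximateFloor {L * r₂ - 1#} (x≤y⇒0≤y-x (begin
        1#       ≤⟨ ≤-by 0≤1 (solve 0 (:2 := :1 :+ :1) refl) ⟩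
        fromℕ 2  ≤⟨ 2≤L ⟩
        L        ≈⟨ sym (*-identityʳ L) ⟩
        L * 1#   ≤⟨ *-monoˡ-≤ 0≤L 1≤r₂ ⟩
        L * r₂ ∎))

      a = proj₁ a-ceiling
      c′ = proj₁ c-ceiling
      R = proj₁ R-floor
      t₀ = proj₁ t₀-floor

    private
      size-singleton : ∀ v → size (singleton v) ≈ 1#
      size-singleton v = trans (sum-cong-≋ (λ u → sym (*-identityˡ (𝟙 (singleton v u))))) (∑-δ (λ _ → 1#) v)

    -- The first `t₀` rounds leave half of the vertices uninformed whatever is chosen. From each
    -- such state, the expected number of vertices avoided for `R` more rounds is at least K, and
    -- `P-full≤` applies.
    early-small : ∀ v → fromℕ K * after (t₀ ℕ.+ R) (λ S → 𝟙 (full S)) (singleton v) ≤ 1#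
    early-small v = begin
      fromℕ K * after (t₀ ℕ.+ R) f S₀         ≈⟨ *-congˡ (after-+ t₀ R f S₀) ⟩
      fromℕ K * after t₀ (after R f) S₀       ≈⟨ sym (𝔼-*ˡ (historyE t₀) (fromℕ K) _) ⟩
      𝔼 (historyE t₀) (λ w → fromℕ K * after R f (run step S₀ w))
        ≤⟨ 𝔼-mono (historyE t₀) (λ w → late w) ⟩
      𝔼 (historyE t₀) (λ _ → 1#)              ≈⟨ 𝔼-1 (historyE t₀) ⟩
      1# ∎
      where
      f : State n → Carrier
      f S = 𝟙 (full S)
      S₀ = singleton v
      P = p ^ R
      0≤P : 0# ≤ P
      0≤P = ^-nonneg R 0≤p

      2^[1+t₀]≤N : fromℕ 2 * fromℕ 2 ^ t₀ ≤ N
      2^[1+t₀]≤N = SupExp-mono-≤ (*-nonneg (0≤fromℕ (suc t₀)) 0≤l₂) (begin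
          fromℕ (suc t₀) * l₂             ≤⟨ *-monoʳ-≤ 0≤l₂ (+-monoʳ-≤ (proj₁ (proj₂ t₀-floor))) ⟩
          (1# + (L * r₂ - 1#)) * l₂       ≈⟨ solve 3 (λ L r l → (:1 :+ (L :* r :- :1)) :* l := L :* (l :* r)) refl L r₂ l₂ ⟩
          L * (l₂ * r₂)                   ≈⟨ trans (*-congˡ l₂*r₂≈1) (*-identityʳ L) ⟩
          L ∎)
        (SupExp-· (suc t₀) 0≤l₂ SupExp-ln2) L↦N

      -- With rate ≤ 1 + e/2 and R ≤ (1 - e)L, the product of the two is L(1 - e/2 - e²/2), leaving
      -- eL/2 to pay for ln(2K).
      2K*base^R≤N : (fromℕ 2 * fromℕ K) * base ^ R ≤ N
      2K*base^R≤N = SupExp-mono-≤ (+-nonneg (+-nonneg 0≤l₂ 0≤lk) (*-nonneg (0≤fromℕ R) 0≤rate)) (begin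
          l₂ + lk + fromℕ R * rate
            ≤⟨ +-mono-≤ (≤-trans (≤-reflexive (+-comm _ _)) (≤-trans lk+l₂≤gL gL≤half*e*L))
                 (*-mono-≤ (0≤fromℕ R) (proj₁ (proj₂ R-floor)) 0≤rate rate≤) ⟩
          half * (e * 1#) * L + (1# - e) * L * (1# + half * e)
            ≤⟨ ≤-by (*-nonneg (*-nonneg 0≤half (0≤x*x e)) 0≤L)
                 (solve 3 (λ h e L → L :+ (h :* :2) :* (e :* L) :- e :* L := (h :* (e :* :1) :* L :+ (:1 :- e) :* L :* (:1 :+ h :* e)) :+ h :* (e :* e) :* L) refl half e L) ⟩
          L + (half * fromℕ 2) * (e * L) - e * L
            ≈⟨ +-congʳ (+-congˡ (*-congʳ half*2≈1)) ⟩
          L + 1# * (e * L) - e * L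
            ≈⟨ solve 2 (λ L x → L :+ :1 :* x :- x := L) refl L (e * L) ⟩
          L ∎)
        (SupExp-+ (+-nonneg 0≤l₂ 0≤lk) (*-nonneg (0≤fromℕ R) 0≤rate) (SupExp-+ 0≤l₂ 0≤lk SupExp-ln2 lk↦K) (SupExp-· R 0≤rate SupExp-rate))
        L↦N
        where
        rate≤ : rate ≤ 1# + half * e
        rate≤ = begin
          rate                                     ≈⟨ solve 1 (λ r → r := :1 :+ :1 :* (r :- :1)) refl rate ⟩
          1# + 1# * (rate - 1#)                    ≈⟨ +-congˡ (trans (*-congʳ (sym half*2≈1)) (*-assoc _ _ _)) ⟩
          1# + half * (fromℕ 2 * (rate - 1#))      ≤⟨ +-monoʳ-≤ (*-monoˡ-≤ 0≤half (rate≤1+e/2 0≤e d-large)) ⟩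
          1# + half * e ∎

      2K≤P*N : fromℕ 2 * fromℕ K ≤ P * N
      2K≤P*N = begin
        fromℕ 2 * fromℕ K                    ≈⟨ x≈1*x P*base^R≈1 ⟩
        (P * base ^ R) * (fromℕ 2 * fromℕ K) ≈⟨ solve 3 (λ a b c → (a :* b) :* c := a :* (c :* b)) refl P (base ^ R) (fromℕ 2 * fromℕ K) ⟩
        P * ((fromℕ 2 * fromℕ K) * base ^ R) ≤⟨ *-monoˡ-≤ 0≤P 2K*base^R≤N ⟩
        P * N ∎
        where
        P*base^R≈1 : P * base ^ R ≈ 1#
        P*base^R≈1 = trans (sym (^-distrib-* p base R)) (trans (^-congˡ R q^d*base≈1) (1^k≈1 R))

      late : ∀ (w : Vec (Vec (Fin n) n) t₀) → fromℕ K * after R f (run step S₀ w) ≤ 1#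
      late w = begin
        fromℕ K * after R f S   ≤⟨ *-monoʳ-≤ 0≤after K≤M ⟩
        M * after R f S         ≤⟨ P-full≤ R S refl (<-≤-trans (0<fromℕ (suc k)) K≤M) ⟩
        1# ∎
        where
        S = run step S₀ w
        M = P * size (complement S)
        0≤after : 0# ≤ after R f S
        0≤after = ≤-trans (≤-reflexive (sym (𝔼-const (historyE R) 0#))) (𝔼-mono (historyE R) (λ w′ → 0≤𝟙 (full (run step S w′))))
        2s≤N : fromℕ 2 * size S ≤ N
        2s≤N = begin
          fromℕ 2 * size S                   ≤⟨ *-monoˡ-≤ (0≤fromℕ 2) (size-run≤ S₀ w) ⟩
          fromℕ 2 * (fromℕ 2 ^ t₀ * size S₀) ≈⟨ *-congˡ (trans (*-congˡ (size-singleton v)) (*-identityʳ _)) ⟩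
          fromℕ 2 * fromℕ 2 ^ t₀             ≤⟨ 2^[1+t₀]≤N ⟩
          N ∎
        K≤M : fromℕ K ≤ M
        K≤M = *-cancelˡ-≤ (0<fromℕ 1) (begin
          fromℕ 2 * fromℕ K                  ≤⟨ 2K≤P*N ⟩
          P * N
            ≤⟨ ≤-by (*-nonneg 0≤P (x≤y⇒0≤y-x 2s≤N))
                 (solve 3 (λ p n s → :2 :* (p :* (n :- s)) := p :* n :+ p :* (n :- :2 :* s)) refl P N (size S)) ⟩
          fromℕ 2 * (P * (N - size S))       ≈⟨ *-congˡ (*-congˡ (sym (size-complement S))) ⟩
          fromℕ 2 * M ∎)

    late-small : ∀ v → fromℕ K * after (a ℕ.+ (b ℕ.+ c′)) (λ S → 𝟙 (not (full S))) (singleton v) ≤ fromℕ 3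
    late-small v = begin
      fromℕ K * after (a ℕ.+ (b ℕ.+ c′)) (λ S → 𝟙 (not (full S))) (singleton v)
        ≤⟨ *-monoˡ-≤ (0≤fromℕ K) (P-notFull≤ A A 0≤κ κ≤1 2θA≈1 0≤κ 2θA≈1 a b c′ (singleton v) 1≤count) ⟩
      fromℕ K * (ρ₃ ^ c′ * N + (fromℕ A * ρ₂ ^ b + ρ₁ ^ a * N))
        ≈⟨ solve 5 (λ k x A y z → k :* (x :+ (A :* y :+ z)) := k :* x :+ (k :* A :* y :+ k :* z)) refl (fromℕ K) (ρ₃ ^ c′ * N) (fromℕ A) (ρ₂ ^ b) (ρ₁ ^ a * N) ⟩
      fromℕ K * (ρ₃ ^ c′ * N) + (fromℕ K * fromℕ A * ρ₂ ^ b + fromℕ K * (ρ₁ ^ a * N))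
        ≤⟨ +-mono-≤ third (+-mono-≤ second first) ⟩
      1# + (1# + 1#)
        ≈⟨ solve 0 (:1 :+ (:1 :+ :1) := :3) refl ⟩
      fromℕ 3 ∎
      where
      0≤κ : 0# ≤ κ
      0≤κ = *-nonneg (0≤fromℕ 2) 0≤θ
      ρ₁ = half * (1# + fromℕ 2 * (κ + θ))
      ρ₂ = p + (1# - p) * ((1# - κ) + θ)
      ρ₃ = p + (1# - p) * (κ + θ)
      0≤κ+θ = +-nonneg 0≤κ 0≤θ

      1≤count : 1 ℕ.≤ count (singleton v)
      1≤count = fromℕ-cancel-≤ {1} {count (singleton v)}
        (≤-reflexive (trans fromℕ-1 (trans (sym (size-singleton v)) (size-count (singleton v)))))

      first : fromℕ K * (ρ₁ ^ a * N) ≤ 1#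
      first = power-small a (0≤fromℕ n) (0≤fromℕ K) (0<fromℕ 1)
        (*-nonneg 0≤half (+-nonneg 0≤1 (*-nonneg (0≤fromℕ 2) 0≤κ+θ)))
        (begin
          half * (1# + fromℕ 2 * (κ + θ)) * fromℕ 2
            ≈⟨ solve 2 (λ h t → h :* (:1 :+ :2 :* (:2 :* t :+ t)) :* :2 := (h :* :2) :* (:1 :+ con (+ 6) :* t)) refl half θ ⟩
          (half * fromℕ 2) * (1# + fromℕ 6 * θ)   ≈⟨ trans (*-congʳ half*2≈1) (*-identityˡ _) ⟩
          -- Rounding 6θ up to 48θ lets the doubling and the final phase share one η.
          1# + fromℕ 6 * θ                        ≤⟨ +-monoʳ-≤ (*-monoʳ-≤ 0≤θ (fromℕ-mono-≤ {6} {48} (ℕ.m≤m+n 6 42))) ⟩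
          1# + η ∎)
        (power-compare a 0≤L L↦N 0≤lk lk↦K 0<η 0≤l₂ SupExp-ln2
          (enough-rounds a l₂*r₂≈1 0≤l₂ (<⇒≤ 0<η) 2≤L θ-small lk≤gL (proj₁ (proj₂ a-ceiling)) (proj₂ (proj₂ a-ceiling))))

      second : fromℕ K * fromℕ A * ρ₂ ^ b ≤ 1#
      second = geometric-small b (*-nonneg 0≤half 0≤θ)
        (+-nonneg 0≤p (*-nonneg 0≤1-p (+-nonneg (x≤y⇒0≤y-x κ≤1) 0≤θ)))
        (middle-ratio 0≤θ) (*-nonneg (0≤fromℕ K) (0≤fromℕ A)) b-large

      third : fromℕ K * (ρ₃ ^ c′ * N) ≤ 1#
      third = power-small c′ (0≤fromℕ n) (0≤fromℕ K) 0<base (+-nonneg 0≤p (*-nonneg 0≤1-p 0≤κ+θ))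
        (late-ratio 0≤θ)
        (power-compare c′ 0≤L L↦N 0≤lk lk↦K 0<η 0≤rate SupExp-rate
          -- The rounds are budgeted for a gain of 1 each; the true gain `rate` is at least 1.
          (≤-trans (enough-rounds c′ (*-identityˡ 1#) 0≤1 (<⇒≤ 0<η) 2≤L θ-small′ (≤-trans lk≤gL gL≤half*e*L)
              (proj₁ (proj₂ c-ceiling)) (proj₂ (proj₂ c-ceiling)))
            (*-monoˡ-≤ (0≤fromℕ c′) 1≤rate)))

    private
      Λ = L * r₂

      t₀+R≤a+b+c : t₀ ℕ.+ R ℕ.≤ a ℕ.+ (b ℕ.+ c′)
      t₀+R≤a+b+c = ℕ.+-mono-≤
        (fromℕ-cancel-≤ {t₀} {a} (begin
          fromℕ t₀         ≤⟨ proj₁ (proj₂ t₀-floor) ⟩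
          Λ - 1#           ≤⟨ ≤-by (+-nonneg 0≤1 (*-nonneg 0≤e 0≤L)) (solve 2 (λ l x → l :+ x := (l :- :1) :+ (:1 :+ x)) refl Λ (e * L)) ⟩
          Λ + e * L        ≤⟨ proj₁ (proj₂ a-ceiling) ⟩
          fromℕ a ∎))
        (ℕ.≤-trans (fromℕ-cancel-≤ {R} {c′} (begin
          fromℕ R          ≤⟨ proj₁ (proj₂ R-floor) ⟩
          (1# - e) * L     ≤⟨ ≤-by (*-nonneg (*-nonneg (0≤fromℕ 2) 0≤e) 0≤L) (solve 2 (λ e L → L :* :1 :+ e :* L := (:1 :- e) :* L :+ :2 :* e :* L) refl e L) ⟩
          L * 1# + e * L   ≤⟨ proj₁ (proj₂ c-ceiling) ⟩
          fromℕ c′ ∎)) (ℕ.m≤n+m c′ b))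

      3eL≤εL : fromℕ 3 * e * L ≤ ε * L
      3eL≤εL = *-monoʳ-≤ 0≤L 3e≤ε

    -- Above, the deviation is at most 2eL + b + 4, from two extended phases, the middle phase and
    -- two roundings; below, it is at most eL + 5. Since b + 5 ≤ eL, both stay within 3eL.
    close : ∀ r → t₀ ℕ.+ R ℕ.≤ r → r ℕ.≤ a ℕ.+ (b ℕ.+ c′) → ∣ fromℕ r - (log₂ℕ n + lnℕ n) ∣ ≤ ε * lnℕ n
    close r lower upper = ∨-least
      (≤-trans (≤-by (+-nonneg (+-nonneg (x≤y⇒0≤y-x r≤) (x≤y⇒0≤y-x b+5≤eL)) 0≤1)
        (solve 5 (λ r l L e b → :3 :* e :* L := (r :- (l :+ L)) :+ (((((l :+ e :* L) :+ :2) :+ (b :+ ((L :* :1 :+ e :* L) :+ :2))) :- r) :+ ((e :* L) :- (b :+ con (+ 5))) :+ :1)) refl (fromℕ r) Λ L e (fromℕ b))) 3eL≤εL)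
      (≤-trans (≤-by (+-nonneg (+-nonneg (x≤y⇒0≤y-x ≤r) (x≤y⇒0≤y-x b+5≤eL)) (+-nonneg (0≤fromℕ b) (*-nonneg 0≤e 0≤L)))
        (solve 5 (λ r l L e b → :3 :* e :* L := (:- (r :- (l :+ L))) :+ (((r :- ((l :- :1 :- :2) :+ ((:1 :- e) :* L :- :2))) :+ ((e :* L) :- (b :+ con (+ 5)))) :+ (b :+ e :* L))) refl (fromℕ r) Λ L e (fromℕ b))) 3eL≤εL)
      where
      r≤ : fromℕ r ≤ ((Λ + e * L) + fromℕ 2) + (fromℕ b + ((L * 1# + e * L) + fromℕ 2))
      r≤ = begin
        fromℕ r                       ≤⟨ fromℕ-mono-≤ upper ⟩
        fromℕ (a ℕ.+ (b ℕ.+ c′))      ≈⟨ trans (fromℕ-+ a (b ℕ.+ c′)) (+-congˡ (fromℕ-+ b c′)) ⟩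
        fromℕ a + (fromℕ b + fromℕ c′) ≤⟨ +-mono-≤ (proj₂ (proj₂ a-ceiling)) (+-monoʳ-≤ (proj₂ (proj₂ c-ceiling))) ⟩
        ((Λ + e * L) + fromℕ 2) + (fromℕ b + ((L * 1# + e * L) + fromℕ 2)) ∎
      move : ∀ {x y z} → x ≤ y + z → x - z ≤ y
      move {x} {y} {z} x≤ = ≤-by (x≤y⇒0≤y-x x≤) (solve 3 (λ x y z → y := (x :- z) :+ ((y :+ z) :- x)) refl x y z)
      ≤r : (Λ - 1# - fromℕ 2) + ((1# - e) * L - fromℕ 2) ≤ fromℕ r
      ≤r = begin
        (Λ - 1# - fromℕ 2) + ((1# - e) * L - fromℕ 2)
          ≤⟨ +-mono-≤ (move (proj₂ (proj₂ t₀-floor))) (move (proj₂ (proj₂ R-floor))) ⟩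
        fromℕ t₀ + fromℕ R      ≈⟨ sym (fromℕ-+ t₀ R) ⟩
        fromℕ (t₀ ℕ.+ R)        ≤⟨ fromℕ-mono-≤ lower ⟩
        fromℕ r ∎

    concentration : ∀ v → Prob≥ ℝ G (1# - δ) (λ ω →
      ∃[ t ] (v BroadcastTime ω is t × ∣ fromℕ t - (log₂ℕ n + lnℕ n) ∣ ≤ ε * lnℕ n))
    concentration v = broadcastTime-Prob≥ v t₀+R≤a+b+c ≤-refl ≤-refl
      (*-cancelˡ-≤ (0<fromℕ (suc k)) (begin
        fromℕ K * (x + y)              ≈⟨ distribˡ _ _ _ ⟩
        fromℕ K * x + fromℕ K * y      ≤⟨ +-mono-≤ (early-small v) (late-small v) ⟩
        1# + fromℕ 3                   ≤⟨ 4≤δK ⟩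
        δ * fromℕ K                    ≈⟨ *-comm _ _ ⟩
        fromℕ K * δ ∎))
      _ (λ ω r isTime lower upper → r , isTime , close r lower upper)
      where
      x = after (t₀ ℕ.+ R) (λ S → 𝟙 (full S)) (singleton v)
      y = after (a ℕ.+ (b ℕ.+ c′)) (λ S → 𝟙 (not (full S))) (singleton v)

-- Size of the degree

module DegreeBounds {c ℓ₁ ℓ₂} (ℝ : Reals c ℓ₁ ℓ₂) where
  open Reals ℝ hiding (zero)
  open OrderedFieldProperties completeOrderedField
  open ≤-Reasoning

  1≤root : ∀ k .{{_ : NonZero k}} {x} → 1# ≤ x → 1# ≤ root k x
  1≤root (suc k) {x} 1≤x z<1 = 1≤x (begin-strict
    x             ≈⟨ sym (root-^ (suc k) (≤-trans 0≤1 1≤x)) ⟩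
    z * z ^ k     ≤⟨ *-monoˡ-≤ 0≤z (x≤1⇒x^k≤1 k 0≤z (<⇒≤ z<1)) ⟩
    z * 1#        ≈⟨ *-identityʳ z ⟩
    z             <⟨ z<1 ⟩
    1# ∎)
    where
    z = root (suc k) x
    0≤z : 0# ≤ z
    0≤z = root-nonneg (suc k) (≤-trans 0≤1 1≤x)

  √*√ : ∀ {x} → 0# ≤ x → √ x * √ x ≈ x
  √*√ {x} 0≤x = trans (*-congˡ (sym (*-identityʳ _))) (root-^ 2 0≤x)

  -- Turns λ ≤ C√d into λ ≤ θd. Comparing the squares of C√d-free factors, C against θ√d, avoids
  -- dividing by a root.
  C√d≤θd : ∀ {C θ} d → 0# ≤ θ → C * C ≤ θ * θ * fromℕ d → C * √ (fromℕ d) ≤ θ * fromℕ d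
  C√d≤θd {C} {θ} d 0≤θ C²≤θ²d = begin
    C * y         ≤⟨ *-monoʳ-≤ 0≤y (x*x≤y*y⇒x≤y (*-nonneg 0≤θ 0≤y) (≤-trans C²≤θ²d (≤-reflexive (begin-equality
      θ * θ * fromℕ d     ≈⟨ *-congˡ (sym (√*√ (0≤fromℕ d))) ⟩
      θ * θ * (y * y)     ≈⟨ solve 2 (λ t y → t :* t :* (y :* y) := (t :* y) :* (t :* y)) refl θ y ⟩
      (θ * y) * (θ * y) ∎)))) ⟩
    θ * y * y     ≈⟨ *-assoc _ _ _ ⟩
    θ * (y * y)   ≈⟨ *-congˡ (√*√ (0≤fromℕ d)) ⟩
    θ * fromℕ d ∎
    where
    y = √ (fromℕ d)
    0≤y : 0# ≤ y
    0≤y = root-nonneg 2 (0≤fromℕ d)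

  -- Once ln n ≥ 1, its ninth root is at least 1, so the degree is at least 2C√n; squaring reduces
  -- the claim to D² ≤ (2C)² n.
  degree-large : ∀ {C} → 0# < C → ∀ D → Σ[ N ∈ ℕ ] (∀ m d → N ℕ.≤ suc m → 1# ≤ lnℕ (suc m) →
    fromℕ 2 * C * √ (fromℕ (suc m) * root 9 (lnℕ (suc m))) ≤ fromℕ d → D ℕ.≤ d)
  degree-large {C} 0<C D = proj₁ ratio , bound
    where
    2C = fromℕ 2 * C
    0<2C : 0# < 2C
    0<2C = *-pos (0<fromℕ 1) 0<C
    ratio = archimedeanRatio (fromℕ D * fromℕ D) (*-pos 0<2C 0<2C)
    bound : ∀ m d → proj₁ ratio ℕ.≤ suc m → 1# ≤ lnℕ (suc m) →
      2C * √ (fromℕ (suc m) * root 9 (lnℕ (suc m))) ≤ fromℕ d → D ℕ.≤ d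
    bound m d N≤n 1≤L 2Cz≤d = fromℕ-cancel-≤ {D} {d} (≤-trans (x*x≤y*y⇒x≤y (*-nonneg (<⇒≤ 0<2C) 0≤z) (begin
        fromℕ D * fromℕ D              ≤⟨ proj₂ ratio ⟩
        2C * 2C * fromℕ (proj₁ ratio)  ≤⟨ *-monoˡ-≤ (0≤x*x 2C) (fromℕ-mono-≤ N≤n) ⟩
        2C * 2C * fromℕ (suc m)        ≈⟨ *-congˡ (sym (*-identityʳ _)) ⟩
        2C * 2C * (fromℕ (suc m) * 1#) ≤⟨ *-monoˡ-≤ (0≤x*x 2C) (*-monoˡ-≤ (0≤fromℕ (suc m)) (1≤root 9 1≤L)) ⟩
        2C * 2C * y                    ≈⟨ *-congˡ (sym (√*√ 0≤y)) ⟩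
        2C * 2C * (z * z)              ≈⟨ solve 2 (λ c z → c :* c :* (z :* z) := (c :* z) :* (c :* z)) refl 2C z ⟩
        (2C * z) * (2C * z) ∎)) 2Cz≤d)
      where
      y = fromℕ (suc m) * root 9 (lnℕ (suc m))
      0≤y : 0# ≤ y
      0≤y = *-nonneg (0≤fromℕ (suc m)) (root-nonneg 9 (≤-trans 0≤1 1≤L))
      z = √ y
      0≤z : 0# ≤ z
      0≤z = root-nonneg 2 0≤y

-- Passage to all sufficiently large indices

theorem2 : ∀ {c ℓ₁ ℓ₂} (ℝ : Reals c ℓ₁ ℓ₂) → let open Reals ℝ in
    (C : Carrier) → 0# < C →
    (m : ℕ → ℕ) → let n = λ (i : ℕ) → suc (m i) in
    (G : ∀ i → Graph (n i)) (d : ℕ → ℕ) (lam : ℕ → Carrier) →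
    TendsToInfinity n →
    Eventually (λ i →
    Graph.Connected (G i)
    × IsNdλGraph ℝ (G i) (d i) (lam i)
    × lam i ≤ C * √ (fromℕ (d i))
    × fromℕ 2 * C * √ (fromℕ (n i) * root 9 (lnℕ (n i))) ≤ fromℕ (d i)) →
    ∀ ε δ → 0# < ε → 0# < δ →
    Eventually (λ i → ∀ v →
    Prob≥ ℝ (G i) (1# - δ) (λ ω →
    ∃[ t ] (PushModel._BroadcastTime_is_ (G i) v ω t
    × ∣ fromℕ t - (log₂ℕ (n i) + lnℕ (n i)) ∣ ≤ ε * lnℕ (n i))))
theorem2 ℝ C 0<C m G d lam n→∞ (I₀ , hypotheses) ε δ 0<ε 0<δ = I₀ ℕ.⊔ I₁ , λ i I≤i v →
  let (_ , ndλ , lam≤C√d , d≥) = hypotheses i (ℕ.≤-trans (ℕ.m≤m⊔n I₀ I₁) I≤i)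
      n≥  = n-large i (ℕ.≤-trans (ℕ.m≤n⊔m I₀ I₁) I≤i)
      y≤L = proj₂ (proj₂ unbounded) (m i) (ℕ.≤-trans (ℕ.m≤m⊔n Nₗ N-deg) n≥)
      D≤d = proj₂ degree (m i) (d i) (ℕ.≤-trans (ℕ.m≤n⊔m Nₗ N-deg) n≥) (≤-trans (≤-by 0≤y refl) y≤L) d≥
  in concentration par (G i) (d i) (lam i) ndλ
       (ℕ.≤-trans (proj₁ (proj₂ unbounded)) (ℕ.≤-trans (ℕ.m≤m⊔n Nₗ N-deg) n≥))
       (ℕ.≤-trans (ℕ.m≤n+m 2 (k₁ ℕ.+ k₂)) D≤d)
       (≤-trans lam≤C√d (C√d≤θd (d i) (<⇒≤ 0<θ) (C²≤ (d i) D≤d)))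
       (2≤e[d-1] (d i) D≤d)
       (threshold≤ y≤L)
       v
  where
  open Reals ℝ
  open OrderedFieldProperties completeOrderedField
  open Logarithms ℝ
  open DegreeBounds ℝ
  open Concentration ℝ
  open ≤-Reasoning
  par = parameters ε δ 0<ε 0<δ
  open Parameters par

  y = recip g 0<g * threshold

  0≤y : 0# ≤ y
  0≤y = *-nonneg (<⇒≤ (0<recip 0<g)) (+-nonneg (+-nonneg (0≤lnℕ K (ℕ.s≤s (ℕ.s≤s ℕ.z≤n))) (<⇒≤ 0<ln2))
          (+-nonneg (0≤fromℕ b) (0≤fromℕ 5)))

  -- The summand `y` puts g ln n above the threshold, and the 1 provides ln n ≥ 1 for
  -- `degree-large`.
  unbounded = lnℕ-unbounded (1# + y)
  Nₗ = proj₁ unbounded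

  k₁ = proj₁ (archimedeanRatio (C * C) (*-pos 0<θ 0<θ))
  k₂ = proj₁ (archimedeanRatio (fromℕ 2) 0<e)

  -- The sum serves as a maximum: `k₁` yields λ ≤ θd, `k₂` yields e(d - 1) ≥ 2, and 2 yields d ≥ 2.
  degree = degree-large 0<C (k₁ ℕ.+ k₂ ℕ.+ 2)
  N-deg = proj₁ degree

  I₁ = proj₁ (n→∞ (Nₗ ℕ.⊔ N-deg))
  n-large = proj₂ (n→∞ (Nₗ ℕ.⊔ N-deg))

  C²≤ : ∀ d → k₁ ℕ.+ k₂ ℕ.+ 2 ℕ.≤ d → C * C ≤ θ * θ * fromℕ d
  C²≤ d D≤d = ≤-trans (proj₂ (archimedeanRatio (C * C) (*-pos 0<θ 0<θ)))
    (*-monoˡ-≤ (0≤x*x θ) (fromℕ-mono-≤ {k₁} {d} (ℕ.≤-trans (ℕ.≤-trans (ℕ.m≤m+n k₁ k₂) (ℕ.m≤m+n (k₁ ℕ.+ k₂) 2)) D≤d)))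

  2≤e[d-1] : ∀ d → k₁ ℕ.+ k₂ ℕ.+ 2 ℕ.≤ d → fromℕ 2 ≤ e * (fromℕ d - 1#)
  2≤e[d-1] d D≤d = ≤-trans (proj₂ (archimedeanRatio (fromℕ 2) 0<e)) (*-monoˡ-≤ (<⇒≤ 0<e)
    (≤-by (x≤y⇒0≤y-x (fromℕ-mono-≤ {suc k₂} {d} (ℕ.≤-trans k₂<D D≤d)))
      (solve 2 (λ d k → d :- :1 := k :+ (d :- (:1 :+ k))) refl (fromℕ d) (fromℕ k₂))))
    where
    k₂<D : suc k₂ ℕ.≤ k₁ ℕ.+ k₂ ℕ.+ 2
    k₂<D = ℕ.≤-trans (ℕ.s≤s (ℕ.m≤n+m k₂ k₁)) (ℕ.≤-trans (ℕ.≤-reflexive (ℕ.+-comm 1 (k₁ ℕ.+ k₂)))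
             (ℕ.+-monoʳ-≤ (k₁ ℕ.+ k₂) (ℕ.s≤s ℕ.z≤n)))

  threshold≤ : ∀ {L} → 1# + y ≤ L → threshold ≤ g * L
  threshold≤ {L} y≤L = begin
    threshold                     ≈⟨ x≈1*x (*-recip 0<g) ⟩
    (g * recip g 0<g) * threshold ≈⟨ *-assoc _ _ _ ⟩
    g * y                         ≤⟨ *-monoˡ-≤ (<⇒≤ 0<g) (≤-trans (≤-by 0≤1 (+-comm _ _)) y≤L) ⟩
    g * L ∎
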